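{- Let $q\ge5$ and let $G$ be a group of automorphisms of the Payne derived quadrangle $\mathcal{Q}^P$ of $W(q)$ which is contained in $\mathrm{PGL}(4,q)$ and acts regularly on the points of $\mathcal{Q}^P$. Then $G$ is conjugate (within $\mathrm{P\Gamma Sp}(4,q)_P$) to one of the groups in Construction A or Construction E described in the context.
   Context: Let $q=p^m$, $p$ prime. $V=\mathbb{F}_q^4$ carries the alternating form $(x,y)=x_1y_4-x_4y_1+x_2y_3-x_3y_2$; $W(q)$ has all points of $\mathrm{PG}(3,q)$ and the totally isotropic lines; $P=\langle(1,0,0,0)\rangle$. The Payne derived quadrangle $\mathcal{Q}^P$ has points $\langle(a,b,c,1)\rangle$ (points not in $P^\perp$) and as lines the totally isotropic lines not through $P$ and the lines $\langle P,Q\rangle$, $Q\notin P^\perp$. $\mathrm{P\Gamma Sp}(4,q)_P$ is the stabilizer of $P$ in $\mathrm{P\Gamma Sp}(4,q)$. A pair $(A,\sigma)$ denotes the map $x\mapsto x^\sigma A$, product $(A_1,\sigma_1)\circ(A_2,\sigma_2)=(A_1^{\sigma_2}A_2,\sigma_1\sigma_2)$. $E(a,b,c,t)$ is the matrix with rows $(1,0,0,0),(-c,1,0,0),(b-ct,t,1,0),(a,b,c,1)$. Given $T:\mathbb{F}_q^3\to\mathbb{F}_q$ and $\theta$, put $\mathfrak{g}_{a,b,c}=(E(a,b,c,T(a,b,c)),\theta_{a,b,c})$ and $G_{T,\theta}=\{\mathfrak{g}_{a,b,c}\}$. Construction A: $\theta\equiv1$, $T(a,b,c)=S_1(c)$ for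 a reduced linearized polynomial $S_1(X)=\sum_{i=0}^{m-1}s_iX^{p^i}$ over $\mathbb{F}_q$. Construction E: $q=2^m$, $m>1$; $\omega,\mu\in\mathbb{F}_q^*$; $(f_0,\dots,f_{m-1},s_0)\in\mathbb{F}_q^{m+1}$ with $f_0=0$, $\mu f_i=(\mu f_{m-i})^{2^i}$ for $1\le i\le m-1$, and $\sum_{j=1}^{m-1}\omega^{ -2^j+1}f_{m-j}^{2^j}=0$; define $s_{i+1}=\sum_{j=1}^{i}\omega^{ -2^j+1}f_{i+1-j}^{2^j}+\omega^{ -2^{i+1}+1}s_0^{2^{i+1}}$ for $0\le i\le m-2$. Set $\theta\equiv1$ and $T(a,b,c)=\omega\,\mathrm{tr}_{\mathbb{F}_q/\mathbb{F}_2}(\mu^2\omega(a+bc)+\mu b)+\sum_{i=0}^{m-1}s_ic^{2^i}+\omega\sum_{0\le i<j\le m-1}\mu^{2^i}f_{j-i}^{2^i}c^{2^i+2^j}$. -}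

module Defs where

open import Level using (0ℓ)
open import Data.Nat as ℕ using (ℕ; zero; suc; _≤_; _<_; _∸_)
open import Data.Nat.Primality using (Prime)
open import Data.Fin using (Fin; zero; suc)
open import Data.List using (List; length)
open import Data.List.Membership.Propositional using (_∈_)
open import Data.List.Relation.Unary.Unique.Propositional using (Unique)
open import Data.Product using (Σ; ∃; ∃-syntax; _×_; _,_)
open import Data.Sum using (_⊎_)
open import Function.Bundles using (_⇔_)
open import Relation.Binary.PropositionalEquality using (_≡_; _≢_)
open import Relation.Binary.Definitions using (DecidableEquality)
open import Algebra.Core using (Op₁; Op₂)
open import Algebra.Structures using (IsCommutativeRing)

record FiniteField : Set₁ where
  infixl 7 _*_
  infixl 6 _+_
  field
    Carrier   : Set
    _+_ _*_   : Op₂ Carrier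
    -_        : Op₁ Carrier
    0# 1#     : Carrier
    isCommutativeRing : IsCommutativeRing _≡_ _+_ _*_ -_ 0# 1#
    _⁻¹       : Op₁ Carrier
    ⁻¹-inverse : ∀ x → x ≢ 0# → x * (x ⁻¹) ≡ 1#
    0≢1       : 0# ≢ 1#
    _≟_       : DecidableEquality Carrier
    p m       : ℕ
    p-prime   : Prime p
    m-pos     : 1 ≤ m
    elements  : List Carrier
    elements-complete : ∀ x → x ∈ elements
    elements-unique   : Unique elements
    card      : length elements ≡ p ℕ.^ m

module Over (F : FiniteField) where
  open FiniteField F public

  infixl 6 _-_
  _-_ : Op₂ Carrier
  x - y = x + (- y)

  infixr 8 _^ᶠ_
  _^ᶠ_ : Carrier → ℕ → Carrier
  x ^ᶠ zero  = 1#
  x ^ᶠ suc n = x * (x ^ᶠ n)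

  Σ< : ℕ → (ℕ → Carrier) → Carrier
  Σ< zero    f = 0#
  Σ< (suc n) f = Σ< n f + f n

  record FieldAut : Set where
    field
      σ      : Carrier → Carrier
      σ⁻     : Carrier → Carrier
      σ-+    : ∀ x y → σ (x + y) ≡ σ x + σ y
      σ-*    : ∀ x y → σ (x * y) ≡ σ x * σ y
      σ-1    : σ 1# ≡ 1#
      σ-inv₁ : ∀ x → σ⁻ (σ x) ≡ x
      σ-inv₂ : ∀ x → σ (σ⁻ x) ≡ x

  -- Vectors of V = F^4 (row vectors) and 4×4 matrices.
  -- Coordinates x₁..x₄ of the paper are indices 0..3.

  Vec4 : Set
  Vec4 = Fin 4 → Carrier

  Mat4 : Set
  Mat4 = Fin 4 → Fin 4 → Carrier

  v4 : {A : Set} → A → A → A → A → Fin 4 → A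
  v4 x y z w zero                   = x
  v4 x y z w (suc zero)             = y
  v4 x y z w (suc (suc zero))       = z
  v4 x y z w (suc (suc (suc zero))) = w

  i0 i1 i2 i3 : Fin 4
  i0 = zero
  i1 = suc zero
  i2 = suc (suc zero)
  i3 = suc (suc (suc zero))

  _·ᵥ_ : Vec4 → Mat4 → Vec4
  (x ·ᵥ A) j = x i0 * A i0 j + x i1 * A i1 j + x i2 * A i2 j + x i3 * A i3 j

  _·ₘ_ : Mat4 → Mat4 → Mat4
  (A ·ₘ B) i = A i ·ᵥ B

  Id4 : Mat4
  Id4 = v4 (v4 1# 0# 0# 0#) (v4 0# 1# 0# 0#) (v4 0# 0# 1# 0#) (v4 0# 0# 0# 1#)

  _^σ_ : Mat4 → FieldAut → Mat4
  (A ^σ s) i j = FieldAut.σ s (A i j)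

  _≡ₘ_ : Mat4 → Mat4 → Set
  A ≡ₘ B = ∀ i j → A i j ≡ B i j

  -- equality up to a nonzero scalar (same element of PGL / same projective point)
  _≃ₘ_ : Mat4 → Mat4 → Set
  A ≃ₘ B = ∃[ λ' ] (λ' ≢ 0# × (∀ i j → A i j ≡ λ' * B i j))

  _∼ᵥ_ : Vec4 → Vec4 → Set
  x ∼ᵥ y = ∃[ λ' ] (λ' ≢ 0# × (∀ i → x i ≡ λ' * y i))

  Invertible : Mat4 → Set
  Invertible A = ∃[ B ] ((A ·ₘ B) ≡ₘ Id4)

  form : Vec4 → Vec4 → Carrier
  form x y = x i0 * y i3 - x i3 * y i0 + x i1 * y i2 - x i2 * y i1

  eP : Vec4
  eP = v4 1# 0# 0# 0#

  -- The Payne derived quadrangle Q^P.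
  -- Points: <(a,b,c,1)>, i.e. the points of PG(3,q) not in P^⊥.

  pt : Carrier → Carrier → Carrier → Vec4
  pt a b c = v4 a b c 1#

  IsQPPoint : Vec4 → Set
  IsQPPoint x = form eP x ≢ 0#

  -- Two points <u>,<v> of Q^P are collinear in Q^P iff they lie on a common
  -- line of Q^P: either the line <u,v> is totally isotropic (such a line
  -- never contains P, as u ∉ P^⊥), or the line <u,v> contains P (so it is
  -- the line <P,u>).  For u = v this holds trivially (the form is alternating).
  QPCollinear : Vec4 → Vec4 → Set
  QPCollinear u v =
    (form u v ≡ 0#) ⊎ (∃[ α ] ∃[ β ] (∀ i → α * u i + β * v i ≡ eP i))

  IsQPAut : Mat4 → Set
  IsQPAut A =
    Invertible A ×
    (∀ a b c → IsQPPoint (pt a b c ·ᵥ A)) ×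
    (∀ a b c a' b' c' →
       QPCollinear (pt a b c) (pt a' b' c')
         ⇔ QPCollinear (pt a b c ·ᵥ A) (pt a' b' c' ·ᵥ A))

  -- Subgroups of PGL(4,q), given by a predicate on representing matrices
  -- (group operations are understood up to nonzero scalars).

  IsPGLSubgroup : (Mat4 → Set) → Set
  IsPGLSubgroup G =
    (∃[ E ] (G E × E ≃ₘ Id4)) ×
    (∀ A B → G A → G B → ∃[ C ] (G C × C ≃ₘ (A ·ₘ B))) ×
    (∀ A → G A → ∃[ B ] (G B × (A ·ₘ B) ≃ₘ Id4))

  ActsRegularlyOnQPPoints : (Mat4 → Set) → Set
  ActsRegularlyOnQPPoints G =
    (∀ a b c a' b' c' → ∃[ A ] (G A × (pt a b c ·ᵥ A) ∼ᵥ pt a' b' c')) ×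
    (∀ a b c a' b' c' A B → G A → G B →
       (pt a b c ·ᵥ A) ∼ᵥ pt a' b' c' →
       (pt a b c ·ᵥ B) ∼ᵥ pt a' b' c' → A ≃ₘ B)

  -- PΓSp(4,q)_P : semilinear maps x ↦ x^σ A with A a similitude of the
  -- symplectic form (preserving it up to a nonzero scalar), fixing P.

  IsPΓSpP : Mat4 → FieldAut → Set
  IsPΓSpP A s =
    Invertible A ×
    (∃[ λ' ] (λ' ≢ 0# × (∀ x y → form (x ·ᵥ A) (y ·ᵥ A) ≡ λ' * form x y))) ×
    ((eP ·ᵥ A) ∼ᵥ eP)

  Emat : Carrier → Carrier → Carrier → Carrier → Mat4
  Emat a b c t =
    v4 (v4 1# 0# 0# 0#)
       (v4 (- c) 1# 0# 0#)
       (v4 (b - c * t) t 1# 0#)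
       (v4 a b c 1#)

  gT : (Carrier → Carrier → Carrier → Carrier) → Carrier → Carrier → Carrier → Mat4
  gT T a b c = Emat a b c (T a b c)

  -- G (a set of elements of PGL(4,q)) is conjugate by h = (A,σ) to the group
  -- G_{T,1}, i.e. h⁻¹ G h = G_{T,1}.  With the composition rule
  -- (A₁,σ₁)∘(A₂,σ₂) = (A₁^{σ₂}A₂, σ₁σ₂) this says: for g ∈ G and
  -- g' ∈ G_{T,1}, h⁻¹ g h = g' iff g∘h = h∘g', i.e. (g^σ A, σ) = (A g', σ)
  -- as elements of PΓL(4,q) (matrices equal up to a nonzero scalar).
  ConjugateTo : (Mat4 → Set) → Mat4 → FieldAut → (Carrier → Carrier → Carrier → Carrier) → Set
  ConjugateTo G A s T =
    (∀ g → G g → ∃[ a ] ∃[ b ] ∃[ c ] (((g ^σ s) ·ₘ A) ≃ₘ (A ·ₘ gT T a b c))) ×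
    (∀ a b c → ∃[ g ] (G g × ((g ^σ s) ·ₘ A) ≃ₘ (A ·ₘ gT T a b c)))

  T-A : (ℕ → Carrier) → Carrier → Carrier → Carrier → Carrier
  T-A s a b c = Σ< m (λ i → s i * c ^ᶠ (p ℕ.^ i))

  -- Construction E (q = 2^m, m > 1).

  ωpow : Carrier → ℕ → Carrier
  ωpow ω j = ω * (ω ⁻¹) ^ᶠ (2 ℕ.^ j)

  -- tr_{F_q/F_2}(x) = Σ_{i<m} x^{2^i}  (an element of F_2 ⊆ F_q)
  tr : Carrier → Carrier
  tr x = Σ< m (λ i → x ^ᶠ (2 ℕ.^ i))

  sE : Carrier → (ℕ → Carrier) → Carrier → ℕ → Carrier
  sE ω f s0 zero    = s0
  sE ω f s0 (suc i) =
    Σ< i (λ k → ωpow ω (suc k) * f (suc i ∸ suc k) ^ᶠ (2 ℕ.^ suc k))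
    + ωpow ω (suc i) * s0 ^ᶠ (2 ℕ.^ suc i)

  ConstrE-params : Carrier → Carrier → (ℕ → Carrier) → Carrier → Set
  ConstrE-params ω μ f s0 =
    (ω ≢ 0#) × (μ ≢ 0#) ×
    (f 0 ≡ 0#) ×
    (∀ i → 1 ≤ i → i ≤ m ∸ 1 → μ * f i ≡ (μ * f (m ∸ i)) ^ᶠ (2 ℕ.^ i)) ×
    (Σ< (m ∸ 1) (λ k → ωpow ω (suc k) * f (m ∸ suc k) ^ᶠ (2 ℕ.^ suc k)) ≡ 0#)

  T-E : Carrier → Carrier → (ℕ → Carrier) → Carrier →
        Carrier → Carrier → Carrier → Carrier
  T-E ω μ f s0 a b c =
    ω * tr (μ ^ᶠ 2 * ω * (a + b * c) + μ * b)
    + Σ< m (λ i → sE ω f s0 i * c ^ᶠ (2 ℕ.^ i))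
    + ω * Σ< m (λ j → Σ< j (λ i →
            μ ^ᶠ (2 ℕ.^ i) * f (j ∸ i) ^ᶠ (2 ℕ.^ i) * c ^ᶠ (2 ℕ.^ i ℕ.+ 2 ℕ.^ j)))

{-# OPTIONS --safe #-}

-- A collineation in G permutes the affine points (a , b , c , 1) and preserves the lines through P
-- and the planes u^⊥, so up to a scalar it is a similitude Sim W v fixing P, where v is the image of
-- the origin and W its action on the coordinates x₂, x₃.  Regularity makes W a function of v.
--
-- An element whose order is prime to p fixes the barycentre of an orbit, so G is a p-group, each W is
-- unipotent, and since the products W W′ are unipotent too, all W have a common fixed vector.  After
-- conjugation G consists of the matrices E(a,b,c,T(a,b,c)), and closure under multiplication says that
-- T is a homomorphism to (F , +) for the twisted group law on F³.
--
-- Hence T(a,b,c) = A(a + bc) + B(b) + S(c) with A and B additive.  For p odd A = B = 0 and S is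
-- additive, that is, given by a linearised polynomial.  For p = 2 and A ≠ 0 the plane c = 0 has image
-- {0 , ω}, which expresses A and B by the trace; then S is a quadratic form whose polarisation is
-- Tr(μ c f(z)) with f² = ω S + S², and comparing coefficients of linearised polynomials gives
-- the relations of Construction E.

module Submission where

open import Defs
open import Level using (0ℓ)
open import Algebra.Bundles using (CommutativeRing; CommutativeMonoid; RawRing; Semiring)
import Algebra.Solver.Ring
open import Algebra.Solver.Ring.AlmostCommutativeRing using (_-Raw-AlmostCommutative⟶_; fromCommutativeRing)
open import Data.Bool.Base using (Bool; true; false; _xor_; _∧_)
import Data.Bool.Properties as Bool
open import Data.Fin.Base as Fin using (Fin; zero; suc; toℕ; inject₁; combine)
open import Data.Fin.Properties using (toℕ-fromℕ; toℕ-inject₁; toℕ<n; pigeonhole; combine-injective)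
open import Data.Integer.Base as ℤ using ()
import Data.Integer.Properties as ℤ
open import Data.List.Base using (List; []; _∷_; foldr; map; length; lookup; applyUpTo)
open import Data.List.Properties using (length-applyUpTo)
open import Data.List.Membership.Propositional using (_∈_; _∉_)
open import Data.List.Membership.Propositional.Properties using (∈-map⁺; ∈-applyUpTo⁻)
open import Data.List.Membership.Propositional.Properties.WithK using (unique∧set⇒bag)
import Data.List.Membership.DecPropositional as DecMembership
open import Data.List.Relation.Binary.BagAndSetEquality using (∼bag⇒↭)
open import Data.List.Relation.Binary.Permutation.Propositional using (_↭_; ↭⇒↭ₛ)
import Data.List.Relation.Binary.Permutation.Setoid.Properties as ↭ₛ
open import Data.List.Relation.Unary.All as All using (All; []; _∷_; all?)
import Data.List.Relation.Unary.All.Properties as All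
open import Data.List.Relation.Unary.AllPairs using ([]; _∷_)
open import Data.List.Relation.Unary.Any as Any using (here; there)
open import Data.List.Relation.Unary.Any.Properties using (lookup-index)
open import Data.List.Relation.Unary.Unique.Propositional using (Unique)
import Data.List.Relation.Unary.Unique.Propositional.Properties as Unique
open import Data.Maybe.Base as Maybe using ()
open import Data.Nat.Base as ℕ using (ℕ; zero; suc; _≤_; _<_; _∸_; z≤n; s≤s; z<s; _!)
import Data.Nat.Properties as ℕ
open import Data.Nat.Combinatorics using (nCn≡1; k![n∸k]!∣n!) renaming (_C_ to _choose_)
open import Data.Nat.Combinatorics.Specification using (nCk≡n!/k![n-k]!)
open import Data.Nat.Coprimality using (Coprime; coprime-Bézout)
open import Data.Nat.DivMod using (m/n*n≡m)
open import Data.Nat.Divisibility using (_∣_; divides; _∣?_; ∣⇒≤; ∣1⇒≡1; m∣m*n)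
open import Data.Nat.GCD using (module Bézout)
open import Data.Nat.Induction using (<-rec)
open import Data.Nat.Primality using (Prime; euclidsLemma; ¬prime[0]; ¬prime[1]; prime⇒nonZero; prime⇒nonTrivial; prime⇒irreducible)
open import Data.Product.Base using (_×_; _,_; proj₁; proj₂; ∃-syntax; swap)
open import Data.Sum.Base using (_⊎_; inj₁; inj₂; [_,_]′)
open import Data.Vec.Functional using (init; last)
open import Function.Base using (_∘_; id)
open import Function.Bundles using (Equivalence; mk⇔)
open import Relation.Binary.PropositionalEquality using (_≡_; _≢_; refl; sym; trans; cong; cong₂; subst; isEquivalence; module ≡-Reasoning) renaming (setoid to ≡-setoid)
open import Relation.Nullary using (¬_; Dec; yes; no; contradiction)
open import Relation.Nullary.Decidable using (dec⇒maybe; decidable-stable; _×-dec_)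

-- `G` is a predicate on matrices up to scalars, without an enumeration or an order, so every
-- group-theoretic step is made on single elements, through the bijection of the group with F³ that
-- regularity provides. The common fixed vector comes from the identity tr (D D′) = 0 for D = W - 1
-- and D′ = W′ - 1.
--
-- Collinearity does not tell totally isotropic lines from lines through P. A collineation might a
-- priori exchange the two kinds, and the normal form of its matrix has to exclude this.
--
-- In characteristic two squaring is bijective and does not change the trace. Therefore the
-- corrections A(c² S(z)) and B(c S(z)) merge under one trace, and a square root can be taken; this
-- is the origin of f. A quadratic form Q with values in F₂ and the same polarisation as S / ω
-- splits S into an additive part and ω Q. Since x ↦ ω x + x² kills ω Q, the equation f² = ω S + S²
-- becomes a recursion for the coefficients s_i. Their indices are cyclic because x^q = x, and the
-- last condition of Construction E says that the recursion closes.

-- Ring solvers with coefficients in the integers and in F₂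

module IntegerSolver (R : CommutativeRing 0ℓ 0ℓ) where
  open import Data.Integer.Base using (ℤ; +_; -[1+_])
  open CommutativeRing R renaming (refl to ≈-refl; sym to ≈-sym; trans to ≈-trans; reflexive to ≈-reflexive)
  open import Algebra.Properties.Semiring.Mult.TCOptimised semiring using (1+×; ×-homo-+; ×1-homo-*) renaming (_×_ to _·_)
  open import Algebra.Properties.Ring ring
  open import Algebra.Properties.AbelianGroup +-abelianGroup
  open import Algebra.Properties.CommutativeSemigroup +-commutativeSemigroup using (interchange)
  open import Relation.Binary.Reasoning.Setoid setoid

  fromℤ : ℤ → Carrier
  fromℤ (+ n)    = n · 1#
  fromℤ -[1+ n ] = - (suc n · 1#)

  fromℤ-⊖ : ∀ m n → fromℤ (m ℤ.⊖ n) ≈ m · 1# - n · 1#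
  fromℤ-⊖ m zero = begin
    m · 1#            ≈⟨ +-identityʳ _ ⟨
    m · 1# + 0#       ≈⟨ +-congˡ ε⁻¹≈ε ⟨
    m · 1# - 0#       ∎
  fromℤ-⊖ zero (suc n) = ≈-sym (+-identityˡ _)
  fromℤ-⊖ (suc m) (suc n) = begin
    fromℤ (suc m ℤ.⊖ suc n)                ≡⟨ cong fromℤ (ℤ.[1+m]⊖[1+n]≡m⊖n m n) ⟩
    fromℤ (m ℤ.⊖ n)                        ≈⟨ fromℤ-⊖ m n ⟩
    m · 1# - n · 1#                        ≈⟨ +-identityˡ _ ⟨
    0# + (m · 1# - n · 1#)                 ≈⟨ +-congʳ (-‿inverseʳ 1#) ⟨
    (1# - 1#) + (m · 1# - n · 1#)          ≈⟨ interchange _ _ _ _ ⟩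
    (1# + m · 1#) + (- 1# - n · 1#)        ≈⟨ +-congˡ (⁻¹-∙-comm _ _) ⟩
    (1# + m · 1#) - (1# + n · 1#)          ≈⟨ +-cong (1+× m 1#) (-‿cong (1+× n 1#)) ⟨
    suc m · 1# - suc n · 1#                ∎

  fromℤ-+ : ∀ i j → fromℤ (i ℤ.+ j) ≈ fromℤ i + fromℤ j
  fromℤ-+ (+ m)    (+ n)    = ×-homo-+ 1# m n
  fromℤ-+ (+ m)    -[1+ n ] = fromℤ-⊖ m (suc n)
  fromℤ-+ -[1+ m ] (+ n)    = ≈-trans (fromℤ-⊖ n (suc m)) (+-comm _ _)
  fromℤ-+ -[1+ m ] -[1+ n ] = begin
    - (suc (suc (m ℕ.+ n)) · 1#)        ≡⟨ cong (λ k → - (k · 1#)) (ℕ.+-suc (suc m) n) ⟨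
    - ((suc m ℕ.+ suc n) · 1#)          ≈⟨ -‿cong (×-homo-+ 1# (suc m) (suc n)) ⟩
    - (suc m · 1# + suc n · 1#)         ≈⟨ ⁻¹-∙-comm _ _ ⟨
    - (suc m · 1#) - (suc n · 1#)       ∎

  fromℤ-neg : ∀ i → fromℤ (ℤ.- i) ≈ - fromℤ i
  fromℤ-neg (+ zero)  = ≈-sym ε⁻¹≈ε
  fromℤ-neg (+ suc n) = ≈-refl
  fromℤ-neg -[1+ n ]  = ≈-sym (⁻¹-involutive _)

  fromℤ-pos* : ∀ m j → fromℤ (+ m ℤ.* j) ≈ fromℤ (+ m) * fromℤ j
  fromℤ-pos* m (+ n) = begin
    fromℤ (+ m ℤ.* + n)  ≡⟨ cong fromℤ (ℤ.pos-* m n) ⟨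
    (m ℕ.* n) · 1#       ≈⟨ ×1-homo-* m n ⟩
    m · 1# * n · 1#      ∎
  fromℤ-pos* m -[1+ n ] = begin
    fromℤ (+ m ℤ.* ℤ.- (+ suc n))  ≡⟨ cong fromℤ (ℤ.neg-distribʳ-* (+ m) (+ suc n)) ⟨
    fromℤ (ℤ.- (+ m ℤ.* + suc n))  ≈⟨ fromℤ-neg (+ m ℤ.* + suc n) ⟩
    - fromℤ (+ m ℤ.* + suc n)      ≈⟨ -‿cong (fromℤ-pos* m (+ suc n)) ⟩
    - (m · 1# * suc n · 1#)        ≈⟨ -‿distribʳ-* _ _ ⟩
    m · 1# * - (suc n · 1#)        ∎

  fromℤ-* : ∀ i j → fromℤ (i ℤ.* j) ≈ fromℤ i * fromℤ j
  fromℤ-* (+ m)    j = fromℤ-pos* m j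
  fromℤ-* -[1+ m ] j = begin
    fromℤ (ℤ.- (+ suc m) ℤ.* j)    ≡⟨ cong fromℤ (ℤ.neg-distribˡ-* (+ suc m) j) ⟨
    fromℤ (ℤ.- (+ suc m ℤ.* j))    ≈⟨ fromℤ-neg (+ suc m ℤ.* j) ⟩
    - fromℤ (+ suc m ℤ.* j)        ≈⟨ -‿cong (fromℤ-pos* (suc m) j) ⟩
    - (suc m · 1# * fromℤ j)       ≈⟨ -‿distribˡ-* _ _ ⟩
    - (suc m · 1#) * fromℤ j       ∎

  fromℤ-morphism : ℤ.+-*-rawRing -Raw-AlmostCommutative⟶ fromCommutativeRing R
  fromℤ-morphism = record
    { ⟦_⟧ = fromℤ ; +-homo = fromℤ-+ ; *-homo = fromℤ-* ; -‿homo = fromℤ-neg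
    ; 0-homo = ≈-refl ; 1-homo = ≈-refl }

  open Algebra.Solver.Ring ℤ.+-*-rawRing (fromCommutativeRing R) fromℤ-morphism
    (λ i j → Maybe.map (λ e → ≈-reflexive (cong fromℤ e)) (dec⇒maybe (i ℤ.≟ j))) public
    using (solve; _:=_; _:+_; _:*_; _:-_; :-_; Polynomial; con)

  :0 :1 :2 : ∀ {n} → Polynomial n
  :0 = con (+ 0)
  :1 = con (+ 1)
  :2 = con (+ 2)

module CharTwoSolver (R : CommutativeRing 0ℓ 0ℓ)
  (1+1≈0 : CommutativeRing._≈_ R (CommutativeRing._+_ R (CommutativeRing.1# R) (CommutativeRing.1# R)) (CommutativeRing.0# R)) where
  open CommutativeRing R renaming (refl to ≈-refl; sym to ≈-sym; trans to ≈-trans; reflexive to ≈-reflexive)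
  open import Algebra.Properties.AbelianGroup +-abelianGroup using (inverseʳ-unique; ε⁻¹≈ε)

  fromBool : Bool → Carrier
  fromBool true  = 1#
  fromBool false = 0#

  -- The field F₂. With these coefficients x + x normalises to 0 and signs disappear.
  booleanRing : RawRing 0ℓ 0ℓ
  booleanRing = record
    { Carrier = Bool ; _≈_ = _≡_ ; _+_ = _xor_ ; _*_ = _∧_ ; -_ = λ b → b ; 0# = false ; 1# = true }

  fromBool-morphism : booleanRing -Raw-AlmostCommutative⟶ fromCommutativeRing R
  fromBool-morphism = record
    { ⟦_⟧    = fromBool
    ; +-homo = λ where
        true  true  → ≈-sym 1+1≈0
        true  false → ≈-sym (+-identityʳ 1#)
        false b     → ≈-sym (+-identityˡ _)
    ; *-homo = λ where
        true  b → ≈-sym (*-identityˡ _)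
        false b → ≈-sym (zeroˡ _)
    ; -‿homo = λ where
        true  → inverseʳ-unique 1# 1# 1+1≈0
        false → ≈-sym ε⁻¹≈ε
    ; 0-homo = ≈-refl
    ; 1-homo = ≈-refl }

  open Algebra.Solver.Ring booleanRing (fromCommutativeRing R) fromBool-morphism
    (λ b c → Maybe.map (λ e → ≈-reflexive (cong fromBool e)) (dec⇒maybe (b Bool.≟ c))) public
    using () renaming (solve to solve₂; _:=_ to _:=₂_; Polynomial to Polynomial₂; con to con₂; _:+_ to _:+₂_; _:*_ to _:*₂_; _:-_ to _:-₂_; :-_ to :-₂_)

  :0₂ :1₂ : ∀ {n} → Polynomial₂ n
  :0₂ = con₂ false
  :1₂ = con₂ true

-- Binomial coefficients modulo a prime and the Frobenius map

prime∤! : ∀ {p k} → Prime p → k < p → ¬ p ∣ k !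
prime∤! {k = zero}  pp k<p p∣1 = ¬prime[1] (subst Prime (∣1⇒≡1 p∣1) pp)
prime∤! {k = suc k} pp k<p p∣! with euclidsLemma (suc k) (k !) pp p∣!
... | inj₁ p∣1+k = ℕ.<⇒≱ k<p (∣⇒≤ p∣1+k)
... | inj₂ p∣k!  = prime∤! pp (ℕ.<-trans (ℕ.n<1+n k) k<p) p∣k!

-- The prime divides p! = C(p, k) k! (p - k)!, but neither of the two factorials, whose arguments
-- are less than p.
prime∣C : ∀ {p k} → Prime p → 0 < k → k < p → p ∣ p choose k
prime∣C {zero}  {k} pp 0<k k<p = contradiction pp ¬prime[0]
prime∣C {p@(suc n)} {k} pp 0<k k<p
  with euclidsLemma (p choose k) (k ! ℕ.* (p ∸ k) !) pp (subst (p ∣_) (sym C*≡!) (m∣m*n (n !)))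
  where
  instance _ = ℕ._!*_!≢0 k (p ∸ k)
  C*≡! : (p choose k) ℕ.* (k ! ℕ.* (p ∸ k) !) ≡ p !
  C*≡! = trans (cong (ℕ._* (k ! ℕ.* (p ∸ k) !)) (nCk≡n!/k![n-k]! (ℕ.<⇒≤ k<p)))
               (m/n*n≡m (k![n∸k]!∣n! (ℕ.<⇒≤ k<p)))
... | inj₁ p∣C = p∣C
... | inj₂ p∣! with euclidsLemma (k !) ((p ∸ k) !) pp p∣!
...   | inj₁ p∣k! = contradiction p∣k! (prime∤! pp k<p)
...   | inj₂ p∣k! = contradiction p∣k! (prime∤! pp (ℕ.∸-monoʳ-< {o = 0} 0<k (ℕ.<⇒≤ k<p)))

module Frobenius {c ℓ} (S : Semiring c ℓ) where
  open Semiring S renaming (refl to ≈-refl; sym to ≈-sym; trans to ≈-trans)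
  open import Algebra.Properties.Semiring.Exp S
  open import Algebra.Properties.Semiring.Mult S using (×-assocˡ) renaming (_×_ to _·_)
  open import Algebra.Properties.Semiring.Sum S
  open import Relation.Binary.Reasoning.Setoid setoid

  -- Stated for commuting elements of any semiring, because it is applied both to the field and to 2
  -- × 2 matrices.
  frobenius : ∀ {p} → Prime p → (∀ z → p · z ≈ 0#) →
              ∀ x y → x * y ≈ y * x → (x + y) ^ p ≈ x ^ p + y ^ p
  frobenius {zero} pp _ = contradiction pp ¬prime[0]
  frobenius {p@(suc n)} pp p·≈0 x y xy≈yx = begin
    (x + y) ^ p                                        ≈⟨ theorem xy≈yx p ⟩
    binomialTerm p Fin.zero + sum (binomialTerm p ∘ Fin.suc)
      ≈⟨ +-cong (≈-trans (+-identityʳ _) (*-identityˡ _)) (sum-init-last (binomialTerm p ∘ Fin.suc)) ⟩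
    y ^ p + (sum (init (binomialTerm p ∘ Fin.suc)) + last (binomialTerm p ∘ Fin.suc))
      ≈⟨ +-congˡ (+-cong (≈-trans (sum-cong-≋ middle) (sum-replicate-zero n)) top) ⟩
    y ^ p + (0# + x ^ p)                               ≈⟨ +-congˡ (+-identityˡ _) ⟩
    y ^ p + x ^ p                                      ≈⟨ +-comm _ _ ⟩
    x ^ p + y ^ p                                      ∎
    where
    open import Algebra.Properties.Semiring.Binomial S x y
    middle : ∀ i → binomialTerm p (Fin.suc (inject₁ i)) ≈ 0#
    middle i with prime∣C {p} {suc (toℕ (inject₁ i))} pp z<s (s≤s (subst (ℕ._< n) (sym (toℕ-inject₁ i)) (toℕ<n i)))
    ... | divides q eq = begin
      (p choose suc (toℕ (inject₁ i))) · t  ≡⟨ cong (_· t) (trans eq (ℕ.*-comm q p)) ⟩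
      (p ℕ.* q) · t                    ≈⟨ ×-assocˡ t p q ⟨
      p · (q · t)                      ≈⟨ p·≈0 _ ⟩
      0#                               ∎
      where t = binomial p (Fin.suc (inject₁ i))
    top : last (binomialTerm p ∘ Fin.suc) ≈ x ^ p
    top rewrite toℕ-fromℕ n | nCn≡1 p | ℕ.n∸n≡0 n =
      ≈-trans (+-identityʳ _) (*-identityʳ _)

-- Arithmetic, characteristic and Fermat's theorem in a finite field

module FieldArithmetic (F : FiniteField) where
  open Over F

  commutativeRing : CommutativeRing 0ℓ 0ℓ
  commutativeRing = record { isCommutativeRing = isCommutativeRing }

  open CommutativeRing commutativeRing public
    using ( +-congˡ; +-congʳ; *-congˡ; *-congʳ; +-assoc; +-comm; +-identityˡ; +-identityʳ; -‿inverseˡ; -‿inverseʳ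
          ; *-assoc; *-comm; *-identityˡ; *-identityʳ; distribˡ; distribʳ; zeroˡ; zeroʳ
          ; semiring; commutativeSemiring; ring
          ; +-commutativeMonoid; *-commutativeMonoid )
  open IntegerSolver commutativeRing public
  open import Algebra.Properties.Semiring.Mult semiring public
    using (×-homo-+; ×-assocˡ; ×1-homo-*; ×-assoc-*) renaming (_×_ to _·_)
  import Algebra.Properties.Semiring.Exp semiring as Exp
  open import Algebra.Properties.CommutativeSemiring.Exp commutativeSemiring using (^-distrib-*)
  open import Algebra.Properties.Ring ring public using (x+x≈x⇒x≈0)

  ^≡^ᶠ : ∀ x n → x Exp.^ n ≡ x ^ᶠ n
  ^≡^ᶠ x zero    = refl
  ^≡^ᶠ x (suc n) = cong (x *_) (^≡^ᶠ x n)

  ^ᶠ-+ : ∀ x m n → x ^ᶠ (m ℕ.+ n) ≡ x ^ᶠ m * x ^ᶠ n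
  ^ᶠ-+ x m n rewrite sym (^≡^ᶠ x m) | sym (^≡^ᶠ x n) | sym (^≡^ᶠ x (m ℕ.+ n)) = Exp.^-homo-* x m n

  ^ᶠ-* : ∀ x m n → (x ^ᶠ m) ^ᶠ n ≡ x ^ᶠ (m ℕ.* n)
  ^ᶠ-* x m n rewrite sym (^≡^ᶠ (x ^ᶠ m) n) | sym (^≡^ᶠ x m) | sym (^≡^ᶠ x (m ℕ.* n)) = Exp.^-assocʳ x m n

  *-^ᶠ : ∀ x y n → (x * y) ^ᶠ n ≡ x ^ᶠ n * y ^ᶠ n
  *-^ᶠ x y n rewrite sym (^≡^ᶠ x n) | sym (^≡^ᶠ y n) | sym (^≡^ᶠ (x * y) n) = ^-distrib-* x y n

  1^ᶠ : ∀ n → 1# ^ᶠ n ≡ 1#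
  1^ᶠ zero    = refl
  1^ᶠ (suc n) = trans (*-identityˡ _) (1^ᶠ n)

  x^1 : ∀ x → x ^ᶠ 1 ≡ x
  x^1 = *-identityʳ

  1≢0 : 1# ≢ 0#
  1≢0 1≡0 = 0≢1 (sym 1≡0)

  ⁻¹-inverseˡ : ∀ x → x ≢ 0# → x ⁻¹ * x ≡ 1#
  ⁻¹-inverseˡ x x≢0 = trans (*-comm _ _) (⁻¹-inverse x x≢0)

  *-cancelˡ : ∀ z x y → z ≢ 0# → z * x ≡ z * y → x ≡ y
  *-cancelˡ z x y z≢0 zx≡zy = trans (sym (undo x)) (trans (cong (z ⁻¹ *_) zx≡zy) (undo y))
    where
    undo : ∀ w → z ⁻¹ * (z * w) ≡ w
    undo w = trans (sym (*-assoc _ _ _)) (trans (cong (_* w) (⁻¹-inverseˡ z z≢0)) (*-identityˡ w))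

  x*y≡0⇒y≡0 : ∀ x y → x ≢ 0# → x * y ≡ 0# → y ≡ 0#
  x*y≡0⇒y≡0 x y x≢0 xy≡0 = *-cancelˡ x y 0# x≢0 (trans xy≡0 (sym (zeroʳ x)))

  x*y≡0⇒x≡0⊎y≡0 : ∀ x y → x * y ≡ 0# → x ≡ 0# ⊎ y ≡ 0#
  x*y≡0⇒x≡0⊎y≡0 x y xy≡0 with x ≟ 0#
  ... | yes x≡0 = inj₁ x≡0
  ... | no x≢0  = inj₂ (x*y≡0⇒y≡0 x y x≢0 xy≡0)

  *-nonzero : ∀ {x y} → x ≢ 0# → y ≢ 0# → x * y ≢ 0#
  *-nonzero x≢0 y≢0 xy≡0 = y≢0 (x*y≡0⇒y≡0 _ _ x≢0 xy≡0)

  ^ᶠ≡0⇒≡0 : ∀ x n → x ^ᶠ n ≡ 0# → x ≡ 0#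
  ^ᶠ≡0⇒≡0 x zero    1≡0 = contradiction 1≡0 1≢0
  ^ᶠ≡0⇒≡0 x (suc n) eq with x*y≡0⇒x≡0⊎y≡0 x (x ^ᶠ n) eq
  ... | inj₁ x≡0 = x≡0
  ... | inj₂ eq′ = ^ᶠ≡0⇒≡0 x n eq′

  ⁻¹-nonzero : ∀ {x} → x ≢ 0# → x ⁻¹ ≢ 0#
  ⁻¹-nonzero {x} x≢0 eq = 1≢0 (trans (sym (⁻¹-inverse x x≢0)) (trans (cong (x *_) eq) (zeroʳ x)))

  x-y≡0⇒x≡y : ∀ x y → x - y ≡ 0# → x ≡ y
  x-y≡0⇒x≡y x y eq = trans (solve 2 (λ x y → x := (x :- y) :+ y) refl x y) (trans (cong (_+ y) eq) (+-identityˡ y))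

  x≡y⇒x-y≡0 : ∀ x y → x ≡ y → x - y ≡ 0#
  x≡y⇒x-y≡0 x y eq = trans (cong (_- y) eq) (-‿inverseʳ y)

  +-cancelʳ : ∀ z x y → x + z ≡ y + z → x ≡ y
  +-cancelʳ z x y eq = trans (solve 2 (λ x z → x := (x :+ z) :- z) refl x z) (trans (cong (_- z) eq) (solve 2 (λ y z → (y :+ z) :- z := y) refl y z))

  -- Both lists are free of duplicates and contain the whole field. Sums and products over the field
  -- can thus be reindexed by a bijection.
  map-elements-↭ : ∀ (f g : Carrier → Carrier) → (∀ x → f (g x) ≡ x) → (∀ x → g (f x) ≡ x) →
                   map f elements ↭ elements
  map-elements-↭ f g fg gf = ∼bag⇒↭ (unique∧set⇒bag
    (Unique.map⁺ (λ {x} {y} eq → trans (sym (gf x)) (trans (cong g eq) (gf y))) elements-unique)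
    elements-unique
    (λ {x} → mk⇔ (λ _ → elements-complete x)
                 (λ _ → subst (_∈ map f elements) (fg x) (∈-map⁺ f (elements-complete (g x))))))

  module Invariance (M : CommutativeMonoid 0ℓ 0ℓ) where
    open CommutativeMonoid M using (_∙_; ε; _≈_)
    fold-invariant : ∀ (f g : Carrier → Carrier) (h : Carrier → CommutativeMonoid.Carrier M) →
      (∀ x → f (g x) ≡ x) → (∀ x → g (f x) ≡ x) →
      foldr _∙_ ε (map h (map f elements)) ≈ foldr _∙_ ε (map h elements)
    fold-invariant f g h fg gf = ↭ₛ.foldr-commMonoid (CommutativeMonoid.setoid M)
      (CommutativeMonoid.isCommutativeMonoid M)
      (↭ₛ.map⁺ (≡-setoid Carrier) (CommutativeMonoid.setoid M) (λ { refl → CommutativeMonoid.refl M })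
         (↭⇒↭ₛ (map-elements-↭ f g fg gf)))

  -- Translation by 1 permutes the field, so it preserves the sum of all elements, yet it adds 1 to
  -- each of the q terms.
  p^m·1≡0 : (p ℕ.^ m) · 1# ≡ 0#
  p^m·1≡0 = +-cancelʳ Σ₁ _ _ (trans (sym shifted) (trans invariant (sym (+-identityˡ Σ₁))))
    where
    sumOf : List Carrier → Carrier
    sumOf = foldr _+_ 0#
    Σ₁ = sumOf (map (λ x → x) elements)
    invariant : sumOf (map (λ x → x) (map (_+ 1#) elements)) ≡ Σ₁
    invariant = Invariance.fold-invariant +-commutativeMonoid (_+ 1#) (_- 1#) (λ x → x)
      (λ x → (solve 1 (λ x → x :- :1 :+ :1 := x) refl x)) (λ x → (solve 1 (λ x → x :+ :1 :- :1 := x) refl x))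
    go : ∀ xs → sumOf (map (λ x → x) (map (_+ 1#) xs)) ≡ length xs · 1# + sumOf (map (λ x → x) xs)
    go []       = sym (+-identityˡ 0#)
    go (x ∷ xs) = trans (cong (x + 1# +_) (go xs))
      (solve 3 (λ x n s → x :+ :1 :+ (n :+ s) := :1 :+ n :+ (x :+ s)) refl x (length xs · 1#) (sumOf (map (λ x → x) xs)))
    shifted : sumOf (map (λ x → x) (map (_+ 1#) elements)) ≡ (p ℕ.^ m) · 1# + Σ₁
    shifted = trans (go elements) (cong (λ n → n · 1# + Σ₁) card)

  -- The m-th power of p · 1 is q · 1 = 0, and a field has no nilpotent elements.
  p·1≡0 : p · 1# ≡ 0#
  p·1≡0 = ^ᶠ≡0⇒≡0 (p · 1#) m (trans (go m) p^m·1≡0)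
    where
    go : ∀ n → (p · 1#) ^ᶠ n ≡ (p ℕ.^ n) · 1#
    go zero    = sym (+-identityʳ 1#)
    go (suc n) = trans (cong (p · 1# *_) (go n)) (sym (×1-homo-* p (p ℕ.^ n)))

  p·x≡0 : ∀ x → p · x ≡ 0#
  p·x≡0 x = trans (cong (p ·_) (sym (*-identityˡ x)))
    (trans (sym (×-assoc-* p 1# x)) (trans (cong (_* x) p·1≡0) (zeroˡ x)))

  frob-+ : ∀ x y → (x + y) ^ᶠ p ≡ x ^ᶠ p + y ^ᶠ p
  frob-+ x y rewrite sym (^≡^ᶠ x p) | sym (^≡^ᶠ y p) | sym (^≡^ᶠ (x + y) p) =
    Frobenius.frobenius semiring p-prime p·x≡0 x y (*-comm x y)

  -- Fermat: compare the products of all nonzero elements before and after scaling by a.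
  private
    unit-part : Carrier → Carrier
    unit-part x with x ≟ 0#
    ... | yes _ = 1#
    ... | no  _ = x

    unit-part-0 : unit-part 0# ≡ 1#
    unit-part-0 with 0# ≟ 0#
    ... | yes _  = refl
    ... | no 0≢0 = contradiction refl 0≢0

    unit-part-≢0 : ∀ {x} → x ≢ 0# → unit-part x ≡ x
    unit-part-≢0 {x} x≢0 with x ≟ 0#
    ... | yes x≡0 = contradiction x≡0 x≢0
    ... | no _    = refl

    unit-part-nonzero : ∀ x → unit-part x ≢ 0#
    unit-part-nonzero x with x ≟ 0#
    ... | yes _  = 1≢0
    ... | no x≢0 = x≢0

    ∏ : List Carrier → Carrier
    ∏ xs = foldr _*_ 1# (map unit-part xs)

    ∏-nonzero : ∀ xs → ∏ xs ≢ 0#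
    ∏-nonzero []       = 1≢0
    ∏-nonzero (x ∷ xs) = *-nonzero (unit-part-nonzero x) (∏-nonzero xs)

    module _ (a : Carrier) (a≢0 : a ≢ 0#) where
      scale-∷ : ∀ x xs → x ≢ 0# → ∀ b n → n * ∏ xs ≡ b * ∏ (map (a *_) xs) →
                a * n * ∏ (x ∷ xs) ≡ b * ∏ (map (a *_) (x ∷ xs))
      scale-∷ x xs x≢0 b n eq
        rewrite unit-part-≢0 x≢0 | unit-part-≢0 (*-nonzero a≢0 x≢0) = begin
          a * n * (x * ∏ xs)              ≡⟨ (solve 4 (λ a n x q → a :* n :* (x :* q) := a :* x :* (n :* q)) refl a n x (∏ xs)) ⟩
          a * x * (n * ∏ xs)              ≡⟨ cong (a * x *_) eq ⟩
          a * x * (b * ∏ (map (a *_) xs)) ≡⟨ (solve 3 (λ k b q → k :* (b :* q) := b :* (k :* q)) refl (a * x) b (∏ (map (a *_) xs))) ⟩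
          b * (a * x * ∏ (map (a *_) xs)) ∎
        where open ≡-Reasoning

      scale-0∉ : ∀ xs → 0# ∉ xs → a ^ᶠ length xs * ∏ xs ≡ 1# * ∏ (map (a *_) xs)
      scale-0∉ []       _   = refl
      scale-0∉ (x ∷ xs) 0∉ = scale-∷ x xs (λ x≡0 → 0∉ (here (sym x≡0))) 1# _ (scale-0∉ xs (0∉ ∘ there))

      -- The entry 0 counts in the exponent but contributes the factor 1 to both products. This
      -- leaves one spare `a`, the difference between the exponents q and q - 1.
      scale-0∈ : ∀ xs → Unique xs → 0# ∈ xs → a ^ᶠ length xs * ∏ xs ≡ a * ∏ (map (a *_) xs)
      scale-0∈ (_ ∷ xs) uniq (here refl) rewrite zeroʳ a | unit-part-0 =
        trans (solve 3 (λ a n q → a :* n :* (:1 :* q) := a :* (n :* q)) refl a (a ^ᶠ length xs) (∏ xs))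
              (cong (a *_) (scale-0∉ xs (Unique.Unique[x∷xs]⇒x∉xs uniq)))
      scale-0∈ (x ∷ xs) uniq@(_ ∷ uniq′) (there 0∈) = scale-∷ x xs
        (λ x≡0 → Unique.Unique[x∷xs]⇒x∉xs uniq (subst (_∈ xs) (sym x≡0) 0∈)) a _ (scale-0∈ xs uniq′ 0∈)

  fermat : ∀ a → a ^ᶠ (p ℕ.^ m) ≡ a
  fermat a with a ≟ 0#
  ... | yes refl = go (p ℕ.^ m) (ℕ.m^n>0 p {{prime⇒nonZero p-prime}} m)
    where
    go : ∀ n → 0 < n → 0# ^ᶠ n ≡ 0#
    go (suc n) _ = zeroˡ _
  ... | no a≢0 = *-cancelˡ (∏ elements) _ _ (∏-nonzero elements) (begin
    ∏ elements * a ^ᶠ (p ℕ.^ m)     ≡⟨ *-comm _ _ ⟩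
    a ^ᶠ (p ℕ.^ m) * ∏ elements     ≡⟨ cong (λ n → a ^ᶠ n * ∏ elements) card ⟨
    a ^ᶠ length elements * ∏ elements  ≡⟨ scale-0∈ a a≢0 elements elements-unique (elements-complete 0#) ⟩
    a * ∏ (map (a *_) elements)     ≡⟨ cong (a *_) invariant ⟩
    a * ∏ elements                  ≡⟨ *-comm _ _ ⟩
    ∏ elements * a                  ∎)
    where
    open ≡-Reasoning
    invariant : ∏ (map (a *_) elements) ≡ ∏ elements
    invariant = Invariance.fold-invariant *-commutativeMonoid (a *_) (a ⁻¹ *_) unit-part
      (λ x → trans (sym (*-assoc _ _ _)) (trans (cong (_* x) (⁻¹-inverse a a≢0)) (*-identityˡ x)))
      (λ x → trans (sym (*-assoc _ _ _)) (trans (cong (_* x) (⁻¹-inverseˡ a a≢0)) (*-identityˡ x)))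

-- Additive maps and linearised polynomials

module LinearisedPolynomials (F : FiniteField) where
  open Over F
  open FieldArithmetic F

  Σ<-cong : ∀ n {f g} → (∀ i → i < n → f i ≡ g i) → Σ< n f ≡ Σ< n g
  Σ<-cong zero    eq = refl
  Σ<-cong (suc n) eq = cong₂ _+_ (Σ<-cong n (λ i i<n → eq i (ℕ.m<n⇒m<1+n i<n))) (eq n (ℕ.n<1+n n))

  Σ<-+ : ∀ n f g → Σ< n (λ i → f i + g i) ≡ Σ< n f + Σ< n g
  Σ<-+ zero    f g = sym (+-identityˡ 0#)
  Σ<-+ (suc n) f g = trans (cong (_+ (f n + g n)) (Σ<-+ n f g))
    (solve 4 (λ a b c d → a :+ b :+ (c :+ d) := a :+ c :+ (b :+ d)) refl (Σ< n f) (Σ< n g) (f n) (g n))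

  Σ<-*ˡ : ∀ n k f → k * Σ< n f ≡ Σ< n (λ i → k * f i)
  Σ<-*ˡ zero    k f = zeroʳ k
  Σ<-*ˡ (suc n) k f = trans (distribˡ _ _ _) (cong (_+ k * f n) (Σ<-*ˡ n k f))

  Σ<-0 : ∀ n → Σ< n (λ _ → 0#) ≡ 0#
  Σ<-0 zero    = refl
  Σ<-0 (suc n) = trans (+-identityʳ _) (Σ<-0 n)

  Σ<-head : ∀ n f → Σ< (suc n) f ≡ f 0 + Σ< n (f ∘ suc)
  Σ<-head zero    f = +-comm 0# (f 0)
  Σ<-head (suc n) f = trans (cong (_+ f (suc n)) (Σ<-head n f)) (+-assoc _ _ _)

  Σ<-split : ∀ a b f → Σ< (a ℕ.+ b) f ≡ Σ< a f + Σ< b (λ i → f (a ℕ.+ i))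
  Σ<-split a zero    f rewrite ℕ.+-identityʳ a = sym (+-identityʳ _)
  Σ<-split a (suc b) f rewrite ℕ.+-suc a b =
    trans (cong (_+ f (a ℕ.+ b)) (Σ<-split a b f)) (+-assoc _ _ _)

  Additive : (Carrier → Carrier) → Set
  Additive f = ∀ x y → f (x + y) ≡ f x + f y

  module _ {f} (f-+ : Additive f) where
    additive-0 : f 0# ≡ 0#
    additive-0 = x+x≈x⇒x≈0 (f 0#) (trans (sym (f-+ 0# 0#)) (cong f (+-identityˡ 0#)))

    additive-neg : ∀ x → f (- x) ≡ - f x
    additive-neg x = begin
      f (- x)                ≡⟨ (solve 2 (λ a b → a := (a :+ b) :- b) refl (f (- x)) (f x)) ⟩
      (f (- x) + f x) - f x  ≡⟨ cong (_- f x) (trans (sym (f-+ (- x) x)) (trans (cong f (-‿inverseˡ x)) additive-0)) ⟩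
      0# - f x               ≡⟨ +-identityˡ _ ⟩
      - f x                  ∎
      where open ≡-Reasoning

    additive-· : ∀ n x → f (n · x) ≡ n · f x
    additive-· zero    x = additive-0
    additive-· (suc n) x = trans (f-+ x (n · x)) (cong (f x +_) (additive-· n x))

    additive-Σ< : ∀ n g → f (Σ< n g) ≡ Σ< n (f ∘ g)
    additive-Σ< zero    g = additive-0
    additive-Σ< (suc n) g = trans (f-+ _ _) (cong (_+ f (g n)) (additive-Σ< n g))

  φ : ℕ → Carrier → Carrier
  φ i x = x ^ᶠ (p ℕ.^ i)

  φ-0 : ∀ x → φ 0 x ≡ x
  φ-0 = *-identityʳ

  φ-∘ : ∀ i j x → φ i (φ j x) ≡ φ (i ℕ.+ j) x
  φ-∘ i j x = trans (^ᶠ-* x (p ℕ.^ j) (p ℕ.^ i))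
    (cong (x ^ᶠ_) (trans (sym (ℕ.^-distribˡ-+-* p j i)) (cong (p ℕ.^_) (ℕ.+-comm j i))))

  φ-1 : ∀ x → φ 1 x ≡ x ^ᶠ p
  φ-1 x = cong (x ^ᶠ_) (ℕ.*-identityʳ p)

  φ-+ : ∀ i → Additive (φ i)
  φ-+ zero    x y = trans (φ-0 _) (sym (cong₂ _+_ (φ-0 x) (φ-0 y)))
  φ-+ (suc i) x y = begin
    φ (suc i) (x + y)        ≡⟨ φ-∘ 1 i (x + y) ⟨
    φ 1 (φ i (x + y))        ≡⟨ cong (φ 1) (φ-+ i x y) ⟩
    φ 1 (φ i x + φ i y)      ≡⟨ φ-1 _ ⟩
    (φ i x + φ i y) ^ᶠ p     ≡⟨ frob-+ _ _ ⟩
    φ i x ^ᶠ p + φ i y ^ᶠ p  ≡⟨ cong₂ _+_ (φ-1 _) (φ-1 _) ⟨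
    φ 1 (φ i x) + φ 1 (φ i y)  ≡⟨ cong₂ _+_ (φ-∘ 1 i x) (φ-∘ 1 i y) ⟩
    φ (suc i) x + φ (suc i) y  ∎
    where open ≡-Reasoning

  φ-* : ∀ i x y → φ i (x * y) ≡ φ i x * φ i y
  φ-* i x y = *-^ᶠ x y (p ℕ.^ i)

  φ-1# : ∀ i → φ i 1# ≡ 1#
  φ-1# i = 1^ᶠ (p ℕ.^ i)

  φ-m : ∀ x → φ m x ≡ x
  φ-m = fermat

  φ≡0⇒≡0 : ∀ i x → φ i x ≡ 0# → x ≡ 0#
  φ≡0⇒≡0 i x = ^ᶠ≡0⇒≡0 x (p ℕ.^ i)

  -- Degree n f c: f is a polynomial function of degree at most n whose
  -- coefficient at xⁿ is c.  Differences f x - f a are divided by x - a.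
  Degree : ℕ → (Carrier → Carrier) → Carrier → Set
  Degree zero    f c = ∀ x → f x ≡ c
  Degree (suc n) f c = ∀ a → ∃[ g ] (Degree n g c × (∀ x → f x ≡ f a + (x - a) * g x))

  degree-resp : ∀ n {f g c d} → (∀ x → f x ≡ g x) → c ≡ d → Degree n f c → Degree n g d
  degree-resp zero    f≗g c≡d deg x = trans (sym (f≗g x)) (trans (deg x) c≡d)
  degree-resp (suc n) f≗g c≡d deg a with deg a
  ... | h , degh , eq = h , degree-resp n (λ _ → refl) c≡d degh ,
    λ x → trans (sym (f≗g x)) (trans (eq x) (cong (_+ (x - a) * h x) (f≗g a)))

  degree-raise : ∀ n {f c} → Degree n f c → Degree (suc n) f 0#
  degree-raise zero    {f} deg a = (λ _ → 0#) , (λ _ → refl) , λ x →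
    trans (trans (deg x) (sym (deg a))) (solve 3 (λ y x a → y := y :+ (x :- a) :* :0) refl (f a) x a)
  degree-raise (suc n) deg a with deg a
  ... | g , degg , eq = g , degree-raise n degg , eq

  degree-< : ∀ {k n f c} → k < n → Degree k f c → Degree n f 0#
  degree-< {k} {suc n} k<1+n deg with ℕ.m≤n⇒m<n∨m≡n (ℕ.s≤s⁻¹ k<1+n)
  ... | inj₁ k<n  = degree-raise n (degree-< k<n deg)
  ... | inj₂ refl = degree-raise k deg

  degree-+ : ∀ n {f g c d} → Degree n f c → Degree n g d → Degree n (λ x → f x + g x) (c + d)
  degree-+ zero    degf degg x = cong₂ _+_ (degf x) (degg x)
  degree-+ (suc n) {f} {g} degf degg a with degf a | degg a
  ... | f′ , degf′ , eqf | g′ , degg′ , eqg = _ , degree-+ n degf′ degg′ , λ x →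
    trans (cong₂ _+_ (eqf x) (eqg x))
      (solve 6 (λ u v x a s t → u :+ (x :- a) :* s :+ (v :+ (x :- a) :* t) := u :+ v :+ (x :- a) :* (s :+ t)) refl (f a) (g a) x a (f′ x) (g′ x))

  degree-*ˡ : ∀ n k {f c} → Degree n f c → Degree n (λ x → k * f x) (k * c)
  degree-*ˡ zero    k deg x = cong (k *_) (deg x)
  degree-*ˡ (suc n) k {f} deg a with deg a
  ... | g , degg , eq = _ , degree-*ˡ n k degg , λ x →
    trans (cong (k *_) (eq x)) (solve 5 (λ k u x a s → k :* (u :+ (x :- a) :* s) := k :* u :+ (x :- a) :* (k :* s)) refl k (f a) x a (g x))

  degree-x* : ∀ n {f c} → Degree n f c → Degree (suc n) (λ x → x * f x) c
  degree-x* zero    {f} {c} deg a = f , deg , λ x →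
    trans (cong (x *_) (deg x)) (trans (solve 3 (λ x a c → x :* c := a :* c :+ (x :- a) :* c) refl x a c)
      (cong₂ (λ s t → a * s + (x - a) * t) (sym (deg a)) (sym (deg x))))
  degree-x* (suc n) {f} {c} deg a with deg a
  -- The quotient comes from x f(x) - a f(a) = (x - a)(f(x) + a g(x)).
  ... | g , degg , eq = (λ x → f x + a * g x)
    , degree-resp (suc n) (λ _ → refl) (+-identityʳ c)
        (degree-+ (suc n) deg (degree-raise n (degree-*ˡ n a degg)))
    , λ x → trans (cong (λ w → x * w) (eq x))
        (trans (solve 4 (λ x a u s → x :* (u :+ (x :- a) :* s) := a :* u :+ (x :- a) :* ((u :+ (x :- a) :* s) :+ a :* s)) refl x a (f a) (g x))
          (cong (λ w → a * f a + (x - a) * (w + a * g x)) (sym (eq x))))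

  degree-^ : ∀ n → Degree n (_^ᶠ n) 1#
  degree-^ zero    x = refl
  degree-^ (suc n)   = degree-x* n (degree-^ n)

  -- Division by x - a at a root a keeps the leading coefficient and leaves the other roots to the
  -- quotient. At degree 0 one root remains, and the constant is 0.
  too-many-roots : ∀ n {f c} → Degree n f c → ∀ xs → Unique xs → All (λ x → f x ≡ 0#) xs →
                   n < length xs → c ≡ 0#
  too-many-roots zero    deg (x ∷ xs) _ (fx≡0 ∷ _) _ = trans (sym (deg x)) fx≡0
  too-many-roots (suc n) {f} deg (a ∷ xs) (a∉ ∷ uniq) (fa≡0 ∷ roots) (s≤s n<) with deg a
  ... | g , degg , eq = too-many-roots n degg xs uniq (All.zipWith root (a∉ , roots)) n<
    where
    root : ∀ {x} → a ≢ x × f x ≡ 0# → g x ≡ 0#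
    root {x} (a≢x , fx≡0) = x*y≡0⇒y≡0 (x - a) (g x) (λ x-a≡0 → a≢x (sym (x-y≡0⇒x≡y x a x-a≡0)))
      (trans (sym (+-identityˡ _)) (trans (+-congʳ (sym fa≡0)) (trans (sym (eq x)) fx≡0)))

  p>1 : 1 < p
  p>1 = ℕ.nonTrivial⇒n>1 p {{prime⇒nonTrivial p-prime}}

  p^-mono-< : ∀ {i j} → i < j → p ℕ.^ i < p ℕ.^ j
  p^-mono-< = ℕ.^-monoʳ-< p p>1

  Lin : (ℕ → Carrier) → Carrier → Carrier
  Lin s x = Σ< m (λ i → s i * φ i x)

  private
    degree-partial-sum : ∀ (s : ℕ → Carrier) k → Degree (p ℕ.^ k) (λ x → Σ< (suc k) (λ i → s i * φ i x)) (s k)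
    degree-partial-sum s zero = degree-resp 1
      (λ x → sym (+-identityˡ _)) (*-identityʳ _) (degree-*ˡ 1 (s 0) (degree-^ 1))
    degree-partial-sum s (suc k) = degree-resp (p ℕ.^ suc k) (λ _ → refl)
      (trans (+-identityˡ _) (*-identityʳ _))
      (degree-+ (p ℕ.^ suc k) (degree-< (p^-mono-< (ℕ.n<1+n k)) (degree-partial-sum s k))
        (degree-*ˡ (p ℕ.^ suc k) (s (suc k)) (degree-^ (p ℕ.^ suc k))))

  -- The degree is at most p^(m - 1) < q, so vanishing on the whole field kills the top coefficient;
  -- the rest follows by descent.
  Lin≡0⇒≡0 : ∀ s → (∀ x → Lin s x ≡ 0#) → ∀ i → i < m → s i ≡ 0#
  Lin≡0⇒≡0 s = go m ℕ.≤-refl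
    where
    go : ∀ n → n ≤ m → (∀ x → Σ< n (λ i → s i * φ i x) ≡ 0#) → ∀ i → i < n → s i ≡ 0#
    go (suc k) k<m vanish i i<1+k with too-many-roots (p ℕ.^ k) (degree-partial-sum s k) elements
      elements-unique (All.universal vanish elements) (subst (p ℕ.^ k <_) (sym card) (p^-mono-< k<m))
    ... | sk≡0 with ℕ.m≤n⇒m<n∨m≡n (ℕ.s≤s⁻¹ i<1+k)
    ...   | inj₁ i<k  = go k (ℕ.<⇒≤ k<m) (λ x → trans (sym (+-identityʳ _))
              (trans (+-congˡ (sym (trans (cong (_* φ k x) sk≡0) (zeroˡ _)))) (vanish x))) i i<k
    ...   | inj₂ refl = sk≡0

  Lin-+ : ∀ s → Additive (Lin s)
  Lin-+ s x y = trans (Σ<-cong m (λ i _ → trans (cong (s i *_) (φ-+ i x y)) (distribˡ _ _ _))) (Σ<-+ m _ _)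

  Lin-+ᶜ : ∀ s t x → Lin s x + Lin t x ≡ Lin (λ i → s i + t i) x
  Lin-+ᶜ s t x = trans (sym (Σ<-+ m _ _)) (Σ<-cong m (λ i _ → sym (distribʳ _ _ _)))

  Lin-*ᶜ : ∀ k s x → k * Lin s x ≡ Lin (λ i → k * s i) x
  Lin-*ᶜ k s x = trans (Σ<-*ˡ m k _) (Σ<-cong m (λ i _ → sym (*-assoc _ _ _)))

  Lin-injective : ∀ s t → (∀ x → Lin s x ≡ Lin t x) → ∀ i → i < m → s i ≡ t i
  Lin-injective s t eq i i<m = trans
    (solve 2 (λ a b → a := a :+ :- :1 :* b :+ b) refl (s i) (t i))
    (trans (cong (_+ t i) (Lin≡0⇒≡0 (λ j → s j + - 1# * t j) (λ x → begin
      Lin (λ j → s j + - 1# * t j) x     ≡⟨ Lin-+ᶜ s _ x ⟨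
      Lin s x + Lin (λ j → - 1# * t j) x ≡⟨ cong (Lin s x +_) (Lin-*ᶜ (- 1#) t x) ⟨
      Lin s x + - 1# * Lin t x           ≡⟨ cong (λ w → w + - 1# * Lin t x) (eq x) ⟩
      Lin t x + - 1# * Lin t x           ≡⟨ (solve 1 (λ a → a :+ :- :1 :* a := :0) refl (Lin t x)) ⟩
      0#                                 ∎) i i<m)) (+-identityˡ _))
    where open ≡-Reasoning

  -- Coefficients of the p-th power of a linearised polynomial: each one is raised to the power p
  -- and moves up one place, and the top one returns to place 0 because x^q = x.
  rotate : ℕ → (ℕ → Carrier) → ℕ → Carrier
  rotate n s zero    = φ 1 (s (n ∸ 1))
  rotate n s (suc i) = φ 1 (s i)

  φ1-Lin : ∀ s x → φ 1 (Lin s x) ≡ Lin (rotate m s) x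
  φ1-Lin s x = trans (additive-Σ< (φ-+ 1) m _)
    (trans (Σ<-cong m (λ i _ → trans (φ-* 1 _ _) (cong (φ 1 (s i) *_) (φ-∘ 1 i x))))
           (wrap m m-pos (φ-m x)))
    where
    open ≡-Reasoning
    wrap : ∀ n → 1 ≤ n → φ n x ≡ x →
           Σ< n (λ i → φ 1 (s i) * φ (suc i) x) ≡ Σ< n (λ i → rotate n s i * φ i x)
    wrap (suc n) _ φn = begin
      Σ< n (λ i → φ 1 (s i) * φ (suc i) x) + φ 1 (s n) * φ (suc n) x
        ≡⟨ +-comm _ _ ⟩
      φ 1 (s n) * φ (suc n) x + Σ< n (λ i → φ 1 (s i) * φ (suc i) x)
        ≡⟨ +-congʳ (*-congˡ (trans φn (sym (φ-0 x)))) ⟩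
      φ 1 (s n) * φ 0 x + Σ< n (λ i → φ 1 (s i) * φ (suc i) x)
        ≡⟨ Σ<-head n _ ⟨
      Σ< (suc n) (λ i → rotate (suc n) s i * φ i x)
        ∎

  Linearised : (Carrier → Carrier) → Set
  Linearised f = ∃[ s ] (∀ x → f x ≡ Lin s x)

  linearised-id : Linearised id
  linearised-id = δ , λ x → go m m-pos x
    where
    δ : ℕ → Carrier
    δ zero    = 1#
    δ (suc _) = 0#
    go : ∀ n → 1 ≤ n → ∀ x → x ≡ Σ< n (λ i → δ i * φ i x)
    go (suc n) _ x = sym (trans (Σ<-head n _) (trans
      (cong₂ _+_ (trans (*-identityˡ _) (φ-0 x)) (trans (Σ<-cong n (λ i _ → zeroˡ _)) (Σ<-0 n)))
      (+-identityʳ x)))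

  linearised-0 : Linearised (λ _ → 0#)
  linearised-0 = (λ _ → 0#) , λ x → sym (trans (Σ<-cong m (λ i _ → zeroˡ _)) (Σ<-0 m))

  linearised-+ : ∀ {f g} → Linearised f → Linearised g → Linearised (λ x → f x + g x)
  linearised-+ (s , f≡) (t , g≡) = _ , λ x → trans (cong₂ _+_ (f≡ x) (g≡ x)) (Lin-+ᶜ s t x)

  linearised-*ˡ : ∀ k {f} → Linearised f → Linearised (λ x → k * f x)
  linearised-*ˡ k (s , f≡) = _ , λ x → trans (cong (k *_) (f≡ x)) (Lin-*ᶜ k s x)

  linearised-φ1 : ∀ {f} → Linearised f → Linearised (λ x → φ 1 (f x))
  linearised-φ1 (s , f≡) = _ , λ x → trans (cong (φ 1) (f≡ x)) (φ1-Lin s x)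

  linearised⇒additive : ∀ {f} → Linearised f → Additive f
  linearised⇒additive (s , f≡) x y =
    trans (f≡ _) (trans (Lin-+ s x y) (sym (cong₂ _+_ (f≡ x) (f≡ y))))

  ·≡·1* : ∀ n x → n · x ≡ n · 1# * x
  ·≡·1* n x = trans (cong (n ·_) (sym (*-identityˡ x))) (sym (×-assoc-* n 1# x))

  -- By Bézout some multiples of n and p differ by 1. If both vanish in the field, then so does 1.
  p∤n⇒n·1≢0 : ∀ n → ¬ p ∣ n → n · 1# ≢ 0#
  p∤n⇒n·1≢0 n p∤n n·1≡0 = 1≢0 (bézout (coprime-Bézout coprime))
    where
    open ≡-Reasoning
    coprime : Coprime n p
    coprime {d} (d∣n , d∣p) with prime⇒irreducible p-prime d∣p
    ... | inj₁ d≡1  = d≡1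
    ... | inj₂ refl = contradiction d∣n p∤n
    multiple : ∀ x k → k · 1# ≡ 0# → (x ℕ.* k) · 1# ≡ 0#
    multiple x k k·1≡0 = trans (×1-homo-* x k) (trans (cong (x · 1# *_) k·1≡0) (zeroʳ _))
    consecutive : ∀ k l → k · 1# ≡ 0# → l · 1# ≡ 0# → suc k ≡ l → 1# ≡ 0#
    consecutive k l k·1≡0 l·1≡0 1+k≡l = begin
      1#             ≡⟨ +-identityʳ 1# ⟨
      1# + 0#        ≡⟨ cong (1# +_) k·1≡0 ⟨
      suc k · 1#     ≡⟨ cong (_· 1#) 1+k≡l ⟩
      l · 1#         ≡⟨ l·1≡0 ⟩
      0#             ∎
    bézout : Bézout.Identity 1 n p → 1# ≡ 0#
    bézout (Bézout.+- x y eq) = consecutive _ _ (multiple y p p·1≡0) (multiple x n n·1≡0) eq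
    bézout (Bézout.-+ x y eq) = consecutive _ _ (multiple x n n·1≡0) (multiple y p p·1≡0) eq

  private
    primeField : List Carrier
    primeField = applyUpTo (_· 1#) p

    primeField-unique : Unique primeField
    primeField-unique = Unique.applyUpTo⁺₁ (_· 1#) p λ {i} {j} i<j j<p i≡j →
      p∤n⇒n·1≢0 (j ∸ i) (λ p∣ → ℕ.<⇒≱ (ℕ.≤-<-trans (ℕ.m∸n≤m j i) j<p)
          (∣⇒≤ {{ℕ.>-nonZero (ℕ.m<n⇒0<n∸m i<j)}} p∣))
        (+-cancelʳ (i · 1#) _ _ (begin
          (j ∸ i) · 1# + i · 1#  ≡⟨ ×-homo-+ 1# (j ∸ i) i ⟨
          (j ∸ i ℕ.+ i) · 1#     ≡⟨ cong (_· 1#) (ℕ.m∸n+n≡m (ℕ.<⇒≤ i<j)) ⟩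
          j · 1#                 ≡⟨ i≡j ⟨
          i · 1#                 ≡⟨ +-identityˡ _ ⟨
          0# + i · 1#            ∎))
      where open ≡-Reasoning

    ·1-^p : ∀ k → (k · 1#) ^ᶠ p ≡ k · 1#
    ·1-^p k = trans (sym (φ-1 _)) (trans (additive-· (φ-+ 1) k 1#) (cong (k ·_) (φ-1# 1)))

  -- The multiples of 1 are already p distinct roots of x^p - x; any other y would be one root too
  -- many.
  x^p≡x⇒x≡k·1 : ∀ y → y ^ᶠ p ≡ y → ∃[ k ] y ≡ k · 1#
  x^p≡x⇒x≡k·1 y y^p≡y with DecMembership._∈?_ _≟_ y primeField
  ... | yes y∈ with ∈-applyUpTo⁻ (_· 1#) y∈
  ...   | k , _ , y≡ = k , y≡
  x^p≡x⇒x≡k·1 y y^p≡y | no y∉ = contradiction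
    (too-many-roots p degree-f (y ∷ primeField) (All.¬Any⇒All¬ primeField y∉ ∷ primeField-unique)
      (root y^p≡y ∷ All.applyUpTo⁺₁ (_· 1#) p (λ {k} _ → root (·1-^p k)))
      (s≤s (ℕ.≤-reflexive (sym (length-applyUpTo (_· 1#) p)))))
    1≢0
    where
    degree-f : Degree p (λ x → x ^ᶠ p + - 1# * x ^ᶠ 1) 1#
    degree-f = degree-resp p (λ _ → refl) (+-identityʳ 1#)
      (degree-+ p (degree-^ p) (degree-< p>1 (degree-*ˡ 1 (- 1#) (degree-^ 1))))
    root : ∀ {x} → x ^ᶠ p ≡ x → x ^ᶠ p + - 1# * x ^ᶠ 1 ≡ 0#
    root {x} eq = trans (cong₂ (λ u v → u + - 1# * v) eq (x^1 x)) (solve 1 (λ x → x :+ :- :1 :* x := :0) refl x)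

  -- Newton interpolation: L vanishes at the nodes treated so far, and P agrees
  -- with f on the kernel of L, which is the span of these nodes.
  record Interpolant (f : Carrier → Carrier) (nodes : List Carrier) : Set where
    field
      L P      : Carrier → Carrier
      L-lin    : Linearised L
      P-lin    : Linearised P
      vanishes : ∀ x → x ∈ nodes → L x ≡ 0#
      agrees   : ∀ x → L x ≡ 0# → f x ≡ P x

  additive-sub-· : ∀ {f} → Additive f → ∀ x k e → f (x - k · e) ≡ f x - k · f e
  additive-sub-· f-+ x k e =
    trans (f-+ _ _) (+-congˡ (trans (additive-neg f-+ _) (cong -_ (additive-· f-+ k e))))

  interpolate : ∀ {f} → Additive f → ∀ nodes → Interpolant f nodes
  interpolate f-+ [] = record
    { L = id ; P = λ _ → 0# ; L-lin = linearised-id ; P-lin = linearised-0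
    ; vanishes = λ _ () ; agrees = λ { x refl → additive-0 f-+ } }
  interpolate {f} f-+ (e ∷ nodes) with interpolate f-+ nodes
  ... | I with Interpolant.L I e ≟ 0#
  ...   | yes Le≡0 = record
    { Interpolant I
    ; vanishes = λ { x (here refl) → Le≡0 ; x (there x∈) → Interpolant.vanishes I x x∈ } }
  ...   | no Le≢0 = record
    { L = L′
    ; P = λ x → P x + c * L x
    ; L-lin = linearised-+ (linearised-φ1 L-lin) (linearised-*ˡ _ L-lin)
    ; P-lin = linearised-+ P-lin (linearised-*ˡ c L-lin)
    ; vanishes = λ { x (here refl) → L′e≡0 ; x (there x∈) → L≡0⇒L′≡0 (vanishes x x∈) }
    ; agrees = agrees′ }
    where
    open Interpolant I
    open ≡-Reasoning
    -- This `c` makes P + c L equal to f at e and changes nothing on the kernel of L. Next, `L′` is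
    -- L^p - L(e)^(p - 1) L, which vanishes where L(x) is an F_p-multiple of L(e).
    c = L e ⁻¹ * (f e - P e)
    L′ : Carrier → Carrier
    L′ x = φ 1 (L x) + - (L e ⁻¹ * φ 1 (L e)) * L x
    L′e≡0 : L′ e ≡ 0#
    L′e≡0 = trans (solve 3 (λ b l i → b :+ :- (i :* b) :* l := b :- i :* l :* b) refl (φ 1 (L e)) (L e) (L e ⁻¹))
      (trans (cong (λ w → φ 1 (L e) - w * φ 1 (L e)) (⁻¹-inverseˡ _ Le≢0))
        (solve 1 (λ b → b :- :1 :* b := :0) refl (φ 1 (L e))))
    L≡0⇒L′≡0 : ∀ {x} → L x ≡ 0# → L′ x ≡ 0#
    L≡0⇒L′≡0 {x} eq = trans (cong (λ w → φ 1 w + - (L e ⁻¹ * φ 1 (L e)) * w) eq)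
      (trans (+-congʳ (additive-0 (φ-+ 1)))
        (solve 1 (λ k → :0 :+ :- k :* :0 := :0) refl (L e ⁻¹ * φ 1 (L e))))
    -- The ratio u = L(x) / L(e) satisfies u^p = u, so u = k · 1. Then x - k · e lies in the kernel
    -- of L, where f and P agree.
    agrees′ : ∀ x → L′ x ≡ 0# → f x ≡ P x + c * L x
    agrees′ x L′x≡0 = conclude (x^p≡x⇒x≡k·1 u u^p≡u)
      where
      u = L e ⁻¹ * L x
      Lx≡u*Le : L x ≡ u * L e
      Lx≡u*Le = trans (sym (*-identityˡ _)) (trans (cong (_* L x) (sym (⁻¹-inverseˡ _ Le≢0)))
        (solve 3 (λ i l y → i :* l :* y := i :* y :* l) refl (L e ⁻¹) (L e) (L x)))
      φLx : φ 1 (L x) ≡ L e ⁻¹ * φ 1 (L e) * L x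
      φLx = trans (solve 3 (λ a k y → a := (a :+ :- k :* y) :+ k :* y) refl (φ 1 (L x)) (L e ⁻¹ * φ 1 (L e)) (L x))
        (trans (+-congʳ L′x≡0) (+-identityˡ _))
      φ⁻¹ : φ 1 (L e ⁻¹) * φ 1 (L e) ≡ 1#
      φ⁻¹ = trans (sym (φ-* 1 _ _)) (trans (cong (φ 1) (⁻¹-inverseˡ _ Le≢0)) (φ-1# 1))
      u^p≡u : u ^ᶠ p ≡ u
      u^p≡u = begin
        u ^ᶠ p                                        ≡⟨ φ-1 u ⟨
        φ 1 u                                         ≡⟨ φ-* 1 _ _ ⟩
        φ 1 (L e ⁻¹) * φ 1 (L x)                      ≡⟨ cong (φ 1 (L e ⁻¹) *_) φLx ⟩
        φ 1 (L e ⁻¹) * (L e ⁻¹ * φ 1 (L e) * L x)     ≡⟨ (solve 4 (λ a i b y → a :* (i :* b :* y) := a :* b :* (i :* y)) refl (φ 1 (L e ⁻¹)) (L e ⁻¹) (φ 1 (L e)) (L x)) ⟩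
        φ 1 (L e ⁻¹) * φ 1 (L e) * u                  ≡⟨ cong (_* u) φ⁻¹ ⟩
        1# * u                                        ≡⟨ *-identityˡ u ⟩
        u                                             ∎
      conclude : ∃[ k ] u ≡ k · 1# → f x ≡ P x + c * L x
      conclude (k , u≡k) = begin
        f x                                             ≡⟨ (solve 2 (λ a b → a := (a :- b) :+ b) refl (f x) (k · f e)) ⟩
        f x - k · f e + k · f e                         ≡⟨ cong (_+ k · f e) (additive-sub-· f-+ x k e) ⟨
        f x′ + k · f e                                  ≡⟨ cong (_+ k · f e) (agrees x′ Lx′≡0) ⟩
        P x′ + k · f e                                  ≡⟨ cong₂ _+_ (additive-sub-· (linearised⇒additive P-lin) x k e) (·≡·1* k (f e)) ⟩
        P x - k · P e + k · 1# * f e                    ≡⟨ cong (λ w → P x - w + k · 1# * f e) (·≡·1* k (P e)) ⟩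
        P x - k · 1# * P e + k · 1# * f e               ≡⟨ (solve 4 (λ a κ b d → a :- κ :* b :+ κ :* d := a :+ κ :* (:1 :* (d :- b))) refl (P x) (k · 1#) (P e) (f e)) ⟩
        P x + k · 1# * (1# * (f e - P e))               ≡⟨ cong₂ (λ v w → P x + v * (w * (f e - P e))) u≡k (⁻¹-inverseˡ _ Le≢0) ⟨
        P x + u * (L e ⁻¹ * L e * (f e - P e))          ≡⟨ (solve 5 (λ a u i l d → a :+ u :* (i :* l :* d) := a :+ i :* d :* (u :* l)) refl (P x) u (L e ⁻¹) (L e) (f e - P e)) ⟩
        P x + c * (u * L e)                             ≡⟨ cong (λ w → P x + c * w) Lx≡u*Le ⟨
        P x + c * L x                                   ∎
        where
        x′ = x - k · e
        Lx′≡0 : L x′ ≡ 0#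
        Lx′≡0 = trans (additive-sub-· (linearised⇒additive L-lin) x k e)
          (x≡y⇒x-y≡0 _ _ (trans Lx≡u*Le (trans (cong (_* L e) u≡k) (sym (·≡·1* k (L e))))))

  -- With all field elements as nodes, L is the zero function and the agreement holds everywhere.
  additive⇒linearised : ∀ {f} → Additive f → Linearised f
  additive⇒linearised f-+ =
    let open Interpolant (interpolate f-+ elements) in
    proj₁ P-lin , λ x → trans (agrees x (vanishes x (elements-complete x))) (proj₂ P-lin x)

-- Trace and trace forms in characteristic two

module CharacteristicTwo (F : FiniteField) (p≡2 : FiniteField.p F ≡ 2) where
  open Over F
  open FieldArithmetic F
  open LinearisedPolynomials F

  1+1≡0 : 1# + 1# ≡ 0#
  1+1≡0 = trans (sym (cong (1# +_) (+-identityʳ 1#))) (subst (λ n → n · 1# ≡ 0#) p≡2 p·1≡0)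

  open CharTwoSolver commutativeRing 1+1≡0 public

  x+x≡0 : ∀ x → x + x ≡ 0#
  x+x≡0 x = (solve₂ 1 (λ x → x :+₂ x :=₂ :0₂) refl x)

  x+y≡0⇒x≡y : ∀ x y → x + y ≡ 0# → x ≡ y
  x+y≡0⇒x≡y x y eq = trans (solve₂ 2 (λ x y → x :=₂ (x :+₂ y) :+₂ y) refl x y) (trans (cong (_+ y) eq) (+-identityˡ y))

  φ1≡sq : ∀ x → φ 1 x ≡ x * x
  φ1≡sq x = trans (φ-1 x) (trans (cong (x ^ᶠ_) p≡2) (cong (x *_) (*-identityʳ x)))

  √ : Carrier → Carrier
  √ = φ (m ∸ 1)

  √-sq : ∀ x → √ x * √ x ≡ x
  √-sq x = trans (sym (φ1≡sq _)) (trans (φ-∘ 1 (m ∸ 1) x)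
    (trans (cong (λ n → φ n x) (ℕ.m+[n∸m]≡n m-pos)) (φ-m x)))

  Tr : Carrier → Carrier
  Tr x = Σ< m (λ i → φ i x)

  Tr-+ : Additive Tr
  Tr-+ x y = trans (Σ<-cong m (λ i _ → φ-+ i x y)) (Σ<-+ m _ _)

  Tr-φ1 : ∀ x → Tr (φ 1 x) ≡ Tr x
  Tr-φ1 x = trans (Σ<-cong m (λ i _ → trans (φ-∘ i 1 x) (cong (λ n → φ n x) (ℕ.+-comm i 1))))
    (+-cancelʳ (φ 0 x) _ _ (trans (+-comm _ _) (trans (sym (Σ<-head m (λ i → φ i x)))
      (cong (Tr x +_) (trans (φ-m x) (sym (φ-0 x)))))))

  Tr-φ : ∀ i x → Tr (φ i x) ≡ Tr x
  Tr-φ zero    x = cong Tr (φ-0 x)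
  Tr-φ (suc i) x = trans (cong Tr (sym (φ-∘ 1 i x))) (trans (Tr-φ1 (φ i x)) (Tr-φ i x))

  φ1-Tr : ∀ x → φ 1 (Tr x) ≡ Tr x
  φ1-Tr x = trans (additive-Σ< (φ-+ 1) m _) (trans (Σ<-cong m (λ i _ → trans (φ-∘ 1 i x)
    (trans (cong (λ n → φ n x) (ℕ.+-comm 1 i)) (sym (φ-∘ i 1 x))))) (Tr-φ1 x))

  Tr-sq : ∀ x → Tr x * Tr x ≡ Tr x
  Tr-sq x = trans (sym (φ1≡sq _)) (φ1-Tr x)

  -- As a function of c, Tr (c w) is the linearised polynomial with coefficients `φ i w`, and the
  -- coefficient at index 0 is w.
  Tr-nondegenerate : ∀ w → (∀ c → Tr (c * w) ≡ 0#) → w ≡ 0#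
  Tr-nondegenerate w vanish = trans (sym (φ-0 w)) (Lin≡0⇒≡0 (λ i → φ i w)
    (λ c → trans (Σ<-cong m (λ i _ → trans (*-comm _ _) (sym (φ-* i c w)))) (vanish c)) 0 m-pos)

  -- An additive f equal to its own square has coefficients fixed by `rotate`. Hence s_(i+1) = s_i²,
  -- all coefficients are the conjugates of s_0, and κ = s_0.
  idempotent⇒trace : ∀ {f} → Additive f → (∀ x → f x * f x ≡ f x) → ∃[ κ ] (∀ x → f x ≡ Tr (κ * x))
  idempotent⇒trace {f} f-+ idem with additive⇒linearised f-+
  ... | s , f≡ = s 0 , λ x → trans (f≡ x)
    (Σ<-cong m (λ i i<m → trans (cong (_* φ i x) (powers i i<m)) (sym (φ-* i (s 0) x))))
    where
    fixed : ∀ i → i < m → rotate m s i ≡ s i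
    fixed = Lin-injective (rotate m s) s (λ x → trans (sym (φ1-Lin s x)) (trans (cong (φ 1) (sym (f≡ x)))
      (trans (φ1≡sq _) (trans (idem x) (f≡ x)))))
    powers : ∀ i → i < m → s i ≡ φ i (s 0)
    powers zero    _   = sym (φ-0 _)
    powers (suc i) i<m = trans (sym (fixed (suc i) i<m))
      (trans (cong (φ 1) (powers i (ℕ.<-trans (ℕ.n<1+n i) i<m))) (φ-∘ 1 i (s 0)))

  Σ<-reverse : ∀ n f → Σ< n f ≡ Σ< n (λ i → f (n ∸ suc i))
  Σ<-reverse zero    f = refl
  Σ<-reverse (suc n) f = trans (+-comm _ _)
    (trans (cong (f n +_) (Σ<-reverse n f)) (sym (Σ<-head n (λ i → f (suc n ∸ suc i)))))

  -- Summation of the triangle i ≤ j < n by rows and by columns; the induction removes the column j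
  -- = n, one term from each row.
  Σ<-triangle : ∀ n (g : ℕ → ℕ → Carrier) →
    Σ< n (λ i → Σ< (n ∸ i) (λ k → g i (i ℕ.+ k))) ≡ Σ< n (λ j → Σ< (suc j) (λ i → g i j))
  Σ<-triangle zero    g = refl
  Σ<-triangle (suc n) g = begin
    Σ< n (λ i → Σ< (suc n ∸ i) (λ k → g i (i ℕ.+ k))) + Σ< (suc n ∸ n) (λ k → g n (n ℕ.+ k))
      ≡⟨ cong₂ _+_ (Σ<-cong n (λ i i<n → last-term i (ℕ.<⇒≤ i<n))) (last-term n ℕ.≤-refl) ⟩
    Σ< n (λ i → Σ< (n ∸ i) (λ k → g i (i ℕ.+ k)) + g i n) + (Σ< (n ∸ n) (λ k → g n (n ℕ.+ k)) + g n n)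
      ≡⟨ cong₂ _+_ (Σ<-+ n _ _) (cong (λ j → Σ< j (λ k → g n (n ℕ.+ k)) + g n n) (ℕ.n∸n≡0 n)) ⟩
    (Σ< n (λ i → Σ< (n ∸ i) (λ k → g i (i ℕ.+ k))) + Σ< n (λ i → g i n)) + (0# + g n n)
      ≡⟨ (solve 3 (λ a b c → a :+ b :+ (:0 :+ c) := a :+ (b :+ c)) refl (Σ< n (λ i → Σ< (n ∸ i) (λ k → g i (i ℕ.+ k)))) (Σ< n (λ i → g i n)) (g n n)) ⟩
    Σ< n (λ i → Σ< (n ∸ i) (λ k → g i (i ℕ.+ k))) + Σ< (suc n) (λ i → g i n)
      ≡⟨ cong (_+ Σ< (suc n) (λ i → g i n)) (Σ<-triangle n g) ⟩
    Σ< n (λ j → Σ< (suc j) (λ i → g i j)) + Σ< (suc n) (λ i → g i n)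
      ∎
    where
    open ≡-Reasoning
    last-term : ∀ i → i ≤ n → Σ< (suc n ∸ i) (λ k → g i (i ℕ.+ k)) ≡ Σ< (n ∸ i) (λ k → g i (i ℕ.+ k)) + g i n
    last-term i i≤n rewrite ℕ.+-∸-assoc 1 i≤n | ℕ.m+[n∸m]≡n i≤n = refl

  -- Q is a quadratic form polarising to the alternating form (c, z) ↦ Tr (c · Lin h z).
  module Polar (h : ℕ → Carrier)
    (h-sym : ∀ i → 1 ≤ i → i < m → h i ≡ φ i (h (m ∸ i))) where

    u : Carrier → Carrier → ℕ → ℕ → Carrier
    u c z i j = φ i (h (j ∸ i)) * φ i c * φ j z

    U : Carrier → Carrier → Carrier
    U c z = Σ< m (λ j → Σ< j (λ i → u c z i j))

    Q : Carrier → Carrier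
    Q c = U c c

    U-+ˡ : ∀ x y z → U (x + y) z ≡ U x z + U y z
    U-+ˡ x y z = trans (Σ<-cong m (λ j _ → trans (Σ<-cong j (λ i _ →
      trans (cong (λ w → φ i (h (j ∸ i)) * w * φ j z) (φ-+ i x y))
        (solve 4 (λ a b c d → a :* (b :+ c) :* d := a :* b :* d :+ a :* c :* d) refl (φ i (h (j ∸ i))) (φ i x) (φ i y) (φ j z))))
      (Σ<-+ j _ _))) (Σ<-+ m _ _)

    U-+ʳ : ∀ z x y → U z (x + y) ≡ U z x + U z y
    U-+ʳ z x y = trans (Σ<-cong m (λ j _ → trans (Σ<-cong j (λ i _ →
      trans (cong (λ w → φ i (h (j ∸ i)) * φ i z * w) (φ-+ j x y)) (distribˡ _ _ _))) (Σ<-+ j _ _))) (Σ<-+ m _ _)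

    Q-+ : ∀ c z → Q (c + z) ≡ Q c + Q z + (U c z + U z c)
    Q-+ c z = trans (U-+ˡ c z (c + z)) (trans (cong₂ _+_ (U-+ʳ c c z) (U-+ʳ z c z))
      (solve 4 (λ a b d e → a :+ b :+ (d :+ e) := a :+ e :+ (b :+ d)) refl (U c c) (U c z) (U z c) (U z z)))

    -- Expand the trace into terms φ_i(c) φ_i(h_k) φ_(i+k)(z). Those with i + k < m form the
    -- diagonal and `U c z`; in the others i + k is reduced modulo m, and `h-sym` turns them into
    -- `U z c`.
    polar : ∀ c z → Tr (c * Lin h z) ≡ Tr (h 0 * c * z) + (U c z + U z c)
    polar c z = begin
      Tr (c * Lin h z)
        ≡⟨ Σ<-cong m (λ i i<m → row i i<m) ⟩
      Σ< m (λ i → Σ< (m ∸ i) (λ k → u c z i (i ℕ.+ k)) + Σ< i (λ j → u z c j i))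
        ≡⟨ Σ<-+ m _ _ ⟩
      Σ< m (λ i → Σ< (m ∸ i) (λ k → u c z i (i ℕ.+ k))) + U z c
        ≡⟨ cong (_+ U z c) (Σ<-triangle m (u c z)) ⟩
      Σ< m (λ j → Σ< j (λ i → u c z i j) + u c z j j) + U z c
        ≡⟨ cong (_+ U z c) (Σ<-+ m _ _) ⟩
      U c z + Σ< m (λ j → u c z j j) + U z c
        ≡⟨ cong (λ w → U c z + w + U z c) (Σ<-cong m (λ j _ → diagonal j)) ⟩
      U c z + Tr (h 0 * c * z) + U z c
        ≡⟨ (solve 3 (λ a b d → a :+ b :+ d := b :+ (a :+ d)) refl (U c z) (Tr (h 0 * c * z)) (U z c)) ⟩
      Tr (h 0 * c * z) + (U c z + U z c)
        ∎
      where
      open ≡-Reasoning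
      diagonal : ∀ j → u c z j j ≡ φ j (h 0 * c * z)
      diagonal j rewrite ℕ.n∸n≡0 j = sym (trans (φ-* j _ _) (cong (_* φ j z) (φ-* j _ _)))
      entry : ∀ i k → φ i c * φ i (h k * φ k z) ≡ φ i (h k) * φ i c * φ (i ℕ.+ k) z
      entry i k = trans (cong (φ i c *_) (trans (φ-* i _ _) (cong (φ i (h k) *_) (φ-∘ i k z))))
        (solve 3 (λ a b d → a :* (b :* d) := b :* a :* d) refl (φ i c) (φ i (h k)) (φ (i ℕ.+ k) z))
      low : ∀ i k → φ i c * φ i (h k * φ k z) ≡ u c z i (i ℕ.+ k)
      low i k = trans (entry i k) (cong (λ n → φ i (h n) * φ i c * φ (i ℕ.+ k) z) (sym (ℕ.m+n∸m≡n i k)))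
      high : ∀ i j → i < m → j < i → φ i c * φ i (h (m ∸ i ℕ.+ j) * φ (m ∸ i ℕ.+ j) z) ≡ u z c j i
      high i j i<m j<i = begin
        φ i c * φ i (h (m ∸ i ℕ.+ j) * φ (m ∸ i ℕ.+ j) z)
          ≡⟨ entry i (m ∸ i ℕ.+ j) ⟩
        φ i (h (m ∸ i ℕ.+ j)) * φ i c * φ (i ℕ.+ (m ∸ i ℕ.+ j)) z
          ≡⟨ cong₂ (λ a b → a * φ i c * b) coefficient wrap ⟩
        φ j (h (i ∸ j)) * φ i c * φ j z
          ≡⟨ (solve 3 (λ a b d → a :* b :* d := a :* d :* b) refl (φ j (h (i ∸ j))) (φ i c) (φ j z)) ⟩
        φ j (h (i ∸ j)) * φ j z * φ i c
          ∎
        where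
        wrap : φ (i ℕ.+ (m ∸ i ℕ.+ j)) z ≡ φ j z
        wrap = trans (cong (λ n → φ n z) (trans (sym (ℕ.+-assoc i (m ∸ i) j))
          (trans (cong (ℕ._+ j) (ℕ.m+[n∸m]≡n (ℕ.<⇒≤ i<m))) (ℕ.+-comm m j))))
          (trans (sym (φ-∘ j m z)) (cong (φ j) (φ-m z)))
        index : m ∸ (i ∸ j) ≡ m ∸ i ℕ.+ j
        index = trans (cong (_∸ (i ∸ j)) (sym (ℕ.m∸n+n≡m (ℕ.<⇒≤ i<m))))
          (trans (ℕ.+-∸-assoc (m ∸ i) (ℕ.m∸n≤m i j)) (cong (m ∸ i ℕ.+_) (ℕ.m∸[m∸n]≡n (ℕ.<⇒≤ j<i))))
        coefficient : φ i (h (m ∸ i ℕ.+ j)) ≡ φ j (h (i ∸ j))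
        coefficient = sym (begin
          φ j (h (i ∸ j))                          ≡⟨ cong (φ j) (h-sym (i ∸ j) (ℕ.m<n⇒0<n∸m j<i) (ℕ.≤-<-trans (ℕ.m∸n≤m i j) i<m)) ⟩
          φ j (φ (i ∸ j) (h (m ∸ (i ∸ j))))        ≡⟨ φ-∘ j (i ∸ j) _ ⟩
          φ (j ℕ.+ (i ∸ j)) (h (m ∸ (i ∸ j)))      ≡⟨ cong₂ (λ a b → φ a (h b)) (ℕ.m+[n∸m]≡n (ℕ.<⇒≤ j<i)) index ⟩
          φ i (h (m ∸ i ℕ.+ j))                    ∎)
      row : ∀ i → i < m → φ i (c * Lin h z) ≡ Σ< (m ∸ i) (λ k → u c z i (i ℕ.+ k)) + Σ< i (λ j → u z c j i)
      row i i<m = begin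
        φ i (c * Lin h z)
          ≡⟨ φ-* i c _ ⟩
        φ i c * φ i (Lin h z)
          ≡⟨ cong (φ i c *_) (additive-Σ< (φ-+ i) m _) ⟩
        φ i c * Σ< m (λ k → φ i (h k * φ k z))
          ≡⟨ Σ<-*ˡ m (φ i c) _ ⟩
        Σ< m (λ k → φ i c * φ i (h k * φ k z))
          ≡⟨ cong (λ n → Σ< n (λ k → φ i c * φ i (h k * φ k z))) (ℕ.m∸n+n≡m (ℕ.<⇒≤ i<m)) ⟨
        Σ< (m ∸ i ℕ.+ i) (λ k → φ i c * φ i (h k * φ k z))
          ≡⟨ Σ<-split (m ∸ i) i _ ⟩
        Σ< (m ∸ i) (λ k → φ i c * φ i (h k * φ k z)) + Σ< i (λ j → φ i c * φ i (h (m ∸ i ℕ.+ j) * φ (m ∸ i ℕ.+ j) z))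
          ≡⟨ cong₂ _+_ (Σ<-cong (m ∸ i) (λ k _ → low i k)) (Σ<-cong i (λ j j<i → high i j i<m j<i)) ⟩
        Σ< (m ∸ i) (λ k → u c z i (i ℕ.+ k)) + Σ< i (λ j → u z c j i)
          ∎

    -- Squaring moves the index pair (i, j) to (i + 1, j + 1), and h-sym identifies
    -- the pairs (i, m) leaving the triangle with the missing pairs (0, i).
    Q-sq : ∀ c → Q c * Q c ≡ Q c
    Q-sq c = trans (sym (φ1≡sq _)) (sym (+-cancelʳ (Σ< m (λ j → w 0 (suc j))) _ _ (begin
      Q c + Σ< m (λ j → w 0 (suc j))                    ≡⟨ cong (Q c +_) (edge m refl) ⟨
      Q c + Σ< m (λ i → w i m)                          ≡⟨⟩
      Σ< (suc m) (λ j → Σ< j (λ i → w i j))             ≡⟨ Σ<-head m _ ⟩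
      0# + Σ< m (λ j → Σ< (suc j) (λ i → w i (suc j)))  ≡⟨ +-identityˡ _ ⟩
      Σ< m (λ j → Σ< (suc j) (λ i → w i (suc j)))       ≡⟨ Σ<-cong m (λ j _ → Σ<-head j _) ⟩
      Σ< m (λ j → w 0 (suc j) + Σ< j (λ i → w (suc i) (suc j)))  ≡⟨ Σ<-+ m _ _ ⟩
      Σ< m (λ j → w 0 (suc j)) + Σ< m (λ j → Σ< j (λ i → w (suc i) (suc j)))  ≡⟨ +-comm _ _ ⟩
      Σ< m (λ j → Σ< j (λ i → w (suc i) (suc j))) + Σ< m (λ j → w 0 (suc j))  ≡⟨ +-congʳ φ1-Q ⟨
      φ 1 (Q c) + Σ< m (λ j → w 0 (suc j))              ∎)))
      where
      open ≡-Reasoning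
      w = u c c
      φ1-w : ∀ i j → φ 1 (w i j) ≡ w (suc i) (suc j)
      φ1-w i j = trans (φ-* 1 _ _) (cong₂ _*_ (trans (φ-* 1 _ _) (cong₂ _*_ (φ-∘ 1 i _) (φ-∘ 1 i c))) (φ-∘ 1 j c))
      φ1-Q : φ 1 (Q c) ≡ Σ< m (λ j → Σ< j (λ i → w (suc i) (suc j)))
      φ1-Q = trans (additive-Σ< (φ-+ 1) m _)
        (Σ<-cong m (λ j _ → trans (additive-Σ< (φ-+ 1) j _) (Σ<-cong j (λ i _ → φ1-w i j))))
      edge-term : ∀ i → suc i < m → w (suc i) m ≡ w 0 (suc i)
      edge-term i 1+i<m = trans
        (cong₂ (λ a b → a * φ (suc i) c * b) (sym (h-sym (suc i) (s≤s z≤n) 1+i<m)) (φ-m c))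
        (trans (solve 3 (λ a b c → a :* b :* c := a :* c :* b) refl (h (suc i)) (φ (suc i) c) c)
          (cong₂ (λ a b → a * b * φ (suc i) c) (sym (φ-0 _)) (sym (φ-0 c))))
      edge : ∀ n → n ≡ m → Σ< n (λ i → w i m) ≡ Σ< n (λ j → w 0 (suc j))
      edge zero    _     = refl
      edge (suc n) 1+n≡m = begin
        Σ< (suc n) (λ i → w i m)                 ≡⟨ Σ<-head n _ ⟩
        w 0 m + Σ< n (λ i → w (suc i) m)         ≡⟨ cong₂ _+_ (cong (w 0) (sym 1+n≡m))
                                                     (Σ<-cong n (λ i i<n → edge-term i (subst (suc i <_) 1+n≡m (s≤s i<n)))) ⟩
        w 0 (suc n) + Σ< n (λ j → w 0 (suc j))   ≡⟨ +-comm _ _ ⟩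
        Σ< (suc n) (λ j → w 0 (suc j))           ∎

  -- Coefficients of the adjoint of `Lin h` for the bilinear form Tr (x y).
  transpose : (ℕ → Carrier) → ℕ → Carrier
  transpose h zero    = h 0
  transpose h (suc i) = φ (suc i) (h (m ∸ suc i))

  -- Inside the trace the i-th term may be raised by φ_(m - i), which turns φ_i(c) back into c. The
  -- index m - i then labels the terms of the adjoint, with m read as 0.
  Tr-transpose : ∀ h c z → Tr (z * Lin h c) ≡ Tr (c * Lin (transpose h) z)
  Tr-transpose h c z = begin
    Tr (z * Lin h c)                        ≡⟨ cong Tr (Σ<-*ˡ m z _) ⟩
    Tr (Σ< m (λ i → z * (h i * φ i c)))     ≡⟨ additive-Σ< Tr-+ m _ ⟩
    Σ< m (λ i → Tr (z * (h i * φ i c)))     ≡⟨ Σ<-cong m (λ i i<m → move i (ℕ.<⇒≤ i<m)) ⟩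
    Σ< m (λ i → Tr (c * term i))            ≡⟨ additive-Σ< Tr-+ m _ ⟨
    Tr (Σ< m (λ i → c * term i))            ≡⟨ cong Tr (Σ<-*ˡ m c _) ⟨
    Tr (c * Σ< m term)                      ≡⟨ cong (λ w → Tr (c * w)) (reindex m refl) ⟩
    Tr (c * Lin (transpose h) z)            ∎
    where
    open ≡-Reasoning
    term : ℕ → Carrier
    term i = φ (m ∸ i) (h i) * φ (m ∸ i) z
    move : ∀ i → i ≤ m → Tr (z * (h i * φ i c)) ≡ Tr (c * term i)
    move i i≤m = begin
      Tr (z * (h i * φ i c))                                      ≡⟨ Tr-φ (m ∸ i) _ ⟨
      Tr (φ (m ∸ i) (z * (h i * φ i c)))                          ≡⟨ cong Tr (trans (φ-* (m ∸ i) _ _) (cong (φ (m ∸ i) z *_) (φ-* (m ∸ i) _ _))) ⟩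
      Tr (φ (m ∸ i) z * (φ (m ∸ i) (h i) * φ (m ∸ i) (φ i c)))    ≡⟨ cong (λ w → Tr (φ (m ∸ i) z * (φ (m ∸ i) (h i) * w))) back ⟩
      Tr (φ (m ∸ i) z * (φ (m ∸ i) (h i) * c))                    ≡⟨ cong Tr (solve 3 (λ a b c → a :* (b :* c) := c :* (b :* a)) refl (φ (m ∸ i) z) (φ (m ∸ i) (h i)) c) ⟩
      Tr (c * term i)                                             ∎
      where
      back : φ (m ∸ i) (φ i c) ≡ c
      back = trans (φ-∘ (m ∸ i) i c) (trans (cong (λ n → φ n c) (ℕ.m∸n+n≡m i≤m)) (φ-m c))
    reindex : ∀ n → n ≡ m → Σ< n term ≡ Σ< n (λ i → transpose h i * φ i z)
    reindex zero    _     = refl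
    reindex (suc n) 1+n≡m = begin
      Σ< (suc n) term                                     ≡⟨ Σ<-head n term ⟩
      term 0 + Σ< n (λ i → term (suc i))                  ≡⟨ cong₂ _+_ (cong₂ _*_ (φ-m (h 0)) (trans (φ-m z) (sym (φ-0 z)))) (Σ<-reverse n _) ⟩
      h 0 * φ 0 z + Σ< n (λ i → term (suc (n ∸ suc i)))   ≡⟨ cong (h 0 * φ 0 z +_) (Σ<-cong n reflected) ⟩
      h 0 * φ 0 z + Σ< n (λ i → transpose h (suc i) * φ (suc i) z)  ≡⟨ Σ<-head n _ ⟨
      Σ< (suc n) (λ i → transpose h i * φ i z)            ∎
      where
      reflected : ∀ i → i < n → term (suc (n ∸ suc i)) ≡ transpose h (suc i) * φ (suc i) z
      reflected i i<n = cong₂ (λ a b → φ a (h b) * φ a z)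
        (trans (cong (m ∸_) index) (ℕ.m∸[m∸n]≡n (subst (suc i ≤_) 1+n≡m (ℕ.m≤n⇒m≤1+n i<n)))) index
        where
        index : suc (n ∸ suc i) ≡ m ∸ suc i
        index = trans (sym (ℕ.+-∸-assoc 1 i<n)) (cong (_∸ suc i) 1+n≡m)

  Tr-injective : ∀ v w → (∀ c → Tr (c * v) ≡ Tr (c * w)) → v ≡ w
  Tr-injective v w eq = x+y≡0⇒x≡y v w (Tr-nondegenerate (v + w) (λ c →
    trans (cong Tr (distribˡ c v w)) (trans (Tr-+ _ _) (trans (cong (_+ Tr (c * w)) (eq c)) (x+x≡0 _)))))

  -- The quadratic form S and the parameters of Construction E

  module Parameters (ω μ : Carrier) (ω≢0 : ω ≢ 0#) (μ≢0 : μ ≢ 0#)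
    (S : Carrier → Carrier) (f : ℕ → Carrier) (S-0 : S 0# ≡ 0#)
    (S-+ : ∀ c z → S (c + z) ≡ S c + S z + ω * Tr (μ * c * Lin f z))
    (S-quadratic : ∀ z → ω * S z + S z * S z ≡ Lin f z * Lin f z) where
    open ≡-Reasoning

    -- With h = μ f the polarisation Tr (μ c f(z)) becomes Tr (c h(z)). The condition μ f_i = (μ
    -- f_(m-i))^(2^i) of Construction E says that `Lin h` is self-adjoint for the trace form.
    h : ℕ → Carrier
    h i = μ * f i

    β : Carrier → Carrier → Carrier
    β c z = Tr (c * Lin h z)

    S-β : ∀ c z → S (c + z) ≡ S c + S z + ω * β c z
    S-β c z = trans (S-+ c z) (cong (λ w → S c + S z + ω * Tr w)
      (trans (solve 3 (λ μ c l → μ :* c :* l := c :* (μ :* l)) refl μ c (Lin f z)) (cong (c *_) (Lin-*ᶜ μ f z))))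

    β-sym : ∀ c z → β c z ≡ β z c
    β-sym c z = *-cancelˡ ω _ _ ω≢0 (+-cancelʳ (S c + S z) _ _ (begin
      ω * β c z + (S c + S z)   ≡⟨ +-comm _ _ ⟩
      S c + S z + ω * β c z     ≡⟨ S-β c z ⟨
      S (c + z)                 ≡⟨ cong S (+-comm c z) ⟩
      S (z + c)                 ≡⟨ S-β z c ⟩
      S z + S c + ω * β z c     ≡⟨ (solve 3 (λ a b d → a :+ b :+ d := d :+ (b :+ a)) refl (S z) (S c) (ω * β z c)) ⟩
      ω * β z c + (S c + S z)   ∎))

    β-alternating : ∀ c → β c c ≡ 0#
    β-alternating c = x*y≡0⇒y≡0 ω _ ω≢0 (begin
      ω * β c c                 ≡⟨ (solve₂ 2 (λ a b → b :=₂ a :+₂ a :+₂ b) refl (S c) (ω * β c c)) ⟩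
      S c + S c + ω * β c c     ≡⟨ S-β c c ⟨
      S (c + c)                 ≡⟨ cong S (x+x≡0 c) ⟩
      S 0#                      ≡⟨ S-0 ⟩
      0#                        ∎)

    h-transpose : ∀ i → i < m → h i ≡ transpose h i
    h-transpose = Lin-injective h (transpose h) (λ z → Tr-injective _ _ (λ c →
      trans (β-sym c z) (Tr-transpose h c z)))

    h-sym : ∀ i → 1 ≤ i → i < m → h i ≡ φ i (h (m ∸ i))
    h-sym (suc i) _ i<m = h-transpose (suc i) i<m

    open Polar h h-sym

    -- On the diagonal c = z the two copies of U cancel in `polar`, and Tr (h_0 c²) = 0 remains.
    -- Every v is a square, so Tr (v h_0) = 0 for all v.
    h0≡0 : h 0 ≡ 0#
    h0≡0 = Tr-nondegenerate (h 0) (λ v → begin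
      Tr (v * h 0)                   ≡⟨ cong (λ w → Tr (w * h 0)) (√-sq v) ⟨
      Tr (√ v * √ v * h 0)           ≡⟨ cong Tr (solve 2 (λ r k → r :* r :* k := k :* r :* r) refl (√ v) (h 0)) ⟩
      Tr (h 0 * √ v * √ v)           ≡⟨ (solve₂ 2 (λ a b → a :=₂ a :+₂ (b :+₂ b)) refl (Tr (h 0 * √ v * √ v)) (U (√ v) (√ v))) ⟩
      Tr (h 0 * √ v * √ v) + (U (√ v) (√ v) + U (√ v) (√ v))  ≡⟨ polar (√ v) (√ v) ⟨
      β (√ v) (√ v)                  ≡⟨ β-alternating (√ v) ⟩
      0#                             ∎)

    f0≡0 : f 0 ≡ 0#
    f0≡0 = x*y≡0⇒y≡0 μ _ μ≢0 h0≡0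

    -- S and ω Q have the same polarisation, so in characteristic two their sum is additive.
    L : Carrier → Carrier
    L c = S c + ω * Q c

    L-+ : Additive L
    L-+ c z = begin
      S (c + z) + ω * Q (c + z)
        ≡⟨ cong₂ (λ a b → a + ω * b) (trans (S-β c z) (cong (λ w → S c + S z + ω * w) β≡U)) (Q-+ c z) ⟩
      S c + S z + ω * (U c z + U z c) + ω * (Q c + Q z + (U c z + U z c))
        ≡⟨ (solve₂ 6 (λ s t ω v q r → s :+₂ t :+₂ ω :*₂ v :+₂ ω :*₂ (q :+₂ r :+₂ v) :=₂ s :+₂ ω :*₂ q :+₂ (t :+₂ ω :*₂ r)) refl (S c) (S z) ω (U c z + U z c) (Q c) (Q z)) ⟩
      L c + L z
        ∎
      where
      β≡U : β c z ≡ U c z + U z c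
      β≡U = trans (polar c z) (trans (+-congʳ (trans (cong (λ k → Tr (k * c * z)) h0≡0)
        (trans (cong Tr (solve 2 (λ c z → :0 :* c :* z := :0) refl c z)) (additive-0 Tr-+)))) (+-identityˡ _))

    s : ℕ → Carrier
    s = proj₁ (additive⇒linearised L-+)

    L≡ : ∀ c → L c ≡ Lin s c
    L≡ = proj₂ (additive⇒linearised L-+)

    S≡ : ∀ c → S c ≡ Lin s c + ω * Q c
    S≡ c = trans (solve₂ 2 (λ a b → a :=₂ (a :+₂ b) :+₂ b) refl (S c) (ω * Q c)) (cong (_+ ω * Q c) (L≡ c))

    -- Passing from S to L adds ω²(Q + Q²) to ω S + S², and this is 0 because Q has values in F₂.
    L-quadratic : ∀ z → ω * Lin s z + φ 1 (Lin s z) ≡ φ 1 (Lin f z)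
    L-quadratic z = begin
      ω * Lin s z + φ 1 (Lin s z)        ≡⟨ cong₂ (λ a b → ω * a + b) (sym (L≡ z)) (trans (cong (φ 1) (sym (L≡ z))) (φ1≡sq _)) ⟩
      ω * L z + L z * L z                ≡⟨ (solve₂ 3 (λ ω a q → ω :*₂ (a :+₂ ω :*₂ q) :+₂ (a :+₂ ω :*₂ q) :*₂ (a :+₂ ω :*₂ q) :=₂ ω :*₂ a :+₂ a :*₂ a :+₂ ω :*₂ ω :*₂ (q :+₂ q :*₂ q)) refl ω (S z) (Q z)) ⟩
      ω * S z + S z * S z + ω * ω * (Q z + Q z * Q z)  ≡⟨ cong (λ w → ω * S z + S z * S z + ω * ω * (Q z + w)) (Q-sq z) ⟩
      ω * S z + S z * S z + ω * ω * (Q z + Q z)  ≡⟨ (solve₂ 3 (λ a ω q → a :+₂ ω :*₂ ω :*₂ (q :+₂ q) :=₂ a) refl (ω * S z + S z * S z) ω (Q z)) ⟩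
      ω * S z + S z * S z                ≡⟨ S-quadratic z ⟩
      Lin f z * Lin f z                  ≡⟨ φ1≡sq _ ⟨
      φ 1 (Lin f z)                      ∎

    -- With indices modulo m this reads ω s_i + s_(i-1)² = f_(i-1)².
    recursion : ∀ i → i < m → ω * s i + rotate m s i ≡ rotate m f i
    recursion = Lin-injective (λ i → ω * s i + rotate m s i) (rotate m f) (λ z →
      trans (sym (trans (cong₂ _+_ (Lin-*ᶜ ω s z) (φ1-Lin s z)) (Lin-+ᶜ _ _ z)))
        (trans (L-quadratic z) (φ1-Lin f z)))

    pow2 : ∀ i x → x ^ᶠ (2 ℕ.^ i) ≡ φ i x
    pow2 i x = cong (λ b → x ^ᶠ (b ℕ.^ i)) (sym p≡2)

    ωφ : ℕ → Carrier
    ωφ j = ω * φ j (ω ⁻¹)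

    partialSum : ℕ → Carrier
    partialSum i = Σ< i (λ k → ωφ (suc k) * φ (suc k) (f (suc i ∸ suc k)))

    sφ : ℕ → Carrier
    sφ zero    = s 0
    sφ (suc i) = partialSum i + ωφ (suc i) * φ (suc i) (s 0)

    ω*ωφ1 : ω * ωφ 1 ≡ 1#
    ω*ωφ1 = begin
      ω * (ω * φ 1 (ω ⁻¹))    ≡⟨ *-assoc _ _ _ ⟨
      ω * ω * φ 1 (ω ⁻¹)      ≡⟨ cong (_* φ 1 (ω ⁻¹)) (φ1≡sq ω) ⟨
      φ 1 ω * φ 1 (ω ⁻¹)      ≡⟨ φ-* 1 _ _ ⟨
      φ 1 (ω * ω ⁻¹)          ≡⟨ cong (φ 1) (⁻¹-inverse ω ω≢0) ⟩
      φ 1 1#                  ≡⟨ φ-1# 1 ⟩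
      1#                      ∎

    -- Since `ωφ k` is ω^(1 - 2^k), both sides carry the factor ω^(2 - 2^(k+1)). Multiplication by ω
    -- thus turns each term of the closed formula into the square of its predecessor.
    ω*ωφ : ∀ k x → ω * (ωφ (suc k) * φ (suc k) x) ≡ φ 1 (ωφ k * φ k x)
    ω*ωφ k x = sym (begin
      φ 1 (ωφ k * φ k x)                          ≡⟨ trans (φ-* 1 _ _) (*-congʳ (φ-* 1 _ _)) ⟩
      φ 1 ω * φ 1 (φ k (ω ⁻¹)) * φ 1 (φ k x)      ≡⟨ cong₂ _*_ (cong₂ _*_ (φ1≡sq ω) (φ-∘ 1 k _)) (φ-∘ 1 k x) ⟩
      ω * ω * φ (suc k) (ω ⁻¹) * φ (suc k) x      ≡⟨ (solve 3 (λ ω a b → ω :* ω :* a :* b := ω :* (ω :* a :* b)) refl ω (φ (suc k) (ω ⁻¹)) (φ (suc k) x)) ⟩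
      ω * (ωφ (suc k) * φ (suc k) x)              ∎)

    -- At index 0 the sum is empty and f_0 = 0 accounts for the last term. Later the first summand
    -- supplies the square of f, and the other summands are the squares of the preceding sum.
    sφ-step : ∀ i → ω * sφ (suc i) ≡ φ 1 (sφ i) + φ 1 (f i)
    sφ-step zero = begin
      ω * (0# + ωφ 1 * φ 1 (s 0))   ≡⟨ (solve 3 (λ ω a b → ω :* (:0 :+ a :* b) := ω :* a :* b) refl ω (ωφ 1) (φ 1 (s 0))) ⟩
      ω * ωφ 1 * φ 1 (s 0)          ≡⟨ cong (_* φ 1 (s 0)) ω*ωφ1 ⟩
      1# * φ 1 (s 0)                ≡⟨ (solve 1 (λ b → :1 :* b := b :+ :0) refl (φ 1 (s 0))) ⟩
      φ 1 (s 0) + 0#                ≡⟨ cong (φ 1 (s 0) +_) (trans (cong (φ 1) f0≡0) (additive-0 (φ-+ 1))) ⟨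
      φ 1 (s 0) + φ 1 (f 0)         ∎
    sφ-step (suc i) = begin
      ω * (partialSum (suc i) + ωφ (2 ℕ.+ i) * φ (2 ℕ.+ i) (s 0))
        ≡⟨ trans (distribˡ _ _ _) (cong₂ _+_ tail (ω*ωφ (suc i) (s 0))) ⟩
      φ 1 (f (suc i)) + φ 1 (partialSum i) + φ 1 (ωφ (suc i) * φ (suc i) (s 0))
        ≡⟨ trans (+-assoc _ _ _) (+-comm _ _) ⟩
      φ 1 (partialSum i) + φ 1 (ωφ (suc i) * φ (suc i) (s 0)) + φ 1 (f (suc i))
        ≡⟨ cong (_+ φ 1 (f (suc i))) (φ-+ 1 _ _) ⟨
      φ 1 (sφ (suc i)) + φ 1 (f (suc i))
        ∎
      where
      tail : ω * partialSum (suc i) ≡ φ 1 (f (suc i)) + φ 1 (partialSum i)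
      tail = begin
        ω * partialSum (suc i)
          ≡⟨ trans (cong (ω *_) (Σ<-head i _)) (distribˡ _ _ _) ⟩
        ω * (ωφ 1 * φ 1 (f (suc i))) + ω * Σ< i (λ k → ωφ (2 ℕ.+ k) * φ (2 ℕ.+ k) (f (suc i ∸ suc k)))
          ≡⟨ cong₂ _+_ (trans (sym (*-assoc _ _ _)) (trans (cong (_* φ 1 (f (suc i))) ω*ωφ1) (*-identityˡ _)))
               (trans (Σ<-*ˡ i ω _) (Σ<-cong i (λ k _ → ω*ωφ (suc k) (f (suc i ∸ suc k))))) ⟩
        φ 1 (f (suc i)) + Σ< i (λ k → φ 1 (ωφ (suc k) * φ (suc k) (f (suc i ∸ suc k))))
          ≡⟨ cong (φ 1 (f (suc i)) +_) (additive-Σ< (φ-+ 1) i _) ⟨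
        φ 1 (f (suc i)) + φ 1 (partialSum i)
          ∎

    s≡sφ : ∀ i → i < m → s i ≡ sφ i
    s≡sφ zero    _   = refl
    s≡sφ (suc i) i<m = *-cancelˡ ω _ _ ω≢0 (begin
      ω * s (suc i)                           ≡⟨ (solve₂ 2 (λ a b → a :=₂ b :+₂ (a :+₂ b)) refl (ω * s (suc i)) (φ 1 (s i))) ⟩
      φ 1 (s i) + (ω * s (suc i) + φ 1 (s i)) ≡⟨ cong (φ 1 (s i) +_) (recursion (suc i) i<m) ⟩
      φ 1 (s i) + φ 1 (f i)                   ≡⟨ cong (λ w → φ 1 w + φ 1 (f i)) (s≡sφ i (ℕ.<-trans (ℕ.n<1+n i) i<m)) ⟩
      φ 1 (sφ i) + φ 1 (f i)                  ≡⟨ sφ-step i ⟨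
      ω * sφ (suc i)                          ∎)

    -- The recursion at index 0 says that the closed formula, continued to index m, returns s_0. Its
    -- last term is already s_0, because `ωφ m` is ω ω⁻¹ = 1, so the sum has to vanish.
    closing : ∀ n → suc n ≡ m → partialSum n ≡ 0#
    closing n 1+n≡m = +-cancelʳ (s 0) _ _ (begin
      partialSum n + s 0                            ≡⟨ cong (partialSum n +_) wrap ⟨
      sφ (suc n)                                    ≡⟨ *-cancelˡ ω _ _ ω≢0 (trans (sφ-step n) (sym around)) ⟩
      s 0                                           ≡⟨ +-identityˡ _ ⟨
      0# + s 0                                      ∎)
      where
      wrap : ωφ (suc n) * φ (suc n) (s 0) ≡ s 0
      wrap = subst (λ k → ωφ k * φ k (s 0) ≡ s 0) (sym 1+n≡m)
        (trans (cong₂ (λ a b → ω * a * b) (φ-m (ω ⁻¹)) (φ-m (s 0)))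
          (trans (cong (_* s 0) (⁻¹-inverse ω ω≢0)) (*-identityˡ _)))
      n≡m∸1 : m ∸ 1 ≡ n
      n≡m∸1 = cong (_∸ 1) (sym 1+n≡m)
      around : ω * s 0 ≡ φ 1 (sφ n) + φ 1 (f n)
      around = begin
        ω * s 0                                        ≡⟨ (solve₂ 2 (λ a b → a :=₂ b :+₂ (a :+₂ b)) refl (ω * s 0) (φ 1 (s (m ∸ 1)))) ⟩
        φ 1 (s (m ∸ 1)) + (ω * s 0 + φ 1 (s (m ∸ 1)))  ≡⟨ cong (φ 1 (s (m ∸ 1)) +_) (recursion 0 m-pos) ⟩
        φ 1 (s (m ∸ 1)) + φ 1 (f (m ∸ 1))              ≡⟨ cong (λ k → φ 1 (s k) + φ 1 (f k)) n≡m∸1 ⟩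
        φ 1 (s n) + φ 1 (f n)                          ≡⟨ cong (λ w → φ 1 w + φ 1 (f n)) (s≡sφ n (subst (n <_) 1+n≡m (ℕ.n<1+n n))) ⟩
        φ 1 (sφ n) + φ 1 (f n)                         ∎

    ωpow≡ωφ : ∀ j → ωpow ω j ≡ ωφ j
    ωpow≡ωφ j = cong (ω *_) (pow2 j (ω ⁻¹))

    sE≡sφ : ∀ i → sE ω f (s 0) i ≡ sφ i
    sE≡sφ zero    = refl
    sE≡sφ (suc i) = cong₂ _+_
      (Σ<-cong i (λ k _ → cong₂ _*_ (ωpow≡ωφ (suc k)) (pow2 (suc k) _)))
      (cong₂ _*_ (ωpow≡ωφ (suc i)) (pow2 (suc i) _))

    constrE-params : ConstrE-params ω μ f (s 0)
    constrE-params = ω≢0 , μ≢0 , f0≡0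
      , (λ i 1≤i i≤m∸1 → trans (h-sym i 1≤i (ℕ.≤-<-trans i≤m∸1 m∸1<m)) (sym (pow2 i _)))
      , trans (Σ<-cong (m ∸ 1) (λ k _ → cong₂ _*_ (ωpow≡ωφ (suc k))
                (trans (pow2 (suc k) _) (cong (λ n → φ (suc k) (f (n ∸ suc k))) (sym 1+[m∸1]≡m)))))
          (closing (m ∸ 1) 1+[m∸1]≡m)
      where
      1+[m∸1]≡m : suc (m ∸ 1) ≡ m
      1+[m∸1]≡m = ℕ.m+[n∸m]≡n m-pos
      m∸1<m : m ∸ 1 < m
      m∸1<m = subst (m ∸ 1 <_) 1+[m∸1]≡m (ℕ.n<1+n _)

    S≡sE : ∀ c → S c ≡ Σ< m (λ i → sE ω f (s 0) i * c ^ᶠ (2 ℕ.^ i))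
      + ω * Σ< m (λ j → Σ< j (λ i →
          μ ^ᶠ (2 ℕ.^ i) * f (j ∸ i) ^ᶠ (2 ℕ.^ i) * c ^ᶠ (2 ℕ.^ i ℕ.+ 2 ℕ.^ j)))
    S≡sE c = trans (S≡ c) (cong₂ (λ a b → a + ω * b)
      (Σ<-cong m (λ i i<m → cong₂ _*_ (trans (s≡sφ i i<m) (sym (sE≡sφ i))) (sym (pow2 i c))))
      (Σ<-cong m (λ j _ → Σ<-cong j (λ i _ → quadratic-term i j))))
      where
      quadratic-term : ∀ i j → u c c i j ≡
        μ ^ᶠ (2 ℕ.^ i) * f (j ∸ i) ^ᶠ (2 ℕ.^ i) * c ^ᶠ (2 ℕ.^ i ℕ.+ 2 ℕ.^ j)
      quadratic-term i j = trans (*-assoc _ _ _) (cong₂ _*_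
        (trans (φ-* i _ _) (sym (cong₂ _*_ (pow2 i μ) (pow2 i (f (j ∸ i))))))
        (sym (trans (^ᶠ-+ c (2 ℕ.^ i) (2 ℕ.^ j)) (cong₂ _*_ (pow2 i c) (pow2 j c)))))

    tr≡Tr : ∀ x → tr x ≡ Tr x
    tr≡Tr x = Σ<-cong m (λ i _ → pow2 i x)

-- The functions T for which the matrices E(a, b, c, T(a, b, c)) form a group

module HomomorphicParameters (F : FiniteField) where
  open Over F
  open FieldArithmetic F
  open LinearisedPolynomials F

  cong₃ : ∀ {A B C D : Set} (f : A → B → C → D) {a a′ b b′ c c′} → a ≡ a′ → b ≡ b′ → c ≡ c′ → f a b c ≡ f a′ b′ c′
  cong₃ f refl refl refl = refl

  all-or-counterexample : ∀ {P : Carrier → Set} → (∀ x → Dec (P x)) → (∀ x → P x) ⊎ (∃[ x ] ¬ P x)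
  all-or-counterexample P? with all? P? elements
  ... | yes all = inj₁ (λ x → All.lookup all (elements-complete x))
  ... | no ¬all = inj₂ (Any.satisfied (All.¬All⇒Any¬ P? elements ¬all))

  ∀? : ∀ {P : Carrier → Set} → (∀ x → Dec (P x)) → Dec (∀ x → P x)
  ∀? P? with all-or-counterexample P?
  ... | inj₁ all      = yes all
  ... | inj₂ (x , ¬P) = no (λ all → ¬P (all x))

  -- The arguments on the left of `T-hom` are the last row of the product of E(a, b, c, T(a, b, c))
  -- and E(x, y, z, T(x, y, z)); in this product the entries t add up.
  module Classification (T : Carrier → Carrier → Carrier → Carrier)
    (T-hom : ∀ a b c x y z →
       T (a + x - b * z + c * (y - z * T x y z)) (b + y + c * T x y z) (c + z) ≡ T a b c + T x y z) where
    open ≡-Reasoning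

    A B S : Carrier → Carrier
    A x = T x 0# 0#
    B y = T 0# y 0#
    S z = T 0# 0# z

    T-left : ∀ a b x y z → T (a + x - b * z) (b + y) z ≡ T a b 0# + T x y z
    T-left a b x y z = trans (cong₃ T
      (solve 6 (λ a x b z y t → a :+ x :- b :* z := a :+ x :- b :* z :+ :0 :* (y :- z :* t)) refl a x b z y (T x y z))
      (solve 3 (λ b y t → b :+ y := b :+ y :+ :0 :* t) refl b y (T x y z)) (sym (+-identityˡ z))) (T-hom a b 0# x y z)

    A-+ : Additive A
    A-+ a x = trans (cong₃ T (solve 2 (λ a x → a :+ x := a :+ x :- :0 :* :0) refl a x) (sym (+-identityˡ 0#)) refl) (T-left a 0# x 0# 0#)

    B-+ : Additive B
    B-+ b y = trans (cong₃ T (solve 1 (λ b → :0 := :0 :+ :0 :- b :* :0) refl b) refl refl) (T-left 0# b 0# y 0#)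

    T-plane : ∀ a b → T a b 0# ≡ A a + B b
    T-plane a b = trans (cong₃ T (solve 1 (λ a → a := a :+ :0 :- :0 :* :0) refl a) (sym (+-identityˡ b)) refl) (T-left a 0# 0# b 0#)

    -- In the twisted group law (x, y, z) is the product of (x + y z, y, 0) and (0, 0, z).
    T-split : ∀ x y z → T x y z ≡ A (x + y * z) + B y + S z
    T-split x y z = begin
      T x y z                                      ≡⟨ cong₃ T (solve 3 (λ x y z → x := x :+ y :* z :+ :0 :- y :* z) refl x y z) (sym (+-identityʳ y)) refl ⟩
      T (x + y * z + 0# - y * z) (y + 0#) z        ≡⟨ T-left (x + y * z) y 0# 0# z ⟩
      T (x + y * z) y 0# + T 0# 0# z               ≡⟨ cong (_+ S z) (T-plane _ _) ⟩
      A (x + y * z) + B y + S z                    ∎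

    -- Compare the two products of (0, 0, z) with (a, b, 0).
    plane-relation : ∀ z a b → A (z * b + z * b + z * z * T a b 0#) + B (z * T a b 0#) ≡ 0#
    plane-relation z a b = +-cancelʳ (A a + B b + S z) _ _ (begin
      A k + B (z * t) + (A a + B b + S z)
        ≡⟨ (solve 5 (λ v w a b s → v :+ w :+ (a :+ b :+ s) := a :+ v :+ (b :+ w) :+ s) refl (A k) (B (z * t)) (A a) (B b) (S z)) ⟩
      A a + A k + (B b + B (z * t)) + S z
        ≡⟨ cong₂ (λ v w → v + w + S z) (A-+ a k) (B-+ b (z * t)) ⟨
      A (a + k) + B (b + z * t) + S z
        ≡⟨ cong₃ (λ u v w → A u + B v + S w)
             (solve 4 (λ a z b t → a :+ (z :* b :+ z :* b :+ z :* z :* t) := :0 :+ a :- :0 :* :0 :+ z :* (b :- :0 :* t) :+ (:0 :+ b :+ z :* t) :* (z :+ :0)) refl a z b t)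
             (solve 3 (λ b z t → b :+ z :* t := :0 :+ b :+ z :* t) refl b z t) (sym (+-identityʳ z)) ⟩
      A (0# + a - 0# * 0# + z * (b - 0# * t) + (0# + b + z * t) * (z + 0#)) + B (0# + b + z * t) + S (z + 0#)
        ≡⟨ T-split _ _ _ ⟨
      T (0# + a - 0# * 0# + z * (b - 0# * t)) (0# + b + z * t) (z + 0#)
        ≡⟨ T-hom 0# 0# z a b 0# ⟩
      S z + t
        ≡⟨ trans (cong (S z +_) (T-plane a b)) (+-comm _ _) ⟩
      A a + B b + S z
        ≡⟨ +-identityˡ _ ⟨
      0# + (A a + B b + S z)
        ∎)
      where
      t = T a b 0#
      k = z * b + z * b + z * z * t

    -- With t = S(z) the product of (0, 0, c) and (0, 0, z) is (- c z t, c t, c + z), and `T-split`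
    -- takes A at - c z t + c t (c + z) = c² t.
    S-relation : ∀ c z → A (c * c * S z) + B (c * S z) + S (c + z) ≡ S c + S z
    S-relation c z = begin
      A (c * c * t) + B (c * t) + S (c + z)
        ≡⟨ cong₂ (λ u v → A u + B v + S (c + z))
             (solve 3 (λ c z t → c :* c :* t := :0 :+ :0 :- :0 :* z :+ c :* (:0 :- z :* t) :+ (:0 :+ :0 :+ c :* t) :* (c :+ z)) refl c z t)
             (solve 2 (λ c t → c :* t := :0 :+ :0 :+ c :* t) refl c t) ⟩
      A (0# + 0# - 0# * z + c * (0# - z * t) + (0# + 0# + c * t) * (c + z)) + B (0# + 0# + c * t) + S (c + z)
        ≡⟨ T-split _ _ _ ⟨
      T (0# + 0# - 0# * z + c * (0# - z * t)) (0# + 0# + c * t) (c + z)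
        ≡⟨ T-hom 0# 0# c 0# 0# z ⟩
      S c + S z
        ∎
      where t = S z

    S-0 : S 0# ≡ 0#
    S-0 = additive-0 A-+

    FormA FormE : Set
    FormA = ∃[ S₁ ] (∀ a b c → T a b c ≡ T-A S₁ a b c)
    FormE = p ≡ 2 × ∃[ ω ] ∃[ μ ] ∃[ f ] ∃[ s₀ ]
      (ConstrE-params ω μ f s₀ × (∀ a b c → T a b c ≡ T-E ω μ f s₀ a b c))

    plane-relation₀ : ∀ z a → A (z * z * A a) + B (z * A a) ≡ 0#
    plane-relation₀ z a = trans (cong (λ k → A k + B (z * A a))
      (solve 2 (λ z t → z :* z :* t := z :* :0 :+ z :* :0 :+ z :* z :* t) refl z (A a))) (plane-relation z a 0#)

    A≡0⇒formA : (∀ x → A x ≡ 0#) → FormA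
    A≡0⇒formA A≡0 = proj₁ S-lin , λ a b c → trans (T≡S a b c) (proj₂ S-lin c)
      where
      -- For A = 0 the plane relation says that B vanishes on all multiples of its values, and y is
      -- a multiple of B(y) as soon as B(y) ≠ 0.
      B≡0 : ∀ y → B y ≡ 0#
      B≡0 y = decidable-stable (B y ≟ 0#) λ By≢0 → By≢0 (begin
        B y                          ≡⟨ cong B (trans (sym (*-identityʳ y)) (cong (y *_) (sym (⁻¹-inverseˡ (B y) By≢0)))) ⟩
        B (y * (B y ⁻¹ * B y))       ≡⟨ cong B (*-assoc _ _ _) ⟨
        B (y * B y ⁻¹ * B y)         ≡⟨ B*B (y * B y ⁻¹) y ⟩
        0#                           ∎)
        where
        B*B : ∀ z b → B (z * B b) ≡ 0#
        B*B z b = trans (sym (+-identityˡ _)) (trans (cong₂ (λ u v → u + B (z * v)) (sym (A≡0 _))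
          (sym (trans (T-plane 0# b) (trans (cong (_+ B b) (A≡0 0#)) (+-identityˡ _))))) (plane-relation z 0# b))
      S-+ : Additive S
      S-+ c z = trans (sym (trans (cong₂ (λ u v → u + v + S (c + z)) (A≡0 _) (B≡0 _))
        (solve 1 (λ s → :0 :+ :0 :+ s := s) refl (S (c + z))))) (S-relation c z)
      T≡S : ∀ a b c → T a b c ≡ S c
      T≡S a b c = trans (T-split a b c) (trans (cong₂ (λ u v → u + v + S c) (A≡0 _) (B≡0 _)) (solve 1 (λ s → :0 :+ :0 :+ s := s) refl (S c)))
      S-lin : Linearised S
      S-lin = additive⇒linearised S-+

    module _ (p≢2 : p ≢ 2) where
      2≢0 : 1# + 1# ≢ 0#
      2≢0 eq = p∤n⇒n·1≢0 2 (λ p∣2 → p≢2 (ℕ.≤-antisym (∣⇒≤ p∣2) p>1)) (trans (cong (1# +_) (+-identityʳ 1#)) eq)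

      -- Replacing z by - z changes the sign of the B-term only; the sum of the two relations is
      -- twice the A-term.
      A-square : ∀ z a → A (z * z * A a) ≡ 0#
      A-square z a = x*y≡0⇒y≡0 (1# + 1#) _ 2≢0 (begin
        (1# + 1#) * α                              ≡⟨ (solve 2 (λ α β → (:1 :+ :1) :* α := (α :+ β) :+ (α :+ :- β)) refl α β) ⟩
        (α + β) + (α + - β)                        ≡⟨ cong₂ _+_ (plane-relation₀ z a) reflected ⟩
        0# + 0#                                    ≡⟨ +-identityˡ 0# ⟩
        0#                                         ∎)
        where
        α = A (z * z * A a)
        β = B (z * A a)
        reflected : α + - β ≡ 0#
        reflected = trans (cong₂ _+_ (cong A (solve 2 (λ z t → z :* z :* t := :- z :* :- z :* t) refl z (A a)))
          (trans (sym (additive-neg B-+ _)) (cong B (solve 2 (λ z t → :- (z :* t) := :- z :* t) refl z (A a)))))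
          (plane-relation₀ (- z) a)

      A≡0 : ∀ a → A a ≡ 0#
      A≡0 a = decidable-stable (A a ≟ 0#) λ Aa≢0 → Aa≢0 (vanish Aa≢0)
        where
        -- Squares span the field: 4 v = (v + 1)² - (v - 1)².
        vanish : A a ≢ 0# → A a ≡ 0#
        vanish t≢0 = begin
          A a                                  ≡⟨ cong A a≡ ⟩
          A (q + - r)                          ≡⟨ A-+ _ _ ⟩
          A q + A (- r)                        ≡⟨ cong (A q +_) (additive-neg A-+ r) ⟩
          A q + - A r                          ≡⟨ cong₂ (λ x y → x + - y) (A-square (v + 1#) a) (A-square (v - 1#) a) ⟩
          0# + - 0#                            ≡⟨ -‿inverseʳ 0# ⟩
          0#                                   ∎
          where
          t = A a
          d = (1# + 1#) * (1# + 1#) * t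
          d≢0 : d ≢ 0#
          d≢0 = *-nonzero (*-nonzero 2≢0 2≢0) t≢0
          v = a * d ⁻¹
          q = (v + 1#) * (v + 1#) * t
          r = (v - 1#) * (v - 1#) * t
          a≡ : a ≡ q + - r
          a≡ = begin
            a                 ≡⟨ *-identityʳ a ⟨
            a * 1#            ≡⟨ cong (a *_) (⁻¹-inverseˡ d d≢0) ⟨
            a * (d ⁻¹ * d)    ≡⟨ *-assoc _ _ _ ⟨
            v * d             ≡⟨ (solve 2 (λ v t → v :* ((:1 :+ :1) :* (:1 :+ :1) :* t) := (v :+ :1) :* (v :+ :1) :* t :+ :- ((v :- :1) :* (v :- :1) :* t)) refl v t) ⟩
            q + - r           ∎

      odd⇒formA : FormA
      odd⇒formA = A≡0⇒formA A≡0

    module _ (p≡2 : p ≡ 2) (a₀ : Carrier) (ω≢0 : A a₀ ≢ 0#) where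
      open CharacteristicTwo F p≡2
      ω = A a₀
      ω⁻¹ = ω ⁻¹

      relation₂ : ∀ z a b → A (z * z * T a b 0#) ≡ B (z * T a b 0#)
      relation₂ z a b = x+y≡0⇒x≡y _ _ (trans (cong (λ k → A k + B (z * T a b 0#))
        (solve₂ 3 (λ z b t → z :*₂ z :*₂ t :=₂ z :*₂ b :+₂ z :*₂ b :+₂ z :*₂ z :*₂ t) refl z b (T a b 0#))) (plane-relation z a b))

      -- Put z = y / t in `relation₂`. Every nonzero value t on the plane c = 0 thus yields the same
      -- B, which is what limits these values.
      B≡A : ∀ a b → T a b 0# ≢ 0# → ∀ y → B y ≡ A (y * y * T a b 0# ⁻¹)
      B≡A a b t≢0 y = sym (begin
        A (y * y * t ⁻¹)                                ≡⟨ cong A (trans (sym (*-identityʳ _)) (cong (y * y * t ⁻¹ *_) (sym (⁻¹-inverseˡ t t≢0)))) ⟩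
        A (y * y * t ⁻¹ * (t ⁻¹ * t))                   ≡⟨ cong A (solve 3 (λ y i t → y :* y :* i :* (i :* t) := y :* i :* (y :* i) :* t) refl y (t ⁻¹) t) ⟩
        A (y * t ⁻¹ * (y * t ⁻¹) * t)                   ≡⟨ relation₂ (y * t ⁻¹) a b ⟩
        B (y * t ⁻¹ * t)                                ≡⟨ cong B (trans (*-assoc _ _ _) (trans (cong (y *_) (⁻¹-inverseˡ t t≢0)) (*-identityʳ y))) ⟩
        B y                                             ∎)
        where t = T a b 0#

      -- Two distinct nonzero values t, ω would give A (y² (1/ω + 1/t)) = 0 for all y.
      values : ∀ a b → T a b 0# ≢ 0# → T a b 0# ≡ ω
      values a b t≢0 = decidable-stable (t ≟ ω) λ t≢ω → ω≢0 (vanish t≢ω)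
        where
        t = T a b 0#
        vanish : t ≢ ω → ω ≡ 0#
        vanish t≢ω = begin
          A a₀                                           ≡⟨ cong A a₀≡ ⟩
          A (y * y * ω⁻¹ + y * y * t ⁻¹)                 ≡⟨ A-+ _ _ ⟩
          A (y * y * ω⁻¹) + A (y * y * t ⁻¹)             ≡⟨ cong₂ _+_ (B≡A a₀ 0# ω≢0 y) (B≡A a b t≢0 y) ⟨
          B y + B y                                      ≡⟨ x+x≡0 _ ⟩
          0#                                             ∎
          where
          k = ω⁻¹ + t ⁻¹
          k≢0 : k ≢ 0#
          k≢0 k≡0 = t≢ω (begin
            t                  ≡⟨ trans (sym (*-identityʳ t)) (cong (t *_) (sym (⁻¹-inverseˡ ω ω≢0))) ⟩
            t * (ω⁻¹ * ω)      ≡⟨ cong (λ i → t * (i * ω)) (x+y≡0⇒x≡y _ _ k≡0) ⟩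
            t * (t ⁻¹ * ω)     ≡⟨ *-assoc _ _ _ ⟨
            t * t ⁻¹ * ω       ≡⟨ trans (cong (_* ω) (⁻¹-inverse t t≢0)) (*-identityˡ ω) ⟩
            ω                  ∎)
          y = √ (a₀ * k ⁻¹)
          a₀≡ : a₀ ≡ y * y * ω⁻¹ + y * y * t ⁻¹
          a₀≡ = begin
            a₀                         ≡⟨ trans (sym (*-identityʳ a₀)) (cong (a₀ *_) (sym (⁻¹-inverseˡ k k≢0))) ⟩
            a₀ * (k ⁻¹ * k)            ≡⟨ *-assoc _ _ _ ⟨
            a₀ * k ⁻¹ * k              ≡⟨ cong (_* k) (√-sq _) ⟨
            y * y * k                  ≡⟨ distribˡ _ _ _ ⟩
            y * y * ω⁻¹ + y * y * t ⁻¹ ∎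

      α : Carrier → Carrier
      α x = ω⁻¹ * A x

      α-+ : Additive α
      α-+ x y = trans (cong (ω⁻¹ *_) (A-+ x y)) (distribˡ _ _ _)

      α-idem : ∀ x → α x * α x ≡ α x
      α-idem x with A x ≟ 0#
      ... | yes Ax≡0 = trans (cong₂ _*_ αx≡0 αx≡0) (trans (zeroˡ 0#) (sym αx≡0))
        where
        αx≡0 : α x ≡ 0#
        αx≡0 = trans (cong (ω⁻¹ *_) Ax≡0) (zeroʳ _)
      ... | no Ax≢0 = trans (cong₂ _*_ αx≡1 αx≡1) (trans (*-identityˡ 1#) (sym αx≡1))
        where
        αx≡1 : α x ≡ 1#
        αx≡1 = trans (cong (ω⁻¹ *_) (values x 0# Ax≢0)) (⁻¹-inverseˡ ω ω≢0)

      κ : Carrier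
      κ = proj₁ (idempotent⇒trace α-+ α-idem)

      A≡Tr : ∀ x → A x ≡ ω * Tr (κ * x)
      A≡Tr x = begin
        A x                  ≡⟨ trans (sym (*-identityˡ _)) (cong (_* A x) (sym (⁻¹-inverse ω ω≢0))) ⟩
        ω * ω⁻¹ * A x        ≡⟨ *-assoc _ _ _ ⟩
        ω * α x              ≡⟨ cong (ω *_) (proj₂ (idempotent⇒trace α-+ α-idem) x) ⟩
        ω * Tr (κ * x)       ∎

      κ≢0 : κ ≢ 0#
      κ≢0 κ≡0 = ω≢0 (begin
        A a₀                ≡⟨ A≡Tr a₀ ⟩
        ω * Tr (κ * a₀)     ≡⟨ cong (λ k → ω * Tr k) (trans (cong (_* a₀) κ≡0) (zeroˡ a₀)) ⟩
        ω * Tr 0#           ≡⟨ cong (ω *_) (additive-0 Tr-+) ⟩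
        ω * 0#              ≡⟨ zeroʳ ω ⟩
        0#                  ∎)

      -- Chosen so that κ = μ² ω. Then B(y) = A(y² / ω) = ω Tr ((μ y)²) = ω Tr (μ y).
      μ : Carrier
      μ = √ (κ * ω⁻¹)

      μ²≡ : μ * μ ≡ κ * ω⁻¹
      μ²≡ = √-sq (κ * ω⁻¹)

      μ≢0 : μ ≢ 0#
      μ≢0 μ≡0 = *-nonzero κ≢0 (⁻¹-nonzero ω≢0) (trans (sym μ²≡) (trans (cong (_* μ) μ≡0) (zeroˡ μ)))

      κ≡ : κ ≡ μ * μ * ω
      κ≡ = begin
        κ                ≡⟨ trans (sym (*-identityʳ κ)) (cong (κ *_) (sym (⁻¹-inverseˡ ω ω≢0))) ⟩
        κ * (ω⁻¹ * ω)    ≡⟨ *-assoc _ _ _ ⟨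
        κ * ω⁻¹ * ω      ≡⟨ cong (_* ω) μ²≡ ⟨
        μ * μ * ω        ∎

      B≡Tr : ∀ y → B y ≡ ω * Tr (μ * y)
      B≡Tr y = begin
        B y                              ≡⟨ B≡A a₀ 0# ω≢0 y ⟩
        A (y * y * ω⁻¹)                  ≡⟨ A≡Tr _ ⟩
        ω * Tr (κ * (y * y * ω⁻¹))       ≡⟨ cong (λ w → ω * Tr w) (solve 3 (λ κ y i → κ :* (y :* y :* i) := κ :* i :* (y :* y)) refl κ y ω⁻¹) ⟩
        ω * Tr (κ * ω⁻¹ * (y * y))       ≡⟨ cong (λ w → ω * Tr (w * (y * y))) μ²≡ ⟨
        ω * Tr (μ * μ * (y * y))         ≡⟨ cong (λ w → ω * Tr w) (solve 2 (λ μ y → μ :* μ :* (y :* y) := μ :* y :* (μ :* y)) refl μ y) ⟩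
        ω * Tr (μ * y * (μ * y))         ≡⟨ cong (λ w → ω * Tr w) (φ1≡sq (μ * y)) ⟨
        ω * Tr (φ 1 (μ * y))             ≡⟨ cong (ω *_) (Tr-φ1 (μ * y)) ⟩
        ω * Tr (μ * y)                   ∎

      -- With s = S(z) the correction A(c² s) + B(c s) is ω Tr (μ² ω c² s + μ c s). Squaring the
      -- second term under the trace gives ω Tr ((μ c)² (ω s + s²)), and a square root of the whole
      -- argument gives ω Tr (μ c G(z)).
      R G : Carrier → Carrier
      R z = ω * S z + S z * S z
      G z = √ (R z)

      S-G : ∀ c z → S (c + z) ≡ S c + S z + ω * Tr (μ * c * G z)
      S-G c z = begin
        S (c + z)                                                ≡⟨ (solve₂ 2 (λ a e → a :=₂ e :+₂ a :+₂ e) refl (S (c + z)) (A (c * c * S z) + B (c * S z))) ⟩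
        A (c * c * S z) + B (c * S z) + S (c + z) + (A (c * c * S z) + B (c * S z))  ≡⟨ cong₂ _+_ (S-relation c z) AB ⟩
        S c + S z + ω * Tr (μ * c * G z)                         ∎
        where
        s = S z
        g = G z
        AB : A (c * c * s) + B (c * s) ≡ ω * Tr (μ * c * g)
        AB = begin
          A (c * c * s) + B (c * s)                                    ≡⟨ cong₂ _+_ (A≡Tr _) (B≡Tr _) ⟩
          ω * Tr (κ * (c * c * s)) + ω * Tr (μ * (c * s))              ≡⟨ distribˡ _ _ _ ⟨
          ω * (Tr (κ * (c * c * s)) + Tr (μ * (c * s)))                ≡⟨ cong₂ (λ u v → ω * (Tr (u * (c * c * s)) + v)) κ≡
                                                                            (sym (trans (cong Tr (sym (φ1≡sq _))) (Tr-φ1 _))) ⟩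
          ω * (Tr (μ * μ * ω * (c * c * s)) + Tr (μ * (c * s) * (μ * (c * s))))  ≡⟨ cong (ω *_) (Tr-+ _ _) ⟨
          ω * Tr (μ * μ * ω * (c * c * s) + μ * (c * s) * (μ * (c * s)))  ≡⟨ cong (λ w → ω * Tr w) (solve 4 (λ μ ω c s → μ :* μ :* ω :* (c :* c :* s) :+ μ :* (c :* s) :* (μ :* (c :* s)) := μ :* c :* (μ :* c) :* (ω :* s :+ s :* s)) refl μ ω c s) ⟩
          ω * Tr (μ * c * (μ * c) * R z)                               ≡⟨ cong (λ w → ω * Tr (μ * c * (μ * c) * w)) (√-sq (R z)) ⟨
          ω * Tr (μ * c * (μ * c) * (g * g))                           ≡⟨ cong (λ w → ω * Tr w) (solve 2 (λ k g → k :* k :* (g :* g) := k :* g :* (k :* g)) refl (μ * c) g) ⟩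
          ω * Tr (μ * c * g * (μ * c * g))                             ≡⟨ cong (ω *_) (trans (cong Tr (sym (φ1≡sq _))) (Tr-φ1 _)) ⟩
          ω * Tr (μ * c * g)                                           ∎

      -- The map x ↦ ω x + x² is additive and vanishes at 0 and ω, hence on ω times a trace, which
      -- is the defect of S in `S-G`.
      R-+ : Additive R
      R-+ c z = begin
        R (c + z)
          ≡⟨ cong (λ w → ω * w + w * w) (S-G c z) ⟩
        ω * (S c + S z + ω * e) + (S c + S z + ω * e) * (S c + S z + ω * e)
          ≡⟨ (solve₂ 4 (λ ω s t e → ω :*₂ (s :+₂ t :+₂ ω :*₂ e) :+₂ (s :+₂ t :+₂ ω :*₂ e) :*₂ (s :+₂ t :+₂ ω :*₂ e) :=₂ ω :*₂ s :+₂ s :*₂ s :+₂ (ω :*₂ t :+₂ t :*₂ t) :+₂ ω :*₂ ω :*₂ (e :+₂ e :*₂ e)) refl ω (S c) (S z) e) ⟩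
        R c + R z + ω * ω * (e + e * e)
          ≡⟨ cong (λ w → R c + R z + ω * ω * (e + w)) (Tr-sq _) ⟩
        R c + R z + ω * ω * (e + e)
          ≡⟨ (solve₂ 3 (λ r ω e → r :+₂ ω :*₂ ω :*₂ (e :+₂ e) :=₂ r) refl (R c + R z) ω e) ⟩
        R c + R z
          ∎
        where e = Tr (μ * c * G z)

      G-+ : Additive G
      G-+ c z = trans (cong √ (R-+ c z)) (φ-+ (m ∸ 1) _ _)

      f : ℕ → Carrier
      f = proj₁ (additive⇒linearised G-+)

      G≡ : ∀ z → G z ≡ Lin f z
      G≡ = proj₂ (additive⇒linearised G-+)

      open Parameters ω μ ω≢0 μ≢0 S f S-0
        (λ c z → trans (S-G c z) (cong (λ w → S c + S z + ω * Tr (μ * c * w)) (G≡ z)))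
        (λ z → trans (sym (√-sq (R z))) (cong₂ _*_ (G≡ z) (G≡ z)))
        using (constrE-params; S≡sE; tr≡Tr; s)

      even⇒formE : FormE
      even⇒formE = p≡2 , ω , μ , f , s 0 , constrE-params , λ a b c → begin
        T a b c
          ≡⟨ T-split a b c ⟩
        A (a + b * c) + B b + S c
          ≡⟨ cong₃ (λ u v w → u + v + w) (A≡Tr _) (B≡Tr b) (S≡sE c) ⟩
        ω * Tr (κ * (a + b * c)) + ω * Tr (μ * b) + (Lin-part c + ω * Quad-part c)
          ≡⟨ (solve 5 (λ ω v w l q → ω :* v :+ ω :* w :+ (l :+ q) := ω :* (v :+ w) :+ l :+ q) refl ω (Tr (κ * (a + b * c))) (Tr (μ * b)) (Lin-part c) (ω * Quad-part c)) ⟩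
        ω * (Tr (κ * (a + b * c)) + Tr (μ * b)) + Lin-part c + ω * Quad-part c
          ≡⟨ cong (λ w → ω * w + Lin-part c + ω * Quad-part c) (begin
               Tr (κ * (a + b * c)) + Tr (μ * b)                  ≡⟨ Tr-+ _ _ ⟨
               Tr (κ * (a + b * c) + μ * b)                       ≡⟨ cong (λ k → Tr (k * (a + b * c) + μ * b))
                                                                       (trans κ≡ (cong (λ k → μ * k * ω) (sym (*-identityʳ μ)))) ⟩
               Tr (μ ^ᶠ 2 * ω * (a + b * c) + μ * b)              ≡⟨ tr≡Tr _ ⟨
               tr (μ ^ᶠ 2 * ω * (a + b * c) + μ * b)              ∎) ⟩
        T-E ω μ f (s 0) a b c
          ∎
        where
        Lin-part Quad-part : Carrier → Carrier
        Lin-part c = Σ< m (λ i → sE ω f (s 0) i * c ^ᶠ (2 ℕ.^ i))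
        Quad-part c = Σ< m (λ j → Σ< j (λ i →
          μ ^ᶠ (2 ℕ.^ i) * f (j ∸ i) ^ᶠ (2 ℕ.^ i) * c ^ᶠ (2 ℕ.^ i ℕ.+ 2 ℕ.^ j)))

    formA-or-formE : FormA ⊎ FormE
    formA-or-formE with p ℕ.≟ 2
    ... | no p≢2 = inj₁ (odd⇒formA p≢2)
    ... | yes p≡2 with all-or-counterexample (λ a → A a ≟ 0#)
    ...   | inj₁ A≡0        = inj₁ (A≡0⇒formA A≡0)
    ...   | inj₂ (a₀ , ω≢0) = inj₂ (even⇒formE p≡2 a₀ ω≢0)

-- Similitudes fixing P as affine maps, and unipotent 2 × 2 matrices

module AffineSimilitudes (F : FiniteField) where
  open Over F
  open FieldArithmetic F
  open LinearisedPolynomials F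

  record Mat2 (A : Set) : Set where
    constructor ⟨_,_,_,_⟩
    field e₁₁ e₁₂ e₂₁ e₂₂ : A
  open Mat2 public

  -- Formulas shared between the field and the polynomial syntax of the ring solver.
  module Formulas {A : Set} (plus times : A → A → A) (⊝_ : A → A) (𝟘 𝟙 : A) where
    infixl 6 _⊕_
    infixl 7 _⊛_
    _⊕_ _⊛_ : A → A → A
    _⊕_ = plus
    _⊛_ = times

    mul₂ : Mat2 A → Mat2 A → Mat2 A
    mul₂ X Y = ⟨ e₁₁ X ⊛ e₁₁ Y ⊕ e₁₂ X ⊛ e₂₁ Y , e₁₁ X ⊛ e₁₂ Y ⊕ e₁₂ X ⊛ e₂₂ Y
               , e₂₁ X ⊛ e₁₁ Y ⊕ e₂₂ X ⊛ e₂₁ Y , e₂₁ X ⊛ e₁₂ Y ⊕ e₂₂ X ⊛ e₂₂ Y ⟩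

    det₂ : Mat2 A → A
    det₂ X = e₁₁ X ⊛ e₂₂ X ⊕ (⊝ (e₁₂ X ⊛ e₂₁ X))

    row : A → A → A → A → Fin 4 → A
    row x y z w zero                   = x
    row x y z w (suc zero)             = y
    row x y z w (suc (suc zero))       = z
    row x y z w (suc (suc (suc zero))) = w

    -- The similitude of the form with linear part X on the coordinates x₂, x₃ that fixes P and maps
    -- (0 , 0 , 0 , 1) to (a , b , c , 1); its first column is forced by the invariance of the form.
    sim : Mat2 A → A × A × A → Fin 4 → Fin 4 → A
    sim X (a , b , c) zero                   = row (det₂ X) 𝟘 𝟘 𝟘
    sim X (a , b , c) (suc zero)             = row (e₁₂ X ⊛ b ⊕ (⊝ (e₁₁ X ⊛ c))) (e₁₁ X) (e₁₂ X) 𝟘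
    sim X (a , b , c) (suc (suc zero))       = row (e₂₂ X ⊛ b ⊕ (⊝ (e₂₁ X ⊛ c))) (e₂₁ X) (e₂₂ X) 𝟘
    sim X (a , b , c) (suc (suc (suc zero))) = row a b c 𝟙

    -- The image of ⟨(a, b, c, 1)⟩ under `sim X (x , y , z)`.
    move : A × A × A → Mat2 A → A × A × A → A × A × A
    move (a , b , c) X (x , y , z) =
        a ⊛ det₂ X ⊕ b ⊛ (e₁₂ X ⊛ y ⊕ (⊝ (e₁₁ X ⊛ z))) ⊕ c ⊛ (e₂₂ X ⊛ y ⊕ (⊝ (e₂₁ X ⊛ z))) ⊕ x
      , b ⊛ e₁₁ X ⊕ c ⊛ e₂₁ X ⊕ y
      , b ⊛ e₁₂ X ⊕ c ⊛ e₂₂ X ⊕ z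

    mul₄ : (Fin 4 → Fin 4 → A) → (Fin 4 → Fin 4 → A) → Fin 4 → Fin 4 → A
    mul₄ M N i j = M i zero ⊛ N zero j ⊕ M i (suc zero) ⊛ N (suc zero) j
      ⊕ M i (suc (suc zero)) ⊛ N (suc (suc zero)) j ⊕ M i (suc (suc (suc zero))) ⊛ N (suc (suc (suc zero))) j

  open Formulas _+_ _*_ -_ 0# 1# public using () renaming (mul₂ to _⊗_; det₂ to det; sim to Sim; move to act)

  M₂ Pt : Set
  M₂ = Mat2 Carrier
  Pt = Carrier × Carrier × Carrier

  𝟙₂ 𝟘₂ : M₂
  𝟙₂ = ⟨ 1# , 0# , 0# , 1# ⟩
  𝟘₂ = ⟨ 0# , 0# , 0# , 0# ⟩

  lower : Carrier → M₂
  lower s = ⟨ 1# , 0# , s , 1# ⟩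

  origin : Pt
  origin = 0# , 0# , 0#

  vec : Pt → Vec4
  vec (a , b , c) = pt a b c

  mat-≡ : ∀ {a a′ b b′ c c′ d d′ : Carrier} → a ≡ a′ → b ≡ b′ → c ≡ c′ → d ≡ d′ →
          ⟨ a , b , c , d ⟩ ≡ ⟨ a′ , b′ , c′ , d′ ⟩
  mat-≡ refl refl refl refl = refl

  pt-≡ : ∀ {a a′ b b′ c c′ : Carrier} → a ≡ a′ → b ≡ b′ → c ≡ c′ → (a , b , c) ≡ (a′ , b′ , c′)
  pt-≡ refl refl refl = refl

  private
    -- A common template for the sixteen entries, each a polynomial identity in fourteen variables.
    Sim-·-equation : (i j : Fin 4) (a₁₁ a₁₂ a₂₁ a₂₂ a b c b₁₁ b₁₂ b₂₁ b₂₂ x y z : Polynomial 14) → Polynomial 14 × Polynomial 14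
    Sim-·-equation i j a₁₁ a₁₂ a₂₁ a₂₂ a b c b₁₁ b₁₂ b₂₁ b₂₂ x y z =
      mul₄ (sim A (a , b , c)) (sim B (x , y , z)) i j := sim (mul₂ A B) (move (a , b , c) B (x , y , z)) i j
      where
      open Formulas _:+_ _:*_ :-_ :0 :1
      A B : Mat2 (Polynomial 14)
      A = ⟨ a₁₁ , a₁₂ , a₂₁ , a₂₂ ⟩
      B = ⟨ b₁₁ , b₁₂ , b₂₁ , b₂₂ ⟩

  Sim-· : ∀ A v B w → (Sim A v ·ₘ Sim B w) ≡ₘ Sim (A ⊗ B) (act v B w)
  Sim-· ⟨ a₁₁ , a₁₂ , a₂₁ , a₂₂ ⟩ (a , b , c) ⟨ b₁₁ , b₁₂ , b₂₁ , b₂₂ ⟩ (x , y , z) zero zero =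
    solve 14 (Sim-·-equation i0 i0) refl a₁₁ a₁₂ a₂₁ a₂₂ a b c b₁₁ b₁₂ b₂₁ b₂₂ x y z
  Sim-· ⟨ a₁₁ , a₁₂ , a₂₁ , a₂₂ ⟩ (a , b , c) ⟨ b₁₁ , b₁₂ , b₂₁ , b₂₂ ⟩ (x , y , z) zero (suc zero) =
    solve 14 (Sim-·-equation i0 i1) refl a₁₁ a₁₂ a₂₁ a₂₂ a b c b₁₁ b₁₂ b₂₁ b₂₂ x y z
  Sim-· ⟨ a₁₁ , a₁₂ , a₂₁ , a₂₂ ⟩ (a , b , c) ⟨ b₁₁ , b₁₂ , b₂₁ , b₂₂ ⟩ (x , y , z) zero (suc (suc zero)) =
    solve 14 (Sim-·-equation i0 i2) refl a₁₁ a₁₂ a₂₁ a₂₂ a b c b₁₁ b₁₂ b₂₁ b₂₂ x y z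
  Sim-· ⟨ a₁₁ , a₁₂ , a₂₁ , a₂₂ ⟩ (a , b , c) ⟨ b₁₁ , b₁₂ , b₂₁ , b₂₂ ⟩ (x , y , z) zero (suc (suc (suc zero))) =
    solve 14 (Sim-·-equation i0 i3) refl a₁₁ a₁₂ a₂₁ a₂₂ a b c b₁₁ b₁₂ b₂₁ b₂₂ x y z
  Sim-· ⟨ a₁₁ , a₁₂ , a₂₁ , a₂₂ ⟩ (a , b , c) ⟨ b₁₁ , b₁₂ , b₂₁ , b₂₂ ⟩ (x , y , z) (suc zero) zero =
    solve 14 (Sim-·-equation i1 i0) refl a₁₁ a₁₂ a₂₁ a₂₂ a b c b₁₁ b₁₂ b₂₁ b₂₂ x y z
  Sim-· ⟨ a₁₁ , a₁₂ , a₂₁ , a₂₂ ⟩ (a , b , c) ⟨ b₁₁ , b₁₂ , b₂₁ , b₂₂ ⟩ (x , y , z) (suc zero) (suc zero) =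
    solve 14 (Sim-·-equation i1 i1) refl a₁₁ a₁₂ a₂₁ a₂₂ a b c b₁₁ b₁₂ b₂₁ b₂₂ x y z
  Sim-· ⟨ a₁₁ , a₁₂ , a₂₁ , a₂₂ ⟩ (a , b , c) ⟨ b₁₁ , b₁₂ , b₂₁ , b₂₂ ⟩ (x , y , z) (suc zero) (suc (suc zero)) =
    solve 14 (Sim-·-equation i1 i2) refl a₁₁ a₁₂ a₂₁ a₂₂ a b c b₁₁ b₁₂ b₂₁ b₂₂ x y z
  Sim-· ⟨ a₁₁ , a₁₂ , a₂₁ , a₂₂ ⟩ (a , b , c) ⟨ b₁₁ , b₁₂ , b₂₁ , b₂₂ ⟩ (x , y , z) (suc zero) (suc (suc (suc zero))) =
    solve 14 (Sim-·-equation i1 i3) refl a₁₁ a₁₂ a₂₁ a₂₂ a b c b₁₁ b₁₂ b₂₁ b₂₂ x y z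
  Sim-· ⟨ a₁₁ , a₁₂ , a₂₁ , a₂₂ ⟩ (a , b , c) ⟨ b₁₁ , b₁₂ , b₂₁ , b₂₂ ⟩ (x , y , z) (suc (suc zero)) zero =
    solve 14 (Sim-·-equation i2 i0) refl a₁₁ a₁₂ a₂₁ a₂₂ a b c b₁₁ b₁₂ b₂₁ b₂₂ x y z
  Sim-· ⟨ a₁₁ , a₁₂ , a₂₁ , a₂₂ ⟩ (a , b , c) ⟨ b₁₁ , b₁₂ , b₂₁ , b₂₂ ⟩ (x , y , z) (suc (suc zero)) (suc zero) =
    solve 14 (Sim-·-equation i2 i1) refl a₁₁ a₁₂ a₂₁ a₂₂ a b c b₁₁ b₁₂ b₂₁ b₂₂ x y z
  Sim-· ⟨ a₁₁ , a₁₂ , a₂₁ , a₂₂ ⟩ (a , b , c) ⟨ b₁₁ , b₁₂ , b₂₁ , b₂₂ ⟩ (x , y , z) (suc (suc zero)) (suc (suc zero)) =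
    solve 14 (Sim-·-equation i2 i2) refl a₁₁ a₁₂ a₂₁ a₂₂ a b c b₁₁ b₁₂ b₂₁ b₂₂ x y z
  Sim-· ⟨ a₁₁ , a₁₂ , a₂₁ , a₂₂ ⟩ (a , b , c) ⟨ b₁₁ , b₁₂ , b₂₁ , b₂₂ ⟩ (x , y , z) (suc (suc zero)) (suc (suc (suc zero))) =
    solve 14 (Sim-·-equation i2 i3) refl a₁₁ a₁₂ a₂₁ a₂₂ a b c b₁₁ b₁₂ b₂₁ b₂₂ x y z
  Sim-· ⟨ a₁₁ , a₁₂ , a₂₁ , a₂₂ ⟩ (a , b , c) ⟨ b₁₁ , b₁₂ , b₂₁ , b₂₂ ⟩ (x , y , z) (suc (suc (suc zero))) zero =
    solve 14 (Sim-·-equation i3 i0) refl a₁₁ a₁₂ a₂₁ a₂₂ a b c b₁₁ b₁₂ b₂₁ b₂₂ x y z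
  Sim-· ⟨ a₁₁ , a₁₂ , a₂₁ , a₂₂ ⟩ (a , b , c) ⟨ b₁₁ , b₁₂ , b₂₁ , b₂₂ ⟩ (x , y , z) (suc (suc (suc zero))) (suc zero) =
    solve 14 (Sim-·-equation i3 i1) refl a₁₁ a₁₂ a₂₁ a₂₂ a b c b₁₁ b₁₂ b₂₁ b₂₂ x y z
  Sim-· ⟨ a₁₁ , a₁₂ , a₂₁ , a₂₂ ⟩ (a , b , c) ⟨ b₁₁ , b₁₂ , b₂₁ , b₂₂ ⟩ (x , y , z) (suc (suc (suc zero))) (suc (suc zero)) =
    solve 14 (Sim-·-equation i3 i2) refl a₁₁ a₁₂ a₂₁ a₂₂ a b c b₁₁ b₁₂ b₂₁ b₂₂ x y z
  Sim-· ⟨ a₁₁ , a₁₂ , a₂₁ , a₂₂ ⟩ (a , b , c) ⟨ b₁₁ , b₁₂ , b₂₁ , b₂₂ ⟩ (x , y , z) (suc (suc (suc zero))) (suc (suc (suc zero))) =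
    solve 14 (Sim-·-equation i3 i3) refl a₁₁ a₁₂ a₂₁ a₂₂ a b c b₁₁ b₁₂ b₂₁ b₂₂ x y z

  ·ᵥ-assoc : ∀ x B C j → (x ·ᵥ (B ·ₘ C)) j ≡ ((x ·ᵥ B) ·ᵥ C) j
  ·ᵥ-assoc x B C j = solve 24
    (λ x₀ x₁ x₂ x₃ b₀₀ b₀₁ b₀₂ b₀₃ b₁₀ b₁₁ b₁₂ b₁₃ b₂₀ b₂₁ b₂₂ b₂₃ b₃₀ b₃₁ b₃₂ b₃₃ c₀ c₁ c₂ c₃ →
      x₀ :* (b₀₀ :* c₀ :+ b₀₁ :* c₁ :+ b₀₂ :* c₂ :+ b₀₃ :* c₃)
      :+ x₁ :* (b₁₀ :* c₀ :+ b₁₁ :* c₁ :+ b₁₂ :* c₂ :+ b₁₃ :* c₃)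
      :+ x₂ :* (b₂₀ :* c₀ :+ b₂₁ :* c₁ :+ b₂₂ :* c₂ :+ b₂₃ :* c₃)
      :+ x₃ :* (b₃₀ :* c₀ :+ b₃₁ :* c₁ :+ b₃₂ :* c₂ :+ b₃₃ :* c₃)
      := (x₀ :* b₀₀ :+ x₁ :* b₁₀ :+ x₂ :* b₂₀ :+ x₃ :* b₃₀) :* c₀
      :+ (x₀ :* b₀₁ :+ x₁ :* b₁₁ :+ x₂ :* b₂₁ :+ x₃ :* b₃₁) :* c₁
      :+ (x₀ :* b₀₂ :+ x₁ :* b₁₂ :+ x₂ :* b₂₂ :+ x₃ :* b₃₂) :* c₂
      :+ (x₀ :* b₀₃ :+ x₁ :* b₁₃ :+ x₂ :* b₂₃ :+ x₃ :* b₃₃) :* c₃)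
    refl (x i0) (x i1) (x i2) (x i3)
    (B i0 i0) (B i0 i1) (B i0 i2) (B i0 i3) (B i1 i0) (B i1 i1) (B i1 i2) (B i1 i3)
    (B i2 i0) (B i2 i1) (B i2 i2) (B i2 i3) (B i3 i0) (B i3 i1) (B i3 i2) (B i3 i3)
    (C i0 j) (C i1 j) (C i2 j) (C i3 j)

  private
    module P {n} = Formulas {Polynomial n} _:+_ _:*_ :-_ :0 :1

    act-assoc-equation : ((t : Polynomial 17 × Polynomial 17 × Polynomial 17) → Polynomial 17) →
      (a b c a₁₁ a₁₂ a₂₁ a₂₂ x y z b₁₁ b₁₂ b₂₁ b₂₂ x′ y′ z′ : Polynomial 17) → Polynomial 17 × Polynomial 17
    act-assoc-equation coordinate a b c a₁₁ a₁₂ a₂₁ a₂₂ x y z b₁₁ b₁₂ b₂₁ b₂₂ x′ y′ z′ =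
      coordinate (P.move (P.move u A v) B w) := coordinate (P.move u (P.mul₂ A B) (P.move v B w))
      where
      A B : Mat2 (Polynomial 17)
      A = ⟨ a₁₁ , a₁₂ , a₂₁ , a₂₂ ⟩
      B = ⟨ b₁₁ , b₁₂ , b₂₁ , b₂₂ ⟩
      u = a , b , c
      v = x , y , z
      w = x′ , y′ , z′

  act-assoc : ∀ u A v B w → act (act u A v) B w ≡ act u (A ⊗ B) (act v B w)
  act-assoc (a , b , c) ⟨ a₁₁ , a₁₂ , a₂₁ , a₂₂ ⟩ (x , y , z) ⟨ b₁₁ , b₁₂ , b₂₁ , b₂₂ ⟩ (x′ , y′ , z′) = pt-≡
    (solve 17 (act-assoc-equation proj₁) refl a b c a₁₁ a₁₂ a₂₁ a₂₂ x y z b₁₁ b₁₂ b₂₁ b₂₂ x′ y′ z′)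
    (solve 17 (act-assoc-equation (λ t → proj₁ (proj₂ t))) refl a b c a₁₁ a₁₂ a₂₁ a₂₂ x y z b₁₁ b₁₂ b₂₁ b₂₂ x′ y′ z′)
    (solve 17 (act-assoc-equation (λ t → proj₂ (proj₂ t))) refl a b c a₁₁ a₁₂ a₂₁ a₂₂ x y z b₁₁ b₁₂ b₂₁ b₂₂ x′ y′ z′)

  act-origin : ∀ A v → act origin A v ≡ v
  act-origin ⟨ a₁₁ , a₁₂ , a₂₁ , a₂₂ ⟩ (x , y , z) = pt-≡
    (solve 4 (λ d s t x → :0 :* d :+ :0 :* s :+ :0 :* t :+ x := x) refl (a₁₁ * a₂₂ + - (a₁₂ * a₂₁)) (a₁₂ * y + - (a₁₁ * z)) (a₂₂ * y + - (a₂₁ * z)) x)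
    (solve 3 (λ a₁₁ a₂₁ y → :0 :* a₁₁ :+ :0 :* a₂₁ :+ y := y) refl a₁₁ a₂₁ y) (solve 3 (λ a₁₂ a₂₂ z → :0 :* a₁₂ :+ :0 :* a₂₂ :+ z := z) refl a₁₂ a₂₂ z)

  act-identity : ∀ v → act v 𝟙₂ origin ≡ v
  act-identity (a , b , c) = pt-≡
    (solve 3 (λ a b c → a :* (:1 :* :1 :+ :- (:0 :* :0)) :+ b :* (:0 :* :0 :+ :- (:1 :* :0)) :+ c :* (:1 :* :0 :+ :- (:0 :* :0)) :+ :0 := a) refl a b c)
    (solve 2 (λ b c → b :* :1 :+ c :* :0 :+ :0 := b) refl b c) (solve 2 (λ b c → b :* :0 :+ c :* :1 :+ :0 := c) refl b c)

  infixl 6 _⊞_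
  _⊞_ : M₂ → M₂ → M₂
  X ⊞ Y = ⟨ e₁₁ X + e₁₁ Y , e₁₂ X + e₁₂ Y , e₂₁ X + e₂₁ Y , e₂₂ X + e₂₂ Y ⟩

  ⊗-assoc : ∀ X Y Z → (X ⊗ Y) ⊗ Z ≡ X ⊗ (Y ⊗ Z)
  ⊗-assoc ⟨ a , b , c , d ⟩ ⟨ e , f , g , h ⟩ ⟨ i , j , k , l ⟩ = mat-≡
    (entry a b i k) (entry a b j l) (entry c d i k) (entry c d j l)
    where
    entry : ∀ x y u v → (x * e + y * g) * u + (x * f + y * h) * v ≡ x * (e * u + f * v) + y * (g * u + h * v)
    entry x y u v = (solve 8 (λ x y u v e f g h → (x :* e :+ y :* g) :* u :+ (x :* f :+ y :* h) :* v := x :* (e :* u :+ f :* v) :+ y :* (g :* u :+ h :* v)) refl x y u v e f g h)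

  ⊗-identityˡ : ∀ X → 𝟙₂ ⊗ X ≡ X
  ⊗-identityˡ ⟨ a , b , c , d ⟩ = mat-≡ (top a c) (top b d) (bottom a c) (bottom b d)
    where
    top : ∀ x y → 1# * x + 0# * y ≡ x
    top x y = (solve 2 (λ x y → :1 :* x :+ :0 :* y := x) refl x y)
    bottom : ∀ x y → 0# * x + 1# * y ≡ y
    bottom x y = (solve 2 (λ x y → :0 :* x :+ :1 :* y := y) refl x y)

  ⊗-identityʳ : ∀ X → X ⊗ 𝟙₂ ≡ X
  ⊗-identityʳ ⟨ a , b , c , d ⟩ = mat-≡ (left a b) (right a b) (left c d) (right c d)
    where
    left : ∀ x y → x * 1# + y * 0# ≡ x
    left x y = (solve 2 (λ x y → x :* :1 :+ y :* :0 := x) refl x y)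
    right : ∀ x y → x * 0# + y * 1# ≡ y
    right x y = (solve 2 (λ x y → x :* :0 :+ y :* :1 := y) refl x y)

  det-⊗ : ∀ X Y → det (X ⊗ Y) ≡ det X * det Y
  det-⊗ ⟨ a , b , c , d ⟩ ⟨ e , f , g , h ⟩ = (solve 8 (λ a b c d e f g h → (a :* e :+ b :* g) :* (c :* f :+ d :* h) :+ :- ((a :* f :+ b :* h) :* (c :* e :+ d :* g)) := (a :* d :+ :- (b :* c)) :* (e :* h :+ :- (f :* g))) refl a b c d e f g h)

  mat2-semiring : Semiring 0ℓ 0ℓ
  mat2-semiring = record
    { Carrier = M₂ ; _≈_ = _≡_ ; _+_ = _⊞_ ; _*_ = _⊗_ ; 0# = 𝟘₂ ; 1# = 𝟙₂
    ; isSemiring = record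
      { isSemiringWithoutAnnihilatingZero = record
        { +-isCommutativeMonoid = record
          { isMonoid = record
            { isSemigroup = record
              { isMagma = record { isEquivalence = isEquivalence ; ∙-cong = cong₂ _⊞_ }
              ; assoc = λ X Y Z → mat-≡ (+-assoc _ _ _) (+-assoc _ _ _) (+-assoc _ _ _) (+-assoc _ _ _) }
            ; identity = (λ X → mat-≡ (+-identityˡ _) (+-identityˡ _) (+-identityˡ _) (+-identityˡ _))
                       , (λ X → mat-≡ (+-identityʳ _) (+-identityʳ _) (+-identityʳ _) (+-identityʳ _)) }
          ; comm = λ X Y → mat-≡ (+-comm _ _) (+-comm _ _) (+-comm _ _) (+-comm _ _) }
        ; *-cong = cong₂ _⊗_
        ; *-assoc = ⊗-assoc
        ; *-identity = ⊗-identityˡ , ⊗-identityʳ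
        ; distrib = ⊗-distribˡ , ⊗-distribʳ }
      ; zero = ⊗-zeroˡ , ⊗-zeroʳ } }
    where
    ⊗-distribˡ : ∀ X Y Z → X ⊗ (Y ⊞ Z) ≡ X ⊗ Y ⊞ X ⊗ Z
    ⊗-distribˡ ⟨ a , b , c , d ⟩ ⟨ e , f , g , h ⟩ ⟨ i , j , k , l ⟩ =
      mat-≡ (entry a b e i g k) (entry a b f j h l) (entry c d e i g k) (entry c d f j h l)
      where
      entry : ∀ x y u v w z → x * (u + v) + y * (w + z) ≡ x * u + y * w + (x * v + y * z)
      entry x y u v w z = (solve 6 (λ x y u v w z → x :* (u :+ v) :+ y :* (w :+ z) := x :* u :+ y :* w :+ (x :* v :+ y :* z)) refl x y u v w z)
    ⊗-distribʳ : ∀ X Y Z → (Y ⊞ Z) ⊗ X ≡ Y ⊗ X ⊞ Z ⊗ X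
    ⊗-distribʳ ⟨ a , b , c , d ⟩ ⟨ e , f , g , h ⟩ ⟨ i , j , k , l ⟩ =
      mat-≡ (entry a c e i f j) (entry b d e i f j) (entry a c g k h l) (entry b d g k h l)
      where
      entry : ∀ x y u v w z → (u + v) * x + (w + z) * y ≡ u * x + w * y + (v * x + z * y)
      entry x y u v w z = (solve 6 (λ x y u v w z → (u :+ v) :* x :+ (w :+ z) :* y := u :* x :+ w :* y :+ (v :* x :+ z :* y)) refl x y u v w z)
    ⊗-zeroˡ : ∀ X → 𝟘₂ ⊗ X ≡ 𝟘₂
    ⊗-zeroˡ ⟨ a , b , c , d ⟩ = mat-≡ (entry a c) (entry b d) (entry a c) (entry b d)
      where
      entry : ∀ x y → 0# * x + 0# * y ≡ 0#
      entry x y = (solve 2 (λ x y → :0 :* x :+ :0 :* y := :0) refl x y)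
    ⊗-zeroʳ : ∀ X → X ⊗ 𝟘₂ ≡ 𝟘₂
    ⊗-zeroʳ ⟨ a , b , c , d ⟩ = mat-≡ (entry a b) (entry a b) (entry c d) (entry c d)
      where
      entry : ∀ x y → x * 0# + y * 0# ≡ 0#
      entry x y = (solve 2 (λ x y → x :* :0 :+ y :* :0 := :0) refl x y)

  open import Algebra.Properties.Semiring.Exp mat2-semiring public using () renaming (_^_ to _^₂_)
  open import Algebra.Properties.Semiring.Mult mat2-semiring using () renaming (_×_ to _·₂_)

  p·₂≡0 : ∀ X → p ·₂ X ≡ 𝟘₂
  p·₂≡0 X = trans (entries p) (mat-≡ (p·x≡0 _) (p·x≡0 _) (p·x≡0 _) (p·x≡0 _))
    where
    entries : ∀ n → n ·₂ X ≡ ⟨ n · e₁₁ X , n · e₁₂ X , n · e₂₁ X , n · e₂₂ X ⟩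
    entries zero    = refl
    entries (suc n) = cong (X ⊞_) (entries n)

  1^₂ : ∀ n → 𝟙₂ ^₂ n ≡ 𝟙₂
  1^₂ zero    = refl
  1^₂ (suc n) = trans (⊗-identityˡ _) (1^₂ n)

  frobenius₂ : ∀ k X → (X ⊞ 𝟙₂) ^₂ (p ℕ.^ k) ≡ X ^₂ (p ℕ.^ k) ⊞ 𝟙₂
  frobenius₂ zero    X = trans (⊗-identityʳ _) (cong (_⊞ 𝟙₂) (sym (⊗-identityʳ X)))
  frobenius₂ (suc k) X = begin
    (X ⊞ 𝟙₂) ^₂ (p ℕ.* p ℕ.^ k)          ≡⟨ ^-assocʳ (X ⊞ 𝟙₂) p (p ℕ.^ k) ⟨
    ((X ⊞ 𝟙₂) ^₂ p) ^₂ (p ℕ.^ k)         ≡⟨ cong (_^₂ (p ℕ.^ k)) (Frobenius.frobenius mat2-semiring p-prime p·₂≡0 X 𝟙₂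
                                               (trans (⊗-identityʳ X) (sym (⊗-identityˡ X)))) ⟩
    (X ^₂ p ⊞ 𝟙₂ ^₂ p) ^₂ (p ℕ.^ k)      ≡⟨ cong (λ Y → (X ^₂ p ⊞ Y) ^₂ (p ℕ.^ k)) (1^₂ p) ⟩
    (X ^₂ p ⊞ 𝟙₂) ^₂ (p ℕ.^ k)           ≡⟨ frobenius₂ k (X ^₂ p) ⟩
    (X ^₂ p) ^₂ (p ℕ.^ k) ⊞ 𝟙₂           ≡⟨ cong (_⊞ 𝟙₂) (^-assocʳ X p (p ℕ.^ k)) ⟩
    X ^₂ (p ℕ.* p ℕ.^ k) ⊞ 𝟙₂            ∎
    where
    open ≡-Reasoning
    open import Algebra.Properties.Semiring.Exp mat2-semiring using (^-assocʳ)

  det-^ : ∀ X n → det (X ^₂ n) ≡ det X ^ᶠ n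
  det-^ X zero    = solve 0 (:1 :* :1 :+ :- (:0 :* :0) := :1) refl
  det-^ X (suc n) = trans (det-⊗ X _) (cong (det X *_) (det-^ X n))

  -- The characteristic polynomial is (x - 1)². Its coefficients are the useful form, because the
  -- trace is linear and can be compared on products.
  Unipotent : M₂ → Set
  Unipotent X = det X ≡ 1# × e₁₁ X + e₂₂ X ≡ 1# + 1#

  -- det (X - 1) = 1 - tr X + det X
  p-power-order⇒unipotent : ∀ k X → X ^₂ (p ℕ.^ k) ≡ 𝟙₂ → Unipotent X
  p-power-order⇒unipotent k X@(⟨ a , b , c , d ⟩) X^≡1 = detX≡1 , trace
    where
    open ≡-Reasoning
    detX≡1 : det X ≡ 1#
    detX≡1 = x-y≡0⇒x≡y _ _ (φ≡0⇒≡0 k _ (begin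
      φ k (det X - 1#)           ≡⟨ φ-+ k _ _ ⟩
      φ k (det X) + φ k (- 1#)   ≡⟨ cong₂ _+_ (trans (sym (det-^ X (p ℕ.^ k))) (cong det X^≡1)) (trans (additive-neg (φ-+ k) 1#) (cong -_ (φ-1# k))) ⟩
      det 𝟙₂ - 1#                ≡⟨ cong (_- 1#) det-𝟙 ⟩
      1# - 1#                    ≡⟨ -‿inverseʳ 1# ⟩
      0#                         ∎))
      where
      det-𝟙 : det 𝟙₂ ≡ 1#
      det-𝟙 = det-^ X 0
    D : M₂
    D = ⟨ a - 1# , b , c , d - 1# ⟩
    D+1≡X : D ⊞ 𝟙₂ ≡ X
    D+1≡X = mat-≡ (solve 1 (λ a → a :- :1 :+ :1 := a) refl a) (+-identityʳ b) (+-identityʳ c) (solve 1 (λ d → d :- :1 :+ :1 := d) refl d)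
    -- By Frobenius (D + 1)^(p^k) = D^(p^k) + 1, so D = X - 1 is nilpotent and its determinant is 0.
    D^≡0 : D ^₂ (p ℕ.^ k) ≡ 𝟘₂
    D^≡0 = cancel (D ^₂ (p ℕ.^ k)) (trans (sym (frobenius₂ k D)) (trans (cong (_^₂ (p ℕ.^ k)) D+1≡X) X^≡1))
      where
      cancel : ∀ Y → Y ⊞ 𝟙₂ ≡ 𝟙₂ → Y ≡ 𝟘₂
      cancel ⟨ e , f , g , h ⟩ eq = mat-≡
        (+-cancelʳ 1# _ _ (trans (cong e₁₁ eq) (sym (+-identityˡ _)))) (+-cancelʳ 0# _ _ (trans (cong e₁₂ eq) (sym (+-identityˡ _))))
        (+-cancelʳ 0# _ _ (trans (cong e₂₁ eq) (sym (+-identityˡ _)))) (+-cancelʳ 1# _ _ (trans (cong e₂₂ eq) (sym (+-identityˡ _))))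
    detD≡0 : det D ≡ 0#
    detD≡0 = ^ᶠ≡0⇒≡0 _ (p ℕ.^ k) (trans (sym (det-^ D (p ℕ.^ k))) (trans (cong det D^≡0) det-𝟘))
      where
      det-𝟘 : det 𝟘₂ ≡ 0#
      det-𝟘 = trans (cong₂ (λ x y → x + - y) (zeroˡ 0#) (zeroˡ 0#)) (-‿inverseʳ 0#)
    trace : a + d ≡ 1# + 1#
    trace = begin
      a + d                              ≡⟨ (solve 4 (λ a b c d → a :+ d := :1 :+ (a :* d :+ :- (b :* c)) :- ((a :- :1) :* (d :- :1) :+ :- (b :* c))) refl a b c d) ⟩
      1# + det X - det D                 ≡⟨ cong₂ (λ x y → 1# + x - y) detX≡1 detD≡0 ⟩
      1# + 1# - 0#                       ≡⟨ solve 0 (:1 :+ :1 :- :0 := :1 :+ :1) refl ⟩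
      1# + 1#                            ∎

-- Groups of similitudes regular on the affine points, and their triangular form

module RegularActions (F : FiniteField) where
  open Over F
  open FieldArithmetic F
  open LinearisedPolynomials F
  open AffineSimilitudes F
  open HomomorphicParameters F using (cong₃; all-or-counterexample; ∀?)

  -- The first row of `P` is a row vector fixed by all `W v`, which is what the first row (1, 0) of
  -- the conjugate expresses.
  record Triangularisation (W : Pt → M₂) : Set where
    field
      P Q   : M₂
      t     : Pt → Carrier
      P⊗Q≡𝟙 : P ⊗ Q ≡ 𝟙₂
      Q⊗P≡𝟙 : Q ⊗ P ≡ 𝟙₂
      W-tri : ∀ v → P ⊗ (W v ⊗ Q) ≡ ⟨ 1# , 0# , t v , 1# ⟩

  -- A point v stands for the group element that maps the origin to v. The image of v under the
  -- element of w stands for their product, and `free` says that only the identity fixes a point.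
  module RegularSystem (W : Pt → M₂)
    (W-∙ : ∀ v w → W (act v (W w) w) ≡ W v ⊗ W w)
    (free : ∀ v w → act v (W w) w ≡ v → w ≡ origin × W w ≡ 𝟙₂) where
    open ≡-Reasoning

    infixr 7 _∙_
    _∙_ : Pt → Pt → Pt
    v ∙ w = act v (W w) w

    ∙-assoc : ∀ u v w → (u ∙ v) ∙ w ≡ u ∙ (v ∙ w)
    ∙-assoc u v w = trans (act-assoc u (W v) v (W w) w) (cong (λ X → act u X (v ∙ w)) (sym (W-∙ v w)))

    W-origin : W origin ≡ 𝟙₂
    W-origin = proj₂ (free origin origin (act-origin _ _))

    ∙-identityʳ : ∀ v → v ∙ origin ≡ v
    ∙-identityʳ v = trans (cong (λ X → act v X origin) W-origin) (act-identity v)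

    pow : Pt → ℕ → Pt
    pow v zero    = origin
    pow v (suc n) = v ∙ pow v n

    pow-+ : ∀ v m n → pow v (m ℕ.+ n) ≡ pow v m ∙ pow v n
    pow-+ v zero    n = sym (act-origin _ _)
    pow-+ v (suc m) n = trans (cong (v ∙_) (pow-+ v m n)) (sym (∙-assoc v _ _))

    pow-* : ∀ v n m → pow v (n ℕ.* m) ≡ pow (pow v m) n
    pow-* v zero    m = refl
    pow-* v (suc n) m = trans (pow-+ v m (n ℕ.* m)) (cong (pow v m ∙_) (pow-* v n m))

    pow-1 : ∀ v → pow v 1 ≡ v
    pow-1 v = ∙-identityʳ v

    W-pow : ∀ v n → W (pow v n) ≡ W v ^₂ n
    W-pow v zero    = W-origin
    W-pow v (suc n) = trans (W-∙ v _) (cong (W v ⊗_) (W-pow v n))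

    code : Carrier → Fin (length elements)
    code x = Any.index (elements-complete x)

    code-injective : ∀ {x y} → code x ≡ code y → x ≡ y
    code-injective {x} {y} eq = trans (lookup-index (elements-complete x))
      (trans (cong (lookup elements) eq) (sym (lookup-index (elements-complete y))))

    codePt : Pt → Fin (length elements ℕ.* (length elements ℕ.* length elements))
    codePt (a , b , c) = combine (code a) (combine (code b) (code c))

    codePt-injective : ∀ {v w} → codePt v ≡ codePt w → v ≡ w
    codePt-injective {a , b , c} {a′ , b′ , c′} eq with combine-injective (code a) _ (code a′) _ eq
    ... | a≡ , eq′ with combine-injective (code b) _ (code b′) _ eq′
    ...   | b≡ , c≡ = pt-≡ (code-injective a≡) (code-injective b≡) (code-injective c≡)

    -- Two of the first q³ + 1 powers coincide, say at i < j. Then `pow v d` with d = j - i fixes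
    -- the point `pow v i`, so it is trivial by `free`.
    finite-order : ∀ v → ∃[ d ] (0 < d × pow v d ≡ origin)
    finite-order v with pigeonhole (ℕ.n<1+n _) (λ i → codePt (pow v (toℕ i)))
    ... | i , j , i<j , eq = d , ℕ.m<n⇒0<n∸m i<j , proj₁ (free (pow v (toℕ i)) (pow v d) (begin
      pow v (toℕ i) ∙ pow v d       ≡⟨ pow-+ v (toℕ i) d ⟨
      pow v (toℕ i ℕ.+ d)           ≡⟨ cong (pow v) (ℕ.m+[n∸m]≡n (ℕ.<⇒≤ i<j)) ⟩
      pow v (toℕ j)                 ≡⟨ codePt-injective eq ⟨
      pow v (toℕ i)                 ∎))
      where d = toℕ j ∸ toℕ i

    Σ<-const : ∀ n x → Σ< n (λ _ → x) ≡ n · 1# * x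
    Σ<-const zero    x = sym (zeroˡ x)
    Σ<-const (suc n) x = trans (cong (_+ x) (Σ<-const n x)) (solve 2 (λ k x → k :* x :+ x := (:1 :+ k) :* x) refl (n · 1#) x)

    -- The barycentre of an orbit whose length is prime to p is a fixed point.
    p∤order⇒origin : ∀ v d → ¬ p ∣ d → pow v d ≡ origin → v ≡ origin
    p∤order⇒origin v@(x , y , z) d p∤d v^d≡0 = proj₁ (free centre v centre-fixed)
      where
      n = d · 1#
      n≢0 : n ≢ 0#
      n≢0 = p∤n⇒n·1≢0 d p∤d
      X = W v
      a b c : ℕ → Carrier
      a i = proj₁ (pow v i)
      b i = proj₁ (proj₂ (pow v i))
      c i = proj₂ (proj₂ (pow v i))
      centre : Pt
      centre = n ⁻¹ * Σ< d a , n ⁻¹ * Σ< d b , n ⁻¹ * Σ< d c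
      step : ∀ i → pow v (suc i) ≡ pow v i ∙ v
      step i = trans (cong (pow v) (ℕ.+-comm 1 i)) (trans (pow-+ v i 1) (cong (pow v i ∙_) (pow-1 v)))
      cyclic : ∀ (π : Pt → Carrier) → Σ< d (λ i → π (pow v (suc i))) ≡ Σ< d (λ i → π (pow v i))
      cyclic π = +-cancelʳ (π origin) _ _ (trans (+-comm _ _) (trans (sym (Σ<-head d (λ i → π (pow v i))))
        (cong (λ w → Σ< d (λ i → π (pow v i)) + π w) v^d≡0)))
      affine-sum : ∀ k l r t → Σ< d (λ i → a i * k + b i * l + c i * r + t) ≡
                   Σ< d a * k + Σ< d b * l + Σ< d c * r + n * t
      affine-sum k l r t = begin
        Σ< d (λ i → a i * k + b i * l + c i * r + t)
          ≡⟨ trans (Σ<-+ d _ _) (+-congʳ (trans (Σ<-+ d _ _) (+-congʳ (Σ<-+ d _ _)))) ⟩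
        Σ< d (λ i → a i * k) + Σ< d (λ i → b i * l) + Σ< d (λ i → c i * r) + Σ< d (λ _ → t)
          ≡⟨ cong₂ _+_ (cong₂ _+_ (cong₂ _+_ (pull k a) (pull l b)) (pull r c)) (Σ<-const d t) ⟩
        Σ< d a * k + Σ< d b * l + Σ< d c * r + n * t
          ∎
        where
        pull : ∀ k e → Σ< d (λ i → e i * k) ≡ Σ< d e * k
        pull k e = trans (Σ<-cong d (λ i _ → *-comm _ _)) (trans (sym (Σ<-*ˡ d k e)) (*-comm _ _))
      -- An affine function commutes with averaging, and the shift by v permutes the orbit
      -- cyclically.
      coordinate : ∀ (π : Pt → Carrier) k l r t → (∀ w → π (w ∙ v) ≡ proj₁ w * k + proj₁ (proj₂ w) * l + proj₂ (proj₂ w) * r + t) →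
                   n ⁻¹ * Σ< d a * k + n ⁻¹ * Σ< d b * l + n ⁻¹ * Σ< d c * r + t ≡ n ⁻¹ * Σ< d (λ i → π (pow v i))
      coordinate π k l r t affine = begin
        n ⁻¹ * A * k + n ⁻¹ * B * l + n ⁻¹ * C * r + t
          ≡⟨ cong (n ⁻¹ * A * k + n ⁻¹ * B * l + n ⁻¹ * C * r +_) (trans (sym (*-identityˡ t)) (cong (_* t) (sym (⁻¹-inverseˡ n n≢0)))) ⟩
        n ⁻¹ * A * k + n ⁻¹ * B * l + n ⁻¹ * C * r + n ⁻¹ * n * t
          ≡⟨ (solve 9 (λ i n A B C k l r t → i :* A :* k :+ i :* B :* l :+ i :* C :* r :+ i :* n :* t := i :* (A :* k :+ B :* l :+ C :* r :+ n :* t)) refl (n ⁻¹) n A B C k l r t) ⟩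
        n ⁻¹ * (A * k + B * l + C * r + n * t)
          ≡⟨ cong (n ⁻¹ *_) (trans (sym (affine-sum k l r t)) (trans (Σ<-cong d (λ i _ → sym (trans (cong π (step i)) (affine (pow v i))))) (cyclic π))) ⟩
        n ⁻¹ * Σ< d (λ i → π (pow v i))
          ∎
        where
        A = Σ< d a
        B = Σ< d b
        C = Σ< d c
      centre-fixed : centre ∙ v ≡ centre
      centre-fixed = pt-≡
        (coordinate proj₁ _ _ _ _ (λ _ → refl))
        (trans (without-a _ _ _ _) (coordinate (proj₁ ∘ proj₂) 0# _ _ _ (λ w → without-a (proj₁ w) _ _ _)))
        (trans (without-a _ _ _ _) (coordinate (proj₂ ∘ proj₂) 0# _ _ _ (λ w → without-a (proj₁ w) _ _ _)))
        where
        without-a : ∀ e q r t → q + r + t ≡ e * 0# + q + r + t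
        without-a e q r t = (solve 4 (λ e q r t → q :+ r :+ t := e :* :0 :+ q :+ r :+ t) refl e q r t)

    -- Induction on an exponent d that kills v. If p divides d, pass to v^p and d / p; otherwise v
    -- is trivial by the barycentre argument.
    p-power-order : ∀ v → ∃[ k ] pow v (p ℕ.^ k) ≡ origin
    p-power-order v with finite-order v
    ... | d , 0<d , v^d≡0 = <-rec (λ d → 0 < d → ∀ v → pow v d ≡ origin → ∃[ k ] pow v (p ℕ.^ k) ≡ origin) remove d 0<d v v^d≡0
      where
      remove : ∀ d → (∀ {e} → e < d → 0 < e → ∀ v → pow v e ≡ origin → ∃[ k ] pow v (p ℕ.^ k) ≡ origin) →
               0 < d → ∀ v → pow v d ≡ origin → ∃[ k ] pow v (p ℕ.^ k) ≡ origin
      remove d rec 0<d v v^d≡0 with p ∣? d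
      ... | no p∤d = 0 , trans (pow-1 v) (p∤order⇒origin v d p∤d v^d≡0)
      ... | yes (divides zero refl) = contradiction 0<d λ ()
      ... | yes (divides e@(suc _) refl) with rec (ℕ.m<m*n e p p>1) z<s (pow v p) (trans (sym (pow-* v e p)) v^d≡0)
      ...   | k , eq = suc k , trans (cong (pow v) (ℕ.*-comm p (p ℕ.^ k))) (trans (pow-* v (p ℕ.^ k) p) eq)

    W-unipotent : ∀ v → Unipotent (W v)
    W-unipotent v with p-power-order v
    ... | k , eq = p-power-order⇒unipotent k (W v) (trans (sym (W-pow v (p ℕ.^ k))) (trans (cong W eq) W-origin))

    private
      -- (a - 1)² = a (tr X - 2) + (1 - det X) - b c, and each of the three terms vanishes.
      lower-triangular : ∀ X → Unipotent X → e₁₂ X ≡ 0# → X ≡ ⟨ 1# , 0# , e₂₁ X , 1# ⟩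
      lower-triangular ⟨ a , b , c , d ⟩ (det≡1 , tr≡2) b≡0 = mat-≡ a≡1 b≡0 refl
        (trans (solve 2 (λ a d → d := (a :+ d) :- a) refl a d) (trans (cong₂ _-_ tr≡2 a≡1) (solve 1 (λ o → o :+ o :- o := o) refl 1#)))
        where
        a≡1 : a ≡ 1#
        a≡1 = x-y≡0⇒x≡y a 1# (^ᶠ≡0⇒≡0 (a - 1#) 2 (begin
          (a - 1#) * ((a - 1#) * 1#)
            ≡⟨ (solve 6 (λ a b c d s e → (a :- :1) :* ((a :- :1) :* :1) := a :* ((a :+ d) :- (:1 :+ :1)) :+ (:1 :- (a :* d :+ :- (b :* c))) :- b :* c) refl a b c d (1# + 1#) (det ⟨ a , b , c , d ⟩)) ⟩
          a * ((a + d) - (1# + 1#)) + (1# - det ⟨ a , b , c , d ⟩) - b * c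
            ≡⟨ cong₃ (λ u v w → a * (u - (1# + 1#)) + (1# - v) - w * c) tr≡2 det≡1 b≡0 ⟩
          a * ((1# + 1#) - (1# + 1#)) + (1# - 1#) - 0# * c
            ≡⟨ (solve 2 (λ a c → a :* ((:1 :+ :1) :- (:1 :+ :1)) :+ (:1 :- :1) :- :0 :* c := :0) refl a c) ⟩
          0#
            ∎))

      already-triangular : (∀ v → e₁₂ (W v) ≡ 0#) → Triangularisation W
      already-triangular b≡0 = record
        { P = 𝟙₂ ; Q = 𝟙₂ ; t = λ v → e₂₁ (W v) ; P⊗Q≡𝟙 = ⊗-identityˡ 𝟙₂ ; Q⊗P≡𝟙 = ⊗-identityˡ 𝟙₂
        ; W-tri = λ v → trans (⊗-identityˡ _) (trans (⊗-identityʳ _) (lower-triangular (W v) (W-unipotent v) (b≡0 v))) }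

      -- For X = 1 + D the vector (x , y), the first row of D, is fixed by X.  It is fixed
      -- by every other 1 + D′ in the group because tr (D D′) = 0.
      module Conjugate (v₀ : Pt) (y≢0 : e₁₂ (W v₀) ≢ 0#) where
        X = W v₀
        x = e₁₁ X - 1#
        y = e₁₂ X
        y⁻¹ = y ⁻¹
        P Q : M₂
        -- The fixed vector (x, y) is completed to a basis by (1, 0); the determinant is - y ≠ 0.
        P = ⟨ x , y , 1# , 0# ⟩
        Q = ⟨ 0# , 1# , y⁻¹ , - (x * y⁻¹) ⟩

        y*y⁻¹≡1 : y * y⁻¹ ≡ 1#
        y*y⁻¹≡1 = ⁻¹-inverse y y≢0

        cancel-y : ∀ k → k * y * y⁻¹ ≡ k
        cancel-y k = trans (*-assoc _ _ _) (trans (cong (k *_) y*y⁻¹≡1) (*-identityʳ k))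

        P⊗Q≡𝟙 : P ⊗ Q ≡ 𝟙₂
        P⊗Q≡𝟙 = mat-≡
          (trans (solve 3 (λ x y i → x :* :0 :+ y :* i := y :* i) refl x y y⁻¹) y*y⁻¹≡1)
          (trans (solve 3 (λ x y i → x :* :1 :+ y :* :- (x :* i) := x :- x :* y :* i) refl x y y⁻¹) (x≡y⇒x-y≡0 _ _ (sym (cancel-y x))))
          (solve 1 (λ i → :1 :* :0 :+ :0 :* i := :0) refl y⁻¹) (solve 1 (λ k → :1 :* :1 :+ :0 :* :- k := :1) refl (x * y⁻¹))

        Q⊗P≡𝟙 : Q ⊗ P ≡ 𝟙₂
        Q⊗P≡𝟙 = mat-≡
          (solve 1 (λ x → :0 :* x :+ :1 :* :1 := :1) refl x) (solve 1 (λ y → :0 :* y :+ :1 :* :0 := :0) refl y)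
          (solve 2 (λ x i → i :* x :+ :- (x :* i) :* :1 := :0) refl x y⁻¹)
          (trans (solve 3 (λ y i k → i :* y :+ k :* :0 := y :* i) refl y y⁻¹ (- (x * y⁻¹))) y*y⁻¹≡1)

        module _ (v : Pt) where
          a = e₁₁ (W v) - 1#
          b = e₁₂ (W v)
          c = e₂₁ (W v)
          d = e₂₂ (W v)
          z = e₂₁ X
          w = e₂₂ X

          d≡ : d ≡ 1# - a
          d≡ = trans (solve 2 (λ e d → d := (e :+ d) :- e) refl (e₁₁ (W v)) d)
            (trans (cong (_- e₁₁ (W v)) (proj₂ (W-unipotent v))) (solve 1 (λ e → :1 :+ :1 :- e := :1 :- (e :- :1)) refl (e₁₁ (W v))))

          w≡ : w ≡ 1# - x
          w≡ = trans (solve 2 (λ e w → w := (e :+ w) :- e) refl (e₁₁ X) w)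
            (trans (cong (_- e₁₁ X) (proj₂ (W-unipotent v₀))) (solve 1 (λ e → :1 :+ :1 :- e := :1 :- (e :- :1)) refl (e₁₁ X)))

          nilpotent : a * a + b * c ≡ 0#
          nilpotent = begin
            a * a + b * c                                     ≡⟨ (solve 3 (λ a b c → a :* a :+ b :* c := :1 :- ((a :+ :1) :* (:1 :- a) :+ :- (b :* c))) refl a b c) ⟩
            1# - ((a + 1#) * (1# - a) + - (b * c))            ≡⟨ cong₂ (λ e f → 1# - (e * f + - (b * c))) (solve 1 (λ e → e :- :1 :+ :1 := e) refl (e₁₁ (W v))) (sym d≡) ⟩
            1# - det (W v)                                    ≡⟨ cong (λ q → 1# - q) (proj₁ (W-unipotent v)) ⟩
            1# - 1#                                           ≡⟨ -‿inverseʳ 1# ⟩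
            0#                                                ∎

          nilpotent₀ : x * x + y * z ≡ 0#
          nilpotent₀ = begin
            x * x + y * z                                     ≡⟨ (solve 3 (λ x y z → x :* x :+ y :* z := :1 :- ((x :+ :1) :* (:1 :- x) :+ :- (y :* z))) refl x y z) ⟩
            1# - ((x + 1#) * (1# - x) + - (y * z))            ≡⟨ cong₂ (λ e f → 1# - (e * f + - (y * z))) (solve 1 (λ e → e :- :1 :+ :1 := e) refl (e₁₁ X)) (sym w≡) ⟩
            1# - det X                                        ≡⟨ cong (λ q → 1# - q) (proj₁ (W-unipotent v₀)) ⟩
            1# - 1#                                           ≡⟨ -‿inverseʳ 1# ⟩
            0#                                                ∎

          -- This is tr (D D′). The product (1 + D)(1 + D′) belongs to the group again, so its trace
          -- is 2, while D and D′ have trace 0.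
          trace-product : x * a + y * c + (z * b + x * a) ≡ 0#
          trace-product = begin
            x * a + y * c + (z * b + x * a)
              ≡⟨ (solve 6 (λ x y z a b c → x :* a :+ y :* c :+ (z :* b :+ x :* a) := ((x :+ :1) :* (a :+ :1) :+ y :* c) :+ (z :* b :+ (:1 :- x) :* (:1 :- a)) :- (:1 :+ :1)) refl x y z a b c) ⟩
            ((x + 1#) * (a + 1#) + y * c) + (z * b + (1# - x) * (1# - a)) - (1# + 1#)
              ≡⟨ cong₂ (λ e f → (e + y * c) + (z * b + f) - (1# + 1#))
                   (cong₂ _*_ (solve 1 (λ e → e :- :1 :+ :1 := e) refl (e₁₁ X)) (solve 1 (λ e → e :- :1 :+ :1 := e) refl (e₁₁ (W v)))) (cong₂ _*_ (sym w≡) (sym d≡)) ⟩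
            e₁₁ (X ⊗ W v) + e₂₂ (X ⊗ W v) - (1# + 1#)
              ≡⟨ cong (λ Y → e₁₁ Y + e₂₂ Y - (1# + 1#)) (W-∙ v₀ v) ⟨
            e₁₁ (W (v₀ ∙ v)) + e₂₂ (W (v₀ ∙ v)) - (1# + 1#)
              ≡⟨ x≡y⇒x-y≡0 _ _ (proj₂ (W-unipotent (v₀ ∙ v))) ⟩
            0#
              ∎

          -- Together with `xa+yc≡0` this is (x, y) D′ = 0. The square of x b - y a is a combination
          -- of det D, det D′ and tr (D D′), all of which vanish.
          xb≡ya : x * b ≡ y * a
          xb≡ya = x-y≡0⇒x≡y _ _ (^ᶠ≡0⇒≡0 _ 2 (begin
            (x * b - y * a) * ((x * b - y * a) * 1#)
              ≡⟨ (solve 6 (λ x y z a b c → (x :* b :- y :* a) :* ((x :* b :- y :* a) :* :1) := y :* y :* (a :* a :+ b :* c) :+ b :* b :* (x :* x :+ y :* z) :- y :* b :* (x :* a :+ y :* c :+ (z :* b :+ x :* a))) refl x y z a b c) ⟩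
            y * y * (a * a + b * c) + b * b * (x * x + y * z) - y * b * (x * a + y * c + (z * b + x * a))
              ≡⟨ cong₃ (λ e f g → y * y * e + b * b * f - y * b * g) nilpotent nilpotent₀ trace-product ⟩
            y * y * 0# + b * b * 0# - y * b * 0#
              ≡⟨ (solve 2 (λ y b → y :* y :* :0 :+ b :* b :* :0 :- y :* b :* :0 := :0) refl y b) ⟩
            0#
              ∎))

          xa+yc≡0 : x * a + y * c ≡ 0#
          xa+yc≡0 = x*y≡0⇒y≡0 y _ y≢0 (begin
            y * (x * a + y * c)
              ≡⟨ (solve 6 (λ x y z a b c → y :* (x :* a :+ y :* c) := y :* (x :* a :+ y :* c :+ (z :* b :+ x :* a)) :- b :* (x :* x :+ y :* z) :+ x :* (x :* b :- y :* a)) refl x y z a b c) ⟩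
            y * (x * a + y * c + (z * b + x * a)) - b * (x * x + y * z) + x * (x * b - y * a)
              ≡⟨ cong₃ (λ e f g → y * e - b * f + x * g) trace-product nilpotent₀ (x≡y⇒x-y≡0 _ _ xb≡ya) ⟩
            y * 0# - b * 0# + x * 0#
              ≡⟨ (solve 3 (λ x y b → y :* :0 :- b :* :0 :+ x :* :0 := :0) refl x y b) ⟩
            0#
              ∎)

          triangular : P ⊗ (W v ⊗ Q) ≡ ⟨ 1# , 0# , b * y⁻¹ , 1# ⟩
          triangular = mat-≡
            (trans (solve 7 (λ x y e b c d i → x :* (e :* :0 :+ b :* i) :+ y :* (c :* :0 :+ d :* i) := (x :* b :+ y :* d) :* i) refl x y (e₁₁ (W v)) b c d y⁻¹)
              (trans (cong (_* y⁻¹) (trans (cong₂ (λ r q → r + y * q) xb≡ya d≡) (solve 2 (λ y a → y :* a :+ y :* (:1 :- a) := y) refl y a))) y*y⁻¹≡1))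
            (begin
              x * (e₁₁ (W v) * 1# + b * - (x * y⁻¹)) + y * (c * 1# + d * - (x * y⁻¹))
                ≡⟨ (solve 7 (λ x y e b c d i → x :* (e :* :1 :+ b :* :- (x :* i)) :+ y :* (c :* :1 :+ d :* :- (x :* i)) := (x :* (e :- :1) :+ y :* c) :+ x :- (x :* b :+ y :* d) :* i :* x) refl x y (e₁₁ (W v)) b c d y⁻¹) ⟩
              (x * a + y * c) + x - (x * b + y * d) * y⁻¹ * x
                ≡⟨ cong₂ (λ r q → r + x - q * y⁻¹ * x) xa+yc≡0 (trans (cong₂ (λ r q → r + y * q) xb≡ya d≡) (solve 2 (λ y a → y :* a :+ y :* (:1 :- a) := y) refl y a)) ⟩
              0# + x - y * y⁻¹ * x
                ≡⟨ cong (λ q → 0# + x - q * x) y*y⁻¹≡1 ⟩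
              0# + x - 1# * x
                ≡⟨ (solve 1 (λ x → :0 :+ x :- :1 :* x := :0) refl x) ⟩
              0#
                ∎)
            (solve 5 (λ e b c d i → :1 :* (e :* :0 :+ b :* i) :+ :0 :* (c :* :0 :+ d :* i) := b :* i) refl (e₁₁ (W v)) b c d y⁻¹)
            (begin
              1# * (e₁₁ (W v) * 1# + b * - (x * y⁻¹)) + 0# * (c * 1# + d * - (x * y⁻¹))
                ≡⟨ (solve 6 (λ x e b c d i → :1 :* (e :* :1 :+ b :* :- (x :* i)) :+ :0 :* (c :* :1 :+ d :* :- (x :* i)) := :1 :+ (e :- :1) :- x :* b :* i) refl x (e₁₁ (W v)) b c d y⁻¹) ⟩
              1# + a - x * b * y⁻¹
                ≡⟨ cong (λ q → 1# + a - q * y⁻¹) (trans xb≡ya (*-comm y a)) ⟩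
              1# + a - a * y * y⁻¹
                ≡⟨ cong (λ q → 1# + a - q) (cancel-y a) ⟩
              1# + a - a
                ≡⟨ (solve 1 (λ a → :1 :+ a :- a := :1) refl a) ⟩
              1#
                ∎)

        conjugate : Triangularisation W
        conjugate = record
          { P = P ; Q = Q ; t = λ v → e₁₂ (W v) * y⁻¹ ; P⊗Q≡𝟙 = P⊗Q≡𝟙 ; Q⊗P≡𝟙 = Q⊗P≡𝟙 ; W-tri = triangular }

    triangularisation : Triangularisation W
    triangularisation with all-or-counterexample (λ a → ∀? (λ b → ∀? (λ c → e₁₂ (W (a , b , c)) ≟ 0#)))
    ... | inj₁ all = already-triangular (λ (a , b , c) → all a b c)
    ... | inj₂ (a , ¬all) with all-or-counterexample (λ b → ∀? (λ c → e₁₂ (W (a , b , c)) ≟ 0#))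
    ...   | inj₁ all = contradiction all ¬all
    ...   | inj₂ (b , ¬all′) with all-or-counterexample (λ c → e₁₂ (W (a , b , c)) ≟ 0#)
    ...     | inj₁ all = contradiction all ¬all′
    ...     | inj₂ (c , y≢0) = Conjugate.conjugate (a , b , c) y≢0

  module TriangularSystem (W : Pt → M₂) (W-∙ : ∀ v w → W (act v (W w) w) ≡ W v ⊗ W w)
    (triangularisation : Triangularisation W) where
    open ≡-Reasoning
    open Triangularisation triangularisation public

    -- Conjugation by `Sim Q origin` transports the image of the origin by Q, so a point in the new
    -- coordinates is carried back by P before `t` applies.
    T : Carrier → Carrier → Carrier → Carrier
    T a b c = t (act (a , b , c) P origin)

    act-PQ : ∀ A B → A ⊗ B ≡ 𝟙₂ → ∀ v → act (act v A origin) B origin ≡ v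
    act-PQ A B AB≡1 v = trans (act-assoc v A origin B origin)
      (trans (cong₂ (act v) AB≡1 (act-origin B origin)) (act-identity v))

    W⊗Q : ∀ v → W v ⊗ Q ≡ Q ⊗ lower (t v)
    W⊗Q v = begin
      W v ⊗ Q                ≡⟨ ⊗-identityˡ _ ⟨
      𝟙₂ ⊗ (W v ⊗ Q)         ≡⟨ cong (_⊗ (W v ⊗ Q)) Q⊗P≡𝟙 ⟨
      (Q ⊗ P) ⊗ (W v ⊗ Q)    ≡⟨ ⊗-assoc Q P _ ⟩
      Q ⊗ (P ⊗ (W v ⊗ Q))    ≡⟨ cong (Q ⊗_) (W-tri v) ⟩
      Q ⊗ lower (t v)        ∎

    T-act-Q : ∀ v → let (a , b , c) = act v Q origin in T a b c ≡ t v
    T-act-Q v = cong t (act-PQ Q P Q⊗P≡𝟙 v)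

    t-∙ : ∀ v w → t (act v (W w) w) ≡ t v + t w
    t-∙ v w = begin
      t (act v (W w) w)                                      ≡⟨ cong e₂₁ (W-tri (act v (W w) w)) ⟨
      e₂₁ (P ⊗ (W (act v (W w) w) ⊗ Q))                      ≡⟨ cong (λ Y → e₂₁ (P ⊗ (Y ⊗ Q))) (W-∙ v w) ⟩
      e₂₁ (P ⊗ ((W v ⊗ W w) ⊗ Q))                    ≡⟨ cong (λ Y → e₂₁ (P ⊗ Y)) (trans (⊗-assoc (W v) (W w) Q) (cong (W v ⊗_) (W⊗Q w))) ⟩
      e₂₁ (P ⊗ (W v ⊗ (Q ⊗ lower (t w))))            ≡⟨ cong (λ Y → e₂₁ (P ⊗ Y)) (⊗-assoc (W v) Q (lower (t w))) ⟨
      e₂₁ (P ⊗ ((W v ⊗ Q) ⊗ lower (t w)))            ≡⟨ cong e₂₁ (⊗-assoc P (W v ⊗ Q) (lower (t w))) ⟨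
      e₂₁ ((P ⊗ (W v ⊗ Q)) ⊗ lower (t w))            ≡⟨ cong (λ Y → e₂₁ (Y ⊗ lower (t w))) (W-tri v) ⟩
      t v * 1# + 1# * t w                            ≡⟨ (solve 2 (λ r s → r :* :1 :+ :1 :* s := r :+ s) refl (t v) (t w)) ⟩
      t v + t w                                      ∎

    T-hom : ∀ a b c x y z →
      T (a + x - b * z + c * (y - z * T x y z)) (b + y + c * T x y z) (c + z) ≡ T a b c + T x y z
    T-hom a b c x y z = trans (cong t (begin
      act (a + x - b * z + c * (y - z * T x y z) , b + y + c * T x y z , c + z) P origin
        ≡⟨ cong (λ u → act u P origin) product ⟨
      act (act v′ (lower (t w)) w′) P origin
        ≡⟨ cong (λ u → act u P origin) conjugated ⟨
      act (act (act v (W w) w) Q origin) P origin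
        ≡⟨ act-PQ Q P Q⊗P≡𝟙 (act v (W w) w) ⟩
      act v (W w) w
        ∎)) (t-∙ v w)
      where
      v′ w′ v w : Pt
      v′ = a , b , c
      w′ = x , y , z
      v = act v′ P origin
      w = act w′ P origin
      product : act v′ (lower (t w)) w′ ≡ (a + x - b * z + c * (y - z * T x y z) , b + y + c * T x y z , c + z)
      product = pt-≡
        (solve 7 (λ a b c x y z s → a :* (:1 :* :1 :+ :- (:0 :* s)) :+ b :* (:0 :* y :+ :- (:1 :* z)) :+ c :* (:1 :* y :+ :- (s :* z)) :+ x := a :+ x :- b :* z :+ c :* (y :- z :* s)) refl a b c x y z (t w))
        (solve 4 (λ b c y s → b :* :1 :+ c :* s :+ y := b :+ y :+ c :* s) refl b c y (t w))
        (solve 3 (λ b c z → b :* :0 :+ c :* :1 :+ z := c :+ z) refl b c z)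
      conjugated : act (act v (W w) w) Q origin ≡ act v′ (lower (t w)) w′
      conjugated = begin
        act (act v (W w) w) Q origin                     ≡⟨ act-assoc v (W w) w Q origin ⟩
        act v (W w ⊗ Q) (act w Q origin)                 ≡⟨ cong₂ (act v) (W⊗Q w) (act-PQ P Q P⊗Q≡𝟙 w′) ⟩
        act v (Q ⊗ lower (t w)) w′                       ≡⟨ cong (act v (Q ⊗ lower (t w))) (act-origin (lower (t w)) w′) ⟨
        act v (Q ⊗ lower (t w)) (act origin (lower (t w)) w′)  ≡⟨ act-assoc v Q origin (lower (t w)) w′ ⟨
        act (act v Q origin) (lower (t w)) w′            ≡⟨ cong (λ u → act u (lower (t w)) w′) (act-PQ P Q P⊗Q≡𝟙 v′) ⟩
        act v′ (lower (t w)) w′                          ∎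

-- Collineations of the derived quadrangle as similitudes

module Quadrangle (F : FiniteField) where
  open Over F
  open FieldArithmetic F
  open AffineSimilitudes F
  open HomomorphicParameters F using (cong₃; all-or-counterexample; module Classification)
  open RegularActions F

  -- Matrices up to scalars

  ≃-sym : ∀ {A B} → A ≃ₘ B → B ≃ₘ A
  ≃-sym {A} {B} (k , k≢0 , eq) = k ⁻¹ , ⁻¹-nonzero k≢0 , λ i j → sym (begin
    k ⁻¹ * A i j         ≡⟨ cong (k ⁻¹ *_) (eq i j) ⟩
    k ⁻¹ * (k * B i j)   ≡⟨ *-assoc _ _ _ ⟨
    k ⁻¹ * k * B i j     ≡⟨ cong (_* B i j) (⁻¹-inverseˡ k k≢0) ⟩
    1# * B i j           ≡⟨ *-identityˡ _ ⟩
    B i j                ∎)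
    where open ≡-Reasoning

  ≃-trans : ∀ {A B C} → A ≃ₘ B → B ≃ₘ C → A ≃ₘ C
  ≃-trans (k , k≢0 , eq) (l , l≢0 , eq′) = k * l , *-nonzero k≢0 l≢0 , λ i j →
    trans (eq i j) (trans (cong (k *_) (eq′ i j)) (sym (*-assoc _ _ _)))

  ≡⇒≃ : ∀ {A B} → A ≡ₘ B → A ≃ₘ B
  ≡⇒≃ eq = 1# , 1≢0 , λ i j → trans (eq i j) (sym (*-identityˡ _))

  ≃-· : ∀ {A A′ B B′} → A ≃ₘ A′ → B ≃ₘ B′ → (A ·ₘ B) ≃ₘ (A′ ·ₘ B′)
  ≃-· {A} {A′} {B} {B′} (k , k≢0 , eq) (l , l≢0 , eq′) = k * l , *-nonzero k≢0 l≢0 , λ i j → trans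
    (cong₂ _+_ (cong₂ _+_ (cong₂ _+_ (cong₂ _*_ (eq i i0) (eq′ i0 j)) (cong₂ _*_ (eq i i1) (eq′ i1 j)))
      (cong₂ _*_ (eq i i2) (eq′ i2 j))) (cong₂ _*_ (eq i i3) (eq′ i3 j)))
    (solve 10 (λ k l a b c d e f g h → k :* a :* (l :* e) :+ k :* b :* (l :* f) :+ k :* c :* (l :* g) :+ k :* d :* (l :* h) := k :* l :* (a :* e :+ b :* f :+ c :* g :+ d :* h)) refl k l (A′ i i0) (A′ i i1) (A′ i i2) (A′ i i3) (B′ i0 j) (B′ i1 j) (B′ i2 j) (B′ i3 j))

  ·ᵥ-Id : ∀ x j → (x ·ᵥ Id4) j ≡ x j
  ·ᵥ-Id x zero                   = (solve 4 (λ a b c d → a :* :1 :+ b :* :0 :+ c :* :0 :+ d :* :0 := a) refl (x i0) (x i1) (x i2) (x i3))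
  ·ᵥ-Id x (suc zero)             = (solve 4 (λ a b c d → a :* :0 :+ b :* :1 :+ c :* :0 :+ d :* :0 := b) refl (x i0) (x i1) (x i2) (x i3))
  ·ᵥ-Id x (suc (suc zero))       = (solve 4 (λ a b c d → a :* :0 :+ b :* :0 :+ c :* :1 :+ d :* :0 := c) refl (x i0) (x i1) (x i2) (x i3))
  ·ᵥ-Id x (suc (suc (suc zero))) = (solve 4 (λ a b c d → a :* :0 :+ b :* :0 :+ c :* :0 :+ d :* :1 := d) refl (x i0) (x i1) (x i2) (x i3))

  Id-· : ∀ A → (Id4 ·ₘ A) ≡ₘ A
  Id-· A zero                   j = (solve 4 (λ a b c d → :1 :* a :+ :0 :* b :+ :0 :* c :+ :0 :* d := a) refl (A i0 j) (A i1 j) (A i2 j) (A i3 j))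
  Id-· A (suc zero)             j = (solve 4 (λ a b c d → :0 :* a :+ :1 :* b :+ :0 :* c :+ :0 :* d := b) refl (A i0 j) (A i1 j) (A i2 j) (A i3 j))
  Id-· A (suc (suc zero))       j = (solve 4 (λ a b c d → :0 :* a :+ :0 :* b :+ :1 :* c :+ :0 :* d := c) refl (A i0 j) (A i1 j) (A i2 j) (A i3 j))
  Id-· A (suc (suc (suc zero))) j = (solve 4 (λ a b c d → :0 :* a :+ :0 :* b :+ :0 :* c :+ :1 :* d := d) refl (A i0 j) (A i1 j) (A i2 j) (A i3 j))

  ≃-refl : ∀ A → A ≃ₘ A
  ≃-refl A = ≡⇒≃ (λ _ _ → refl)

  -- The subgroup axioms supply right inverses. Associativity gives A ≃ A (B C) ≃ (A B) C ≃ C, so B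
  -- A ≃ B C.
  inverse-swap : ∀ A B C → (A ·ₘ B) ≃ₘ Id4 → (B ·ₘ C) ≃ₘ Id4 → (B ·ₘ A) ≃ₘ Id4
  inverse-swap A B C AB≃1 BC≃1 = ≃-trans (≃-· {B} {B} {A} {C} (≃-refl B) A≃C) BC≃1
    where
    A≃C : A ≃ₘ C
    A≃C = ≃-trans (≃-sym (≃-trans (≃-· {A} {A} {B ·ₘ C} {Id4} (≃-refl A) BC≃1) (≡⇒≃ (λ i → ·ᵥ-Id (A i)))))
      (≃-trans (≡⇒≃ (λ i → ·ᵥ-assoc (A i) B C)) (≃-trans (≃-· {A ·ₘ B} {Id4} {C} {C} AB≃1 (≃-refl C)) (≡⇒≃ (Id-· C))))

  -- Collineations as affine similitudes

  form-eP : ∀ y → form eP y ≡ y i3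
  form-eP y = (solve 4 (λ a b c d → :1 :* d :- :0 :* a :+ :0 :* c :- :0 :* b := d) refl (y i0) (y i1) (y i2) (y i3))

  module NormalForm (A B : Mat4) (AB≃1 : (A ·ₘ B) ≃ₘ Id4) (BA≃1 : (B ·ₘ A) ≃ₘ Id4)
    (points : ∀ a b c → IsQPPoint (pt a b c ·ᵥ A))
    (collinear : ∀ a b c a′ b′ c′ → QPCollinear (pt a b c) (pt a′ b′ c′) →
                 QPCollinear (pt a b c ·ᵥ A) (pt a′ b′ c′ ·ᵥ A)) where
    open ≡-Reasoning

    κ α x y r₁ w₁₁ w₁₂ r₂ w₂₁ w₂₂ a₀ b₀ c₀ : Carrier
    κ = A i3 i3
    α = A i0 i0
    x = A i0 i1
    y = A i0 i2
    r₁ = A i1 i0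
    w₁₁ = A i1 i1
    w₁₂ = A i1 i2
    r₂ = A i2 i0
    w₂₁ = A i2 i1
    w₂₂ = A i2 i2
    a₀ = A i3 i0
    b₀ = A i3 i1
    c₀ = A i3 i2

    last≢0 : ∀ a b c → a * A i0 i3 + b * A i1 i3 + c * A i2 i3 + 1# * κ ≢ 0#
    last≢0 a b c eq = points a b c (trans (form-eP (pt a b c ·ᵥ A)) eq)

    κ≢0 : κ ≢ 0#
    κ≢0 κ≡0 = last≢0 0# 0# 0# (trans
      (solve 4 (λ a b c κ → :0 :* a :+ :0 :* b :+ :0 :* c :+ :1 :* κ := κ) refl (A i0 i3) (A i1 i3) (A i2 i3) κ) κ≡0)

    private
      -- If one of the first three entries q of the last column were nonzero, then q t + κ would
      -- vanish at t = - κ / q, and an affine point would be mapped into the plane P^⊥.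
      root : ∀ q → q ≢ 0# → - κ * q ⁻¹ * q + κ ≡ 0#
      root q q≢0 = trans (solve 3 (λ κ q i → :- κ :* i :* q :+ κ := κ :* (:1 :- i :* q)) refl κ q (q ⁻¹))
        (trans (cong (λ e → κ * (1# - e)) (⁻¹-inverseˡ q q≢0)) (solve 1 (λ κ → κ :* (:1 :- :1) := :0) refl κ))

    A₀₃≡0 : A i0 i3 ≡ 0#
    A₀₃≡0 = decidable-stable (A i0 i3 ≟ 0#) λ q≢0 → last≢0 (- κ * A i0 i3 ⁻¹) 0# 0# (trans
      (solve 5 (λ t a b c κ → t :* a :+ :0 :* b :+ :0 :* c :+ :1 :* κ := t :* a :+ κ) refl (- κ * A i0 i3 ⁻¹) (A i0 i3) (A i1 i3) (A i2 i3) κ) (root _ q≢0))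

    A₁₃≡0 : A i1 i3 ≡ 0#
    A₁₃≡0 = decidable-stable (A i1 i3 ≟ 0#) λ q≢0 → last≢0 0# (- κ * A i1 i3 ⁻¹) 0# (trans
      (solve 5 (λ t a b c κ → :0 :* a :+ t :* b :+ :0 :* c :+ :1 :* κ := t :* b :+ κ) refl (- κ * A i1 i3 ⁻¹) (A i0 i3) (A i1 i3) (A i2 i3) κ) (root _ q≢0))

    A₂₃≡0 : A i2 i3 ≡ 0#
    A₂₃≡0 = decidable-stable (A i2 i3 ≟ 0#) λ q≢0 → last≢0 0# 0# (- κ * A i2 i3 ⁻¹) (trans
      (solve 5 (λ t a b c κ → :0 :* a :+ :0 :* b :+ t :* c :+ :1 :* κ := t :* c :+ κ) refl (- κ * A i2 i3 ⁻¹) (A i0 i3) (A i1 i3) (A i2 i3) κ) (root _ q≢0))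

    image : Pt → Vec4
    image v = vec v ·ᵥ A

    image-last : ∀ v → image v i3 ≡ κ
    image-last (a , b , c) = trans (cong₃ (λ s t r → a * s + b * t + c * r + 1# * κ) A₀₃≡0 A₁₃≡0 A₂₃≡0)
      (solve 4 (λ a b c κ → a :* :0 :+ b :* :0 :+ c :* :0 :+ :1 :* κ := κ) refl a b c κ)

    -- The alternatives are a totally isotropic image line and an image line through P. With the
    -- difference D in place of the second point, R i0 cancels from the form and D i1 = D i2 = 0
    -- expresses that P is on the line.
    direction : ∀ v w (R D : Vec4) → (∀ j → image v j ≡ R j) → (∀ j → image w j ≡ D j + R j) →
      QPCollinear (vec v) (vec w) →
      (κ * D i0 ≡ R i1 * D i2 - R i2 * D i1) ⊎ (D i1 ≡ 0# × D i2 ≡ 0#)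
    direction v@(a , b , c) w@(a′ , b′ , c′) R D v≡ w≡ coll with collinear a b c a′ b′ c′ coll
    ... | inj₁ form≡0 = inj₁ (begin
      κ * D i0
        ≡⟨ (solve 7 (λ κ d₀ d₁ d₂ r₀ r₁ r₂ → κ :* d₀ := (r₁ :* d₂ :- r₂ :* d₁) :- (r₀ :* κ :- κ :* (d₀ :+ r₀) :+ r₁ :* (d₂ :+ r₂) :- r₂ :* (d₁ :+ r₁))) refl κ (D i0) (D i1) (D i2) (R i0) (R i1) (R i2)) ⟩
      e - (R i0 * κ - κ * (D i0 + R i0) + R i1 * (D i2 + R i2) - R i2 * (D i1 + R i1))
        ≡⟨ cong (λ f → e - f) isotropic ⟩
      e - 0#
        ≡⟨ (solve 1 (λ e → e :- :0 := e) refl e) ⟩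
      e
        ∎)
      where
      e = R i1 * D i2 - R i2 * D i1
      isotropic : R i0 * κ - κ * (D i0 + R i0) + R i1 * (D i2 + R i2) - R i2 * (D i1 + R i1) ≡ 0#
      isotropic = trans (sym (cong₂ _-_ (cong₂ _+_ (cong₂ _-_ (cong₂ _*_ (v≡ i0) (image-last w)) (cong₂ _*_ (image-last v) (w≡ i0)))
        (cong₂ _*_ (v≡ i1) (w≡ i2))) (cong₂ _*_ (v≡ i2) (w≡ i1)))) form≡0
    ... | inj₂ (s , t , eq) = inj₂ (coordinate i1 (eq i1) , coordinate i2 (eq i2))
      where
      s+t≡0 : s + t ≡ 0#
      s+t≡0 = x*y≡0⇒y≡0 κ _ κ≢0 (trans (solve 3 (λ κ s t → κ :* (s :+ t) := s :* κ :+ t :* κ) refl κ s t)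
        (trans (cong₂ (λ e f → s * e + t * f) (sym (image-last v)) (sym (image-last w))) (eq i3)))
      difference : ∀ j → t * D j ≡ s * image v j + t * image w j
      difference j = begin
        t * D j                                      ≡⟨ (solve 4 (λ s t d r → t :* d := s :* r :+ t :* (d :+ r) :- (s :+ t) :* r) refl s t (D j) (R j)) ⟩
        s * R j + t * (D j + R j) - (s + t) * R j    ≡⟨ cong (λ k → s * R j + t * (D j + R j) - k * R j) s+t≡0 ⟩
        s * R j + t * (D j + R j) - 0# * R j         ≡⟨ (solve 4 (λ s t d r → s :* r :+ t :* (d :+ r) :- :0 :* r := s :* r :+ t :* (d :+ r)) refl s t (D j) (R j)) ⟩
        s * R j + t * (D j + R j)                    ≡⟨ cong₂ (λ e f → s * e + t * f) (v≡ j) (w≡ j) ⟨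
        s * image v j + t * image w j                ∎
      t≢0 : t ≢ 0#
      t≢0 t≡0 = 1≢0 (trans (sym (eq i0)) (trans (sym (difference i0)) (trans (cong (_* D i0) t≡0) (zeroˡ _))))
      coordinate : ∀ j → s * image v j + t * image w j ≡ 0# → D j ≡ 0#
      coordinate j eq′ = x*y≡0⇒y≡0 t _ t≢0 (trans (difference j) eq′)

    image-combination : ∀ a b c j → image (a , b , c) j ≡ a * A i0 j + b * A i1 j + c * A i2 j + A i3 j
    image-combination a b c j = cong (a * A i0 j + b * A i1 j + c * A i2 j +_) (*-identityˡ _)

    image-origin : ∀ j → image origin j ≡ A i3 j
    image-origin j = trans (image-combination 0# 0# 0# j)
      (solve 4 (λ e f g h → :0 :* e :+ :0 :* f :+ :0 :* g :+ h := h) refl (A i0 j) (A i1 j) (A i2 j) (A i3 j))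

    -- If (x , y) ≠ 0 then the images of the lines ⟨P , u⟩ are totally isotropic, which
    -- makes the column (0 , y , -x , s) a null vector of A for a suitable s.
    module NullVector (¬x,y≡0 : ¬ (x ≡ 0# × y ≡ 0#)) where
      vertical : ∀ b c → κ * α ≡ (b * w₁₁ + c * w₂₁ + b₀) * y - (b * w₁₂ + c * w₂₂ + c₀) * x
      vertical b c = [ (λ eq → eq) , (λ x,y≡0 → contradiction x,y≡0 ¬x,y≡0) ]′
        (direction (0# , b , c) (1# , b , c) (λ j → b * A i1 j + c * A i2 j + A i3 j) (A i0)
          (λ j → trans (image-combination 0# b c j)
            (solve 4 (λ e f g h → :0 :* e :+ f :+ g :+ h := f :+ g :+ h) refl (A i0 j) (b * A i1 j) (c * A i2 j) (A i3 j)))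
          (λ j → trans (image-combination 1# b c j)
            (solve 4 (λ e f g h → :1 :* e :+ f :+ g :+ h := e :+ (f :+ g :+ h)) refl (A i0 j) (b * A i1 j) (c * A i2 j) (A i3 j)))
          (inj₂ (- 1# , 1# , on-line)))
        where
        on-line : ∀ i → - 1# * pt 0# b c i + 1# * pt 1# b c i ≡ eP i
        on-line zero                   = solve 0 (:- :1 :* :0 :+ :1 :* :1 := :1) refl
        on-line (suc zero)             = (solve 1 (λ b → :- :1 :* b :+ :1 :* b := :0) refl b)
        on-line (suc (suc zero))       = (solve 1 (λ c → :- :1 :* c :+ :1 :* c := :0) refl c)
        on-line (suc (suc (suc zero))) = solve 0 (:- :1 :* :1 :+ :1 :* :1 := :0) refl
      -- Determined by the last row of A; the other rows end in 0 and put no condition on s.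
      s = - (b₀ * y - c₀ * x) * κ ⁻¹
      row₀ : x * y - y * x + A i0 i3 * s ≡ 0#
      row₀ = trans (cong (λ e → x * y - y * x + e * s) A₀₃≡0) (solve 3 (λ x y s → x :* y :- y :* x :+ :0 :* s := :0) refl x y s)
      -- In `vertical` the left side is constant and the right side affine in (b, c), so the
      -- coefficients of b and c vanish; they are read off as differences.
      row₁ : w₁₁ * y - w₁₂ * x + A i1 i3 * s ≡ 0#
      row₁ = begin
        w₁₁ * y - w₁₂ * x + A i1 i3 * s       ≡⟨ cong (λ e → w₁₁ * y - w₁₂ * x + e * s) A₁₃≡0 ⟩
        w₁₁ * y - w₁₂ * x + 0# * s            ≡⟨ (solve 9 (λ w₁₁ w₁₂ w₂₁ w₂₂ b₀ c₀ x y s → w₁₁ :* y :- w₁₂ :* x :+ :0 :* s := ((:1 :* w₁₁ :+ :0 :* w₂₁ :+ b₀) :* y :- (:1 :* w₁₂ :+ :0 :* w₂₂ :+ c₀) :* x) :- ((:0 :* w₁₁ :+ :0 :* w₂₁ :+ b₀) :* y :- (:0 :* w₁₂ :+ :0 :* w₂₂ :+ c₀) :* x)) refl w₁₁ w₁₂ w₂₁ w₂₂ b₀ c₀ x y s) ⟩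
        _ - _                                 ≡⟨ cong₂ _-_ (vertical 1# 0#) (vertical 0# 0#) ⟨
        κ * α - κ * α                         ≡⟨ -‿inverseʳ _ ⟩
        0#                                    ∎
      row₂ : w₂₁ * y - w₂₂ * x + A i2 i3 * s ≡ 0#
      row₂ = begin
        w₂₁ * y - w₂₂ * x + A i2 i3 * s       ≡⟨ cong (λ e → w₂₁ * y - w₂₂ * x + e * s) A₂₃≡0 ⟩
        w₂₁ * y - w₂₂ * x + 0# * s            ≡⟨ (solve 9 (λ w₁₁ w₁₂ w₂₁ w₂₂ b₀ c₀ x y s → w₂₁ :* y :- w₂₂ :* x :+ :0 :* s := ((:0 :* w₁₁ :+ :1 :* w₂₁ :+ b₀) :* y :- (:0 :* w₁₂ :+ :1 :* w₂₂ :+ c₀) :* x) :- ((:0 :* w₁₁ :+ :0 :* w₂₁ :+ b₀) :* y :- (:0 :* w₁₂ :+ :0 :* w₂₂ :+ c₀) :* x)) refl w₁₁ w₁₂ w₂₁ w₂₂ b₀ c₀ x y s) ⟩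
        _ - _                                 ≡⟨ cong₂ _-_ (vertical 0# 1#) (vertical 0# 0#) ⟨
        κ * α - κ * α                         ≡⟨ -‿inverseʳ _ ⟩
        0#                                    ∎
      row₃ : b₀ * y - c₀ * x + κ * s ≡ 0#
      row₃ = trans (solve 3 (λ q κ i → q :+ κ :* (:- q :* i) := q :* (:1 :- i :* κ)) refl (b₀ * y - c₀ * x) κ (κ ⁻¹))
        (trans (cong (λ e → (b₀ * y - c₀ * x) * (1# - e)) (⁻¹-inverseˡ κ κ≢0)) (solve 1 (λ q → q :* (:1 :- :1) := :0) refl (b₀ * y - c₀ * x)))
      k = proj₁ BA≃1
      -- B A = k Id applied to the null column of A gives k times this column, hence x = y = 0.
      null-row : ∀ i → k * (Id4 i i1 * y - Id4 i i2 * x + Id4 i i3 * s) ≡ 0#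
      null-row i = begin
        k * (Id4 i i1 * y - Id4 i i2 * x + Id4 i i3 * s)
          ≡⟨ (solve 7 (λ k a b c x y s → k :* (a :* y :- b :* x :+ c :* s) := k :* a :* y :- k :* b :* x :+ k :* c :* s) refl k (Id4 i i1) (Id4 i i2) (Id4 i i3) x y s) ⟩
        k * Id4 i i1 * y - k * Id4 i i2 * x + k * Id4 i i3 * s
          ≡⟨ cong₃ (λ a b c → a * y - b * x + c * s) (entry i1) (entry i2) (entry i3) ⟨
        (B ·ₘ A) i i1 * y - (B ·ₘ A) i i2 * x + (B ·ₘ A) i i3 * s
          ≡⟨ (solve 15 (λ a₁ b₁ c₁ d₁ a₂ b₂ c₂ d₂ a₃ b₃ c₃ d₃ x y s → (a₁ :+ b₁ :+ c₁ :+ d₁) :* y :- (a₂ :+ b₂ :+ c₂ :+ d₂) :* x :+ (a₃ :+ b₃ :+ c₃ :+ d₃) :* s := (a₁ :* y :- a₂ :* x :+ a₃ :* s) :+ (b₁ :* y :- b₂ :* x :+ b₃ :* s) :+ ((c₁ :* y :- c₂ :* x :+ c₃ :* s) :+ (d₁ :* y :- d₂ :* x :+ d₃ :* s))) refl (B i i0 * x) (B i i1 * w₁₁) (B i i2 * w₂₁) (B i i3 * b₀) (B i i0 * y) (B i i1 * w₁₂) (B i i2 * w₂₂) (B i i3 * c₀) (B i i0 * A i0 i3) (B i i1 * A i1 i3) (B i i2 * A i2 i3) (B i i3 * κ) x y s) ⟩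
        (B i i0 * x * y - B i i0 * y * x + B i i0 * A i0 i3 * s) + (B i i1 * w₁₁ * y - B i i1 * w₁₂ * x + B i i1 * A i1 i3 * s)
          + ((B i i2 * w₂₁ * y - B i i2 * w₂₂ * x + B i i2 * A i2 i3 * s) + (B i i3 * b₀ * y - B i i3 * c₀ * x + B i i3 * κ * s))
          ≡⟨ cong₂ _+_ (cong₂ _+_ (vanish (B i i0) row₀) (vanish (B i i1) row₁)) (cong₂ _+_ (vanish (B i i2) row₂) (vanish (B i i3) row₃)) ⟩
        0# + 0# + (0# + 0#)
          ≡⟨ solve 0 (:0 :+ :0 :+ (:0 :+ :0) := :0) refl ⟩
        0#
          ∎
        where
        vanish : ∀ q {e f g} → e * y - f * x + g * s ≡ 0# → q * e * y - q * f * x + q * g * s ≡ 0#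
        vanish q {e} {f} {g} eq = trans (solve 7 (λ q e f g x y s → q :* e :* y :- q :* f :* x :+ q :* g :* s := q :* (e :* y :- f :* x :+ g :* s)) refl q e f g x y s)
          (trans (cong (q *_) eq) (zeroʳ q))
        entry : ∀ j → (B ·ₘ A) i j ≡ k * Id4 i j
        entry j = proj₂ (proj₂ BA≃1) i j
      k≢0 : k ≢ 0#
      k≢0 = proj₁ (proj₂ BA≃1)
      y≡0 : y ≡ 0#
      y≡0 = trans (solve 3 (λ x y s → y := :1 :* y :- :0 :* x :+ :0 :* s) refl x y s) (x*y≡0⇒y≡0 k _ k≢0 (null-row i1))
      x≡0 : x ≡ 0#
      x≡0 = trans (solve 3 (λ x y s → x := :- (:0 :* y :- :1 :* x :+ :0 :* s)) refl x y s)
        (trans (cong -_ (x*y≡0⇒y≡0 k _ k≢0 (null-row i2))) (solve 0 (:- :0 := :0) refl))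

    x,y≡0 : x ≡ 0# × y ≡ 0#
    x,y≡0 = decidable-stable ((x ≟ 0#) ×-dec (y ≟ 0#)) λ ¬x,y≡0 → ¬x,y≡0 (NullVector.x≡0 ¬x,y≡0 , NullVector.y≡0 ¬x,y≡0)

    l : Carrier
    l = proj₁ AB≃1

    AB-entry : ∀ i j → A i i0 * B i0 j + A i i1 * B i1 j + A i i2 * B i2 j + A i i3 * B i3 j ≡ l * Id4 i j
    AB-entry = proj₂ (proj₂ AB≃1)

    first-row : ∀ j → α * B i0 j ≡ l * Id4 i0 j
    first-row j = trans (trans (solve 4 (λ a f g h → a := a :+ :0 :* f :+ :0 :* g :+ :0 :* h) refl (α * B i0 j) (B i1 j) (B i2 j) (B i3 j))
      (cong₃ (λ f g h → α * B i0 j + f * B i1 j + g * B i2 j + h * B i3 j) (sym (proj₁ x,y≡0)) (sym (proj₂ x,y≡0)) (sym A₀₃≡0)))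
      (AB-entry i0 j)

    α≢0 : α ≢ 0#
    α≢0 α≡0 = proj₁ (proj₂ AB≃1) (trans (sym (*-identityʳ l)) (trans (sym (first-row i0)) (trans (cong (_* B i0 i0) α≡0) (zeroˡ _))))

    -- A row (r , 0 , 0 , 0) would be proportional to the first row.
    row-nonzero : ∀ i → A i i3 ≡ 0# → Id4 i0 i ≡ 0# → Id4 i i ≡ 1# → ¬ (A i i1 ≡ 0# × A i i2 ≡ 0#)
    row-nonzero i t≡0 off diag (f≡0 , g≡0) = proj₁ (proj₂ AB≃1) (begin
      l                                   ≡⟨ trans (sym (*-identityʳ l)) (cong (l *_) (sym diag)) ⟩
      l * Id4 i i                         ≡⟨ AB-entry i i ⟨
      A i i0 * B i0 i + A i i1 * B i1 i + A i i2 * B i2 i + A i i3 * B i3 i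
                                          ≡⟨ cong₂ _+_ (cong₃ (λ e f g → A i i0 * e + f * B i1 i + g * B i2 i) B₀≡0 f≡0 g≡0) (cong (_* B i3 i) t≡0) ⟩
      A i i0 * 0# + 0# * B i1 i + 0# * B i2 i + 0# * B i3 i
                                          ≡⟨ (solve 4 (λ r f g h → r :* :0 :+ :0 :* f :+ :0 :* g :+ :0 :* h := :0) refl (A i i0) (B i1 i) (B i2 i) (B i3 i)) ⟩
      0#                                  ∎)
      where
      B₀≡0 : B i0 i ≡ 0#
      B₀≡0 = x*y≡0⇒y≡0 α _ α≢0 (trans (first-row i) (trans (cong (l *_) off) (zeroʳ l)))

    -- The line joining (0, 0, 0, 1) to (0, 1, 0, 1) is totally isotropic. By `row-nonzero` its
    -- image misses P, so the image is totally isotropic too.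
    r₁≡ : κ * r₁ ≡ b₀ * w₁₂ - c₀ * w₁₁
    r₁≡ = [ (λ eq → eq) , (λ eqs → contradiction eqs (row-nonzero i1 A₁₃≡0 refl refl)) ]′
      (direction origin (0# , 1# , 0#) (A i3) (A i1) image-origin
        (λ j → trans (image-combination 0# 1# 0# j)
          (solve 4 (λ e f g h → :0 :* e :+ :1 :* f :+ :0 :* g :+ h := f :+ h) refl (A i0 j) (A i1 j) (A i2 j) (A i3 j)))
        (inj₁ (solve 0 (:0 :* :1 :- :1 :* :0 :+ :0 :* :0 :- :0 :* :1 := :0) refl)))

    r₂≡ : κ * r₂ ≡ b₀ * w₂₂ - c₀ * w₂₁
    r₂≡ = [ (λ eq → eq) , (λ eqs → contradiction eqs (row-nonzero i2 A₂₃≡0 refl refl)) ]′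
      (direction origin (0# , 0# , 1#) (A i3) (A i2) image-origin
        (λ j → trans (image-combination 0# 0# 1# j)
          (solve 4 (λ e f g h → :0 :* e :+ :0 :* f :+ :1 :* g :+ h := g :+ h) refl (A i0 j) (A i1 j) (A i2 j) (A i3 j)))
        (inj₁ (solve 0 (:0 :* :1 :- :1 :* :0 :+ :0 :* :1 :- :0 :* :0 := :0) refl)))

    -- The totally isotropic line joining (0, 0, 1, 1) to (- 1, 1, 1, 1) has a direction involving
    -- the first row of A, and comparison with `r₁≡` isolates α.
    α≡ : κ * α ≡ w₁₁ * w₂₂ + - (w₁₂ * w₂₁)
    α≡ = [ determinant , (λ eqs → contradiction (nonzero eqs) (row-nonzero i1 A₁₃≡0 refl refl)) ]′
      (direction (0# , 0# , 1#) (- 1# , 1# , 1#) (λ j → A i2 j + A i3 j) (λ j → A i1 j - A i0 j)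
        (λ j → trans (image-combination 0# 0# 1# j)
          (solve 4 (λ e f g h → :0 :* e :+ :0 :* f :+ :1 :* g :+ h := g :+ h) refl (A i0 j) (A i1 j) (A i2 j) (A i3 j)))
        (λ j → trans (image-combination (- 1#) 1# 1# j)
          (solve 4 (λ e f g h → :- :1 :* e :+ :1 :* f :+ :1 :* g :+ h := f :- e :+ (g :+ h)) refl (A i0 j) (A i1 j) (A i2 j) (A i3 j)))
        (inj₁ (solve 0 (:0 :* :1 :- :1 :* :- :1 :+ :0 :* :1 :- :1 :* :1 := :0) refl)))
      where
      nonzero : w₁₁ - x ≡ 0# × w₁₂ - y ≡ 0# → w₁₁ ≡ 0# × w₁₂ ≡ 0#
      nonzero (eq₁ , eq₂) = trans (x-y≡0⇒x≡y _ _ eq₁) (proj₁ x,y≡0) , trans (x-y≡0⇒x≡y _ _ eq₂) (proj₂ x,y≡0)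
      determinant : κ * (r₁ - α) ≡ (w₂₁ + b₀) * (w₁₂ - y) - (w₂₂ + c₀) * (w₁₁ - x) → κ * α ≡ w₁₁ * w₂₂ + - (w₁₂ * w₂₁)
      determinant eq = begin
        κ * α
          ≡⟨ (solve 3 (λ κ α r₁ → κ :* α := κ :* r₁ :- κ :* (r₁ :- α)) refl κ α r₁) ⟩
        κ * r₁ - κ * (r₁ - α)
          ≡⟨ cong₂ _-_ r₁≡ (trans eq (cong₂ (λ f g → (w₂₁ + b₀) * (w₁₂ - f) - (w₂₂ + c₀) * (w₁₁ - g)) (proj₂ x,y≡0) (proj₁ x,y≡0))) ⟩
        (b₀ * w₁₂ - c₀ * w₁₁) - ((w₂₁ + b₀) * (w₁₂ - 0#) - (w₂₂ + c₀) * (w₁₁ - 0#))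
          ≡⟨ (solve 6 (λ w₁₁ w₁₂ w₂₁ w₂₂ b₀ c₀ → (b₀ :* w₁₂ :- c₀ :* w₁₁) :- ((w₂₁ :+ b₀) :* (w₁₂ :- :0) :- (w₂₂ :+ c₀) :* (w₁₁ :- :0)) := w₁₁ :* w₂₂ :+ :- (w₁₂ :* w₂₁)) refl w₁₁ w₁₂ w₂₁ w₂₂ b₀ c₀) ⟩
        w₁₁ * w₂₂ + - (w₁₂ * w₂₁)
          ∎

    normal-form : ∃[ X ] ∃[ v ] (A ≃ₘ Sim X v)
    normal-form = ⟨ i * w₁₁ , i * w₁₂ , i * w₂₁ , i * w₂₂ ⟩ , (i * a₀ , i * b₀ , i * c₀) , κ , κ≢0 , entries
      where
      i = κ ⁻¹
      scale : ∀ e → e ≡ κ * (i * e)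
      scale e = trans (sym (*-identityˡ e)) (trans (cong (_* e) (sym (⁻¹-inverse κ κ≢0))) (*-assoc _ _ _))
      zero-entry : ∀ {e} → e ≡ 0# → e ≡ κ * 0#
      zero-entry e≡0 = trans e≡0 (sym (zeroʳ κ))
      -- The first column of `Sim` is quadratic in the other entries, so dividing those by κ divides
      -- it by κ².
      quadratic : ∀ r e f g h → κ * r ≡ e * f + - (g * h) → r ≡ κ * (i * e * (i * f) + - (i * g * (i * h)))
      quadratic r e f g h eq = begin
        r                                            ≡⟨ trans (scale r) (cong (κ *_) (scale (i * r))) ⟩
        κ * (κ * (i * (i * r)))                      ≡⟨ (solve 3 (λ κ i r → κ :* (κ :* (i :* (i :* r))) := κ :* (i :* i :* (κ :* r))) refl κ i r) ⟩
        κ * (i * i * (κ * r))                        ≡⟨ cong (λ q → κ * (i * i * q)) eq ⟩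
        κ * (i * i * (e * f + - (g * h)))            ≡⟨ (solve 6 (λ κ i e f g h → κ :* (i :* i :* (e :* f :+ :- (g :* h))) := κ :* (i :* e :* (i :* f) :+ :- (i :* g :* (i :* h)))) refl κ i e f g h) ⟩
        κ * (i * e * (i * f) + - (i * g * (i * h)))  ∎
      entries : ∀ k l → A k l ≡ κ * Sim ⟨ i * w₁₁ , i * w₁₂ , i * w₂₁ , i * w₂₂ ⟩ (i * a₀ , i * b₀ , i * c₀) k l
      entries zero zero = quadratic α w₁₁ w₂₂ w₁₂ w₂₁ α≡
      entries zero (suc zero) = zero-entry (proj₁ x,y≡0)
      entries zero (suc (suc zero)) = zero-entry (proj₂ x,y≡0)
      entries zero (suc (suc (suc zero))) = zero-entry A₀₃≡0
      entries (suc zero) zero = quadratic r₁ w₁₂ b₀ w₁₁ c₀ (trans r₁≡ (cong₂ _-_ (*-comm _ _) (*-comm _ _)))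
      entries (suc zero) (suc zero) = scale w₁₁
      entries (suc zero) (suc (suc zero)) = scale w₁₂
      entries (suc zero) (suc (suc (suc zero))) = zero-entry A₁₃≡0
      entries (suc (suc zero)) zero = quadratic r₂ w₂₂ b₀ w₂₁ c₀ (trans r₂≡ (cong₂ _-_ (*-comm _ _) (*-comm _ _)))
      entries (suc (suc zero)) (suc zero) = scale w₂₁
      entries (suc (suc zero)) (suc (suc zero)) = scale w₂₂
      entries (suc (suc zero)) (suc (suc (suc zero))) = zero-entry A₂₃≡0
      entries (suc (suc (suc zero))) zero = scale a₀
      entries (suc (suc (suc zero))) (suc zero) = scale b₀
      entries (suc (suc (suc zero))) (suc (suc zero)) = scale c₀
      entries (suc (suc (suc zero))) (suc (suc (suc zero))) = sym (*-identityʳ κ)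

  Sim-last : ∀ X v j → Sim X v i3 j ≡ vec v j
  Sim-last X v zero                   = refl
  Sim-last X v (suc zero)             = refl
  Sim-last X v (suc (suc zero))       = refl
  Sim-last X v (suc (suc (suc zero))) = refl

  vec-Sim : ∀ v X w j → (vec v ·ᵥ Sim X w) j ≡ vec (act v X w) j
  vec-Sim (a , b , c) X w j = trans (Sim-· 𝟙₂ (a , b , c) X w i3 j) (Sim-last (𝟙₂ ⊗ X) (act (a , b , c) X w) j)

  Sim-identity : Sim 𝟙₂ origin ≡ₘ Id4
  Sim-identity zero zero = solve 0 (:1 :* :1 :+ :- (:0 :* :0) := :1) refl
  Sim-identity zero (suc zero) = refl
  Sim-identity zero (suc (suc zero)) = refl
  Sim-identity zero (suc (suc (suc zero))) = refl
  Sim-identity (suc zero) zero = solve 0 (:0 :* :0 :+ :- (:1 :* :0) := :0) refl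
  Sim-identity (suc zero) (suc zero) = refl
  Sim-identity (suc zero) (suc (suc zero)) = refl
  Sim-identity (suc zero) (suc (suc (suc zero))) = refl
  Sim-identity (suc (suc zero)) zero = solve 0 (:1 :* :0 :+ :- (:0 :* :0) := :0) refl
  Sim-identity (suc (suc zero)) (suc zero) = refl
  Sim-identity (suc (suc zero)) (suc (suc zero)) = refl
  Sim-identity (suc (suc zero)) (suc (suc (suc zero))) = refl
  Sim-identity (suc (suc (suc zero))) zero = refl
  Sim-identity (suc (suc (suc zero))) (suc zero) = refl
  Sim-identity (suc (suc (suc zero))) (suc (suc zero)) = refl
  Sim-identity (suc (suc (suc zero))) (suc (suc (suc zero))) = refl

  Sim-lower : ∀ s a b c → Sim (lower s) (a , b , c) ≡ₘ Emat a b c s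
  Sim-lower s a b c zero zero = (solve 1 (λ s → :1 :* :1 :+ :- (:0 :* s) := :1) refl s)
  Sim-lower s a b c zero (suc zero) = refl
  Sim-lower s a b c zero (suc (suc zero)) = refl
  Sim-lower s a b c zero (suc (suc (suc zero))) = refl
  Sim-lower s a b c (suc zero) zero = (solve 2 (λ b c → :0 :* b :+ :- (:1 :* c) := :- c) refl b c)
  Sim-lower s a b c (suc zero) (suc zero) = refl
  Sim-lower s a b c (suc zero) (suc (suc zero)) = refl
  Sim-lower s a b c (suc zero) (suc (suc (suc zero))) = refl
  Sim-lower s a b c (suc (suc zero)) zero = (solve 3 (λ b c s → :1 :* b :+ :- (s :* c) := b :- c :* s) refl b c s)
  Sim-lower s a b c (suc (suc zero)) (suc zero) = refl
  Sim-lower s a b c (suc (suc zero)) (suc (suc zero)) = refl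
  Sim-lower s a b c (suc (suc zero)) (suc (suc (suc zero))) = refl
  Sim-lower s a b c (suc (suc (suc zero))) zero = refl
  Sim-lower s a b c (suc (suc (suc zero))) (suc zero) = refl
  Sim-lower s a b c (suc (suc (suc zero))) (suc (suc zero)) = refl
  Sim-lower s a b c (suc (suc (suc zero))) (suc (suc (suc zero))) = refl

  -- The last diagonal entry is 1 on both sides and forces the scalar to be 1.
  Sim-injective : ∀ X v Y w → Sim X v ≃ₘ Sim Y w → X ≡ Y × v ≡ w
  Sim-injective X v Y w (k , _ , eq) =
    mat-≡ (entry i1 i1) (entry i1 i2) (entry i2 i1) (entry i2 i2) , pt-≡ (entry i3 i0) (entry i3 i1) (entry i3 i2)
    where
    k≡1 : k ≡ 1#
    k≡1 = trans (sym (*-identityʳ k)) (sym (eq i3 i3))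
    entry : ∀ i j → Sim X v i j ≡ Sim Y w i j
    entry i j = trans (eq i j) (trans (cong (_* Sim Y w i j) k≡1) (*-identityˡ _))

  det≢0 : ∀ X Y → X ⊗ Y ≡ 𝟙₂ → det X ≢ 0#
  det≢0 X Y XY≡1 det≡0 = 1≢0 (begin
    1#             ≡⟨ solve 0 (:1 :* :1 :+ :- (:0 :* :0) := :1) refl ⟨
    det 𝟙₂         ≡⟨ cong det XY≡1 ⟨
    det (X ⊗ Y)    ≡⟨ det-⊗ X Y ⟩
    det X * det Y  ≡⟨ trans (cong (_* det Y) det≡0) (zeroˡ _) ⟩
    0#             ∎)
    where open ≡-Reasoning

  Sim-similitude : ∀ Q x y → form (x ·ᵥ Sim Q origin) (y ·ᵥ Sim Q origin) ≡ det Q * form x y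
  Sim-similitude Q x y = trans
    (cong₂ _-_ (cong₂ _+_ (cong₂ _-_ (cong₂ _*_ (first x) (fourth y)) (cong₂ _*_ (fourth x) (first y)))
      (cong₂ _*_ (second x) (third y))) (cong₂ _*_ (third x) (second y)))
    (solve 12 (λ a b c d x₀ x₁ x₂ x₃ y₀ y₁ y₂ y₃ → x₀ :* (a :* d :+ :- (b :* c)) :* y₃ :- x₃ :* (y₀ :* (a :* d :+ :- (b :* c))) :+ (x₁ :* a :+ x₂ :* c) :* (y₁ :* b :+ y₂ :* d) :- (x₁ :* b :+ x₂ :* d) :* (y₁ :* a :+ y₂ :* c) := (a :* d :+ :- (b :* c)) :* (x₀ :* y₃ :- x₃ :* y₀ :+ x₁ :* y₂ :- x₂ :* y₁)) refl (e₁₁ Q) (e₁₂ Q) (e₂₁ Q) (e₂₂ Q) (x i0) (x i1) (x i2) (x i3) (y i0) (y i1) (y i2) (y i3))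
    where
    first : ∀ z → (z ·ᵥ Sim Q origin) i0 ≡ z i0 * det Q
    first z = (solve 8 (λ e f g h a b c d → e :+ f :* (b :* :0 :+ :- (a :* :0)) :+ g :* (d :* :0 :+ :- (c :* :0)) :+ h :* :0 := e) refl (z i0 * det Q) (z i1) (z i2) (z i3) (e₁₁ Q) (e₁₂ Q) (e₂₁ Q) (e₂₂ Q))
    second : ∀ z → (z ·ᵥ Sim Q origin) i1 ≡ z i1 * e₁₁ Q + z i2 * e₂₁ Q
    second z = (solve 4 (λ e f g h → e :* :0 :+ f :+ g :+ h :* :0 := f :+ g) refl (z i0) (z i1 * e₁₁ Q) (z i2 * e₂₁ Q) (z i3))
    third : ∀ z → (z ·ᵥ Sim Q origin) i2 ≡ z i1 * e₁₂ Q + z i2 * e₂₂ Q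
    third z = (solve 4 (λ e f g h → e :* :0 :+ f :+ g :+ h :* :0 := f :+ g) refl (z i0) (z i1 * e₁₂ Q) (z i2 * e₂₂ Q) (z i3))
    fourth : ∀ z → (z ·ᵥ Sim Q origin) i3 ≡ z i3
    fourth z = (solve 4 (λ e f g h → e :* :0 :+ f :* :0 :+ g :* :0 :+ h :* :1 := h) refl (z i0) (z i1) (z i2) (z i3))

  identityAut : FieldAut
  identityAut = record
    { σ = λ x → x ; σ⁻ = λ x → x ; σ-+ = λ _ _ → refl ; σ-* = λ _ _ → refl ; σ-1 = refl
    ; σ-inv₁ = λ _ → refl ; σ-inv₂ = λ _ → refl }

  Sim-invertible : ∀ Q P → Q ⊗ P ≡ 𝟙₂ → Invertible (Sim Q origin)
  Sim-invertible Q P QP≡1 = Sim P origin , λ i j → trans (Sim-· Q origin P origin i j)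
    (trans (cong₂ (λ X v → Sim X v i j) QP≡1 (act-origin P origin)) (Sim-identity i j))

  Sim-fixes-P : ∀ Q → det Q ≢ 0# → (eP ·ᵥ Sim Q origin) ∼ᵥ eP
  Sim-fixes-P Q det≢0 = det Q , det≢0 , λ where
    zero                   → (solve 3 (λ e f g → :1 :* e :+ :0 :* f :+ :0 :* g :+ :0 :* :0 := e :* :1) refl (det Q) (e₁₂ Q * 0# + - (e₁₁ Q * 0#)) (e₂₂ Q * 0# + - (e₂₁ Q * 0#)))
    (suc zero)             → (solve 3 (λ e f g → :1 :* :0 :+ :0 :* f :+ :0 :* g :+ :0 :* :0 := e :* :0) refl (det Q) (e₁₁ Q) (e₂₁ Q))
    (suc (suc zero))       → (solve 3 (λ e f g → :1 :* :0 :+ :0 :* f :+ :0 :* g :+ :0 :* :0 := e :* :0) refl (det Q) (e₁₂ Q) (e₂₂ Q))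
    (suc (suc (suc zero))) → (solve 1 (λ e → :1 :* :0 :+ :0 :* :0 :+ :0 :* :0 :+ :0 :* :1 := e :* :0) refl (det Q))

  Sim-∈-PΓSpP : ∀ Q P → Q ⊗ P ≡ 𝟙₂ → ∀ s → IsPΓSpP (Sim Q origin) s
  Sim-∈-PΓSpP Q P QP≡1 s = Sim-invertible Q P QP≡1 , (det Q , det≢0 Q P QP≡1 , Sim-similitude Q) , Sim-fixes-P Q (det≢0 Q P QP≡1)

  Conclusion : (Mat4 → Set) → Set
  Conclusion G = ∃[ A ] ∃[ s ] (IsPΓSpP A s ×
    ((∃[ S₁ ] ConjugateTo G A s (T-A S₁))
     ⊎
     (p ≡ 2 × 1 < m ×
      ∃[ ω ] ∃[ μ ] ∃[ f ] ∃[ s₀ ]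
        (ConstrE-params ω μ f s₀ × ConjugateTo G A s (T-E ω μ f s₀)))))

  -- Conjugation of the group into Construction A or E

  module Assemble (5≤q : 5 ≤ p ℕ.^ m) (G : Mat4 → Set) (W : Pt → M₂)
    (W-∙ : ∀ v w → W (act v (W w) w) ≡ W v ⊗ W w)
    (triangularisation : Triangularisation W)
    (G⇒W : ∀ g → G g → ∃[ v ] g ≃ₘ Sim (W v) v)
    (W⇒G : ∀ v → ∃[ g ] (G g × g ≃ₘ Sim (W v) v)) where

    open TriangularSystem W W-∙ triangularisation

    conjugates : ∀ T′ → (∀ a b c → T a b c ≡ T′ a b c) → ∀ g v → g ≃ₘ Sim (W v) v →
      let (a , b , c) = act v Q origin in (g ·ₘ Sim Q origin) ≃ₘ (Sim Q origin ·ₘ gT T′ a b c)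
    conjugates T′ T≡T′ g v g≃ = ≃-trans (≃-· {g} {Sim (W v) v} {Sim Q origin} {Sim Q origin} g≃ (≃-refl _))
      (≃-trans (≡⇒≃ equal) (≃-· {Sim Q origin} {Sim Q origin} {Sim (lower (t v)) (a , b , c)} {gT T′ a b c} (≃-refl _)
        (≡⇒≃ (λ i j → trans (Sim-lower (t v) a b c i j) (cong (λ s → Emat a b c s i j) (trans (sym (T-act-Q v)) (T≡T′ a b c)))))))
      where
      v′ = act v Q origin
      a = proj₁ v′
      b = proj₁ (proj₂ v′)
      c = proj₂ (proj₂ v′)
      equal : (Sim (W v) v ·ₘ Sim Q origin) ≡ₘ (Sim Q origin ·ₘ Sim (lower (t v)) v′)
      equal i j = trans (Sim-· (W v) v Q origin i j) (trans (cong₂ (λ X u → Sim X u i j) (W⊗Q v) (sym (act-origin (lower (t v)) v′)))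
        (sym (Sim-· Q origin (lower (t v)) v′ i j)))

    conjugate-to : ∀ T′ → (∀ a b c → T a b c ≡ T′ a b c) → ConjugateTo G (Sim Q origin) identityAut T′
    conjugate-to T′ T≡T′ = forth , back
      where
      forth : ∀ g → G g → ∃[ a ] ∃[ b ] ∃[ c ] ((g ·ₘ Sim Q origin) ≃ₘ (Sim Q origin ·ₘ gT T′ a b c))
      forth g Gg = let v , g≃ = G⇒W g Gg in _ , _ , _ , conjugates T′ T≡T′ g v g≃
      back : ∀ a b c → ∃[ g ] (G g × (g ·ₘ Sim Q origin) ≃ₘ (Sim Q origin ·ₘ gT T′ a b c))
      back a b c = let g , Gg , g≃ = W⇒G (act (a , b , c) P origin) in g , Gg ,
        subst (λ (a , b , c) → (g ·ₘ Sim Q origin) ≃ₘ (Sim Q origin ·ₘ gT T′ a b c))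
          (act-PQ P Q P⊗Q≡𝟙 (a , b , c)) (conjugates T′ T≡T′ g _ g≃)

    -- The bound q ≥ 5 excludes q = 2, as Construction E requires.
    1<m : p ≡ 2 → 1 < m
    1<m p≡2 with ℕ.m≤n⇒m<n∨m≡n m-pos
    ... | inj₁ 1<m = 1<m
    ... | inj₂ 1≡m = contradiction (subst (5 ≤_) (cong₂ ℕ._^_ p≡2 (sym 1≡m)) 5≤q) λ { (s≤s (s≤s ())) }

    conclusion : Conclusion G
    conclusion = Sim Q origin , identityAut , Sim-∈-PΓSpP Q P Q⊗P≡𝟙 identityAut ,
      [ (λ (S₁ , T≡) → inj₁ (S₁ , conjugate-to (T-A S₁) T≡))
      , (λ (p≡2 , ω , μ , f , s₀ , params , T≡) →
          inj₂ (p≡2 , 1<m p≡2 , ω , μ , f , s₀ , params , conjugate-to (T-E ω μ f s₀) T≡)) ]′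
      (Classification.formA-or-formE T T-hom)

  -- The function W of a regular group of collineations

  module RegularGroup (G : Mat4 → Set) (subgroup : IsPGLSubgroup G)
    (automorphisms : ∀ A → G A → IsQPAut A) (regular : ActsRegularlyOnQPPoints G) where

    abstract
      similar : ∀ A → G A → ∃[ X ] ∃[ v ] A ≃ₘ Sim X v
      similar A GA =
        let B , GB , AB≃1 = proj₂ (proj₂ subgroup) A GA
            C , _  , BC≃1 = proj₂ (proj₂ subgroup) B GB
        in NormalForm.normal-form A B AB≃1 (inverse-swap A B C AB≃1 BC≃1)
          (proj₁ (proj₂ (automorphisms A GA)))
          (λ a b c a′ b′ c′ → Equivalence.to (proj₂ (proj₂ (automorphisms A GA)) a b c a′ b′ c′))

    origin-row : ∀ A j → (vec origin ·ᵥ A) j ≡ A i3 j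
    origin-row A j = (solve 4 (λ e f g h → :0 :* e :+ :0 :* f :+ :0 :* g :+ :1 :* h := h) refl (A i0 j) (A i1 j) (A i2 j) (A i3 j))

    origin-image : ∀ A X v → A ≃ₘ Sim X v → (vec origin ·ᵥ A) ∼ᵥ vec v
    origin-image A X v (k , k≢0 , eq) = k , k≢0 , λ j →
      trans (origin-row A j) (trans (eq i3 j) (cong (k *_) (Sim-last X v j)))

    target : ∀ A X v v′ → A ≃ₘ Sim X v′ → (vec origin ·ᵥ A) ∼ᵥ vec v → v′ ≡ v
    target A X v v′ (k , k≢0 , eq′) (l , l≢0 , eq) = pt-≡ (coordinate i0) (coordinate i1) (coordinate i2)
      where
      last-row : ∀ j → k * Sim X v′ i3 j ≡ l * vec v j
      last-row j = trans (sym (eq′ i3 j)) (trans (sym (origin-row A j)) (eq j))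
      k≡l : k ≡ l
      k≡l = trans (sym (*-identityʳ k)) (trans (last-row i3) (*-identityʳ l))
      coordinate : ∀ j → Sim X v′ i3 j ≡ vec v j
      coordinate j = *-cancelˡ k _ _ k≢0 (trans (last-row j) (cong (_* vec v j) (sym k≡l)))

    element : ∀ v → ∃[ X ] ∃[ A ] (G A × A ≃ₘ Sim X v)
    element v@(a , b , c) =
      let A , GA , origin∼ = proj₁ regular 0# 0# 0# a b c
          X , v′ , A≃ = similar A GA
      in X , A , GA , subst (λ u → A ≃ₘ Sim X u) (target A X v v′ A≃ origin∼) A≃

    unique : ∀ A X B Y v → G A → G B → A ≃ₘ Sim X v → B ≃ₘ Sim Y v → A ≃ₘ B
    unique A X B Y v@(a , b , c) GA GB A≃ B≃ =
      proj₂ regular 0# 0# 0# a b c A B GA GB (origin-image A X v A≃) (origin-image B Y v B≃)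

    W : Pt → M₂
    W v = proj₁ (element v)

    W⇒G : ∀ v → ∃[ g ] (G g × g ≃ₘ Sim (W v) v)
    W⇒G v = proj₂ (element v)

    G⇒W : ∀ g → G g → ∃[ v ] g ≃ₘ Sim (W v) v
    G⇒W g Gg =
      let X , v , g≃ = similar g Gg
          A , GA , A≃ = W⇒G v
      in v , ≃-trans (unique g X A (W v) v Gg GA g≃ A≃) A≃

    -- The product of the elements at v and w and the element chosen at u send the origin to the
    -- same point, so regularity identifies them.
    W-∙ : ∀ v w → W (act v (W w) w) ≡ W v ⊗ W w
    W-∙ v w = multiplicative (W v) (W w) (W u) (W⇒G v) (W⇒G w) (W⇒G u)
      where
      u = act v (W w) w
      multiplicative : ∀ X Y Z → ∃[ A ] (G A × A ≃ₘ Sim X v) → ∃[ B ] (G B × B ≃ₘ Sim Y w) →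
        ∃[ D ] (G D × D ≃ₘ Sim Z (act v Y w)) → Z ≡ X ⊗ Y
      multiplicative X Y Z (A , GA , A≃) (B , GB , B≃) (D , GD , D≃) =
        let C , GC , C≃AB = proj₁ (proj₂ subgroup) A B GA GB
            C≃ = ≃-trans C≃AB (≃-trans (≃-· {A} {Sim X v} {B} {Sim Y w} A≃ B≃) (≡⇒≃ (Sim-· X v Y w)))
        in proj₁ (Sim-injective Z (act v Y w) (X ⊗ Y) (act v Y w)
             (≃-trans (≃-sym D≃) (≃-trans (unique D Z C (X ⊗ Y) (act v Y w) GD GC D≃ C≃) C≃)))

    -- An element that fixes v agrees at v with the identity of the group, so by regularity it is
    -- the identity.
    free : ∀ v w → act v (W w) w ≡ v → w ≡ origin × W w ≡ 𝟙₂
    free v@(a , b , c) w = trivial (W w) (W⇒G w) (proj₁ subgroup)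
      where
      scaled : ∀ {M N k} → (∀ i j → M i j ≡ k * N i j) → ∀ j → (vec v ·ᵥ M) j ≡ k * (vec v ·ᵥ N) j
      scaled {M} {N} {k} eq j = trans (cong₂ _+_ (cong₃ (λ e f g → a * e + b * f + c * g) (eq i0 j) (eq i1 j) (eq i2 j)) (cong (1# *_) (eq i3 j)))
        (solve 8 (λ a b c k e f g h → a :* (k :* e) :+ b :* (k :* f) :+ c :* (k :* g) :+ :1 :* (k :* h) := k :* (a :* e :+ b :* f :+ c :* g :+ :1 :* h)) refl a b c k (N i0 j) (N i1 j) (N i2 j) (N i3 j))
      trivial : ∀ X → ∃[ A ] (G A × A ≃ₘ Sim X w) → ∃[ E ] (G E × E ≃ₘ Id4) →
        act v X w ≡ v → w ≡ origin × X ≡ 𝟙₂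
      trivial X (A , GA , A≃@(k , k≢0 , eq)) (E , GE , E≃1@(l , l≢0 , eq′)) fixed = swap (Sim-injective X w 𝟙₂ origin
        (≃-trans (≃-sym A≃) (≃-trans (proj₂ regular a b c a b c A E GA GE fixed-A fixed-E)
          (≃-trans E≃1 (≃-sym (≡⇒≃ Sim-identity))))))
        where
        fixed-A : (vec v ·ᵥ A) ∼ᵥ vec v
        fixed-A = k , k≢0 , λ j → trans (scaled {A} {Sim X w} eq j)
          (cong (k *_) (trans (vec-Sim v X w j) (cong (λ u → vec u j) fixed)))
        fixed-E : (vec v ·ᵥ E) ∼ᵥ vec v
        fixed-E = l , l≢0 , λ j → trans (scaled {E} {Id4} eq′ j) (cong (l *_) (·ᵥ-Id (vec v) j))

  classification : 5 ≤ p ℕ.^ m → (G : Mat4 → Set) → IsPGLSubgroup G → (∀ A → G A → IsQPAut A) →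
         ActsRegularlyOnQPPoints G → Conclusion G
  classification 5≤q G subgroup automorphisms regular = Assemble.conclusion 5≤q G W W-∙ (RegularSystem.triangularisation W W-∙ free) G⇒W W⇒G
    where open RegularGroup G subgroup automorphisms regular

open import Data.Nat using (_^_)

theorem4p1 : (F : FiniteField) →
    let open Over F in
    5 ≤ p ^ m →
    (G : Mat4 → Set) →
    IsPGLSubgroup G →
    (∀ A → G A → IsQPAut A) →
    ActsRegularlyOnQPPoints G →
    ∃[ A ] ∃[ s ] (IsPΓSpP A s ×
    ((∃[ S₁ ] ConjugateTo G A s (T-A S₁))
    ⊎
    (p ≡ 2 × 1 < m ×
    ∃[ ω ] ∃[ μ ] ∃[ f ] ∃[ s₀ ]
    (ConstrE-params ω μ f s₀ × ConjugateTo G A s (T-E ω μ f s₀)))))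
theorem4p1 = Quadrangle.classification
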